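{- Let $T$ be a triangulation of a convex polygon, let $n$ be the number of arcs in $T$, and let $t$ be the number of interior triangles of $T$ (triangles of $T$ all three of whose sides are arcs of $T$; equivalently, the number of oriented 3-cycles in $Q_T$). Then every maximal green sequence for $Q_T$ has length at least $n + t$.
   Context: For a convex polygon $S$, an arc is a diagonal of $S$, and a triangulation $T$ is a maximal collection of arcs which pairwise do not intersect in the interior of $S$. The quiver $Q_T$ has one vertex for each arc of $T$, and for any two arcs $i, j$ that are sides of a common triangle $\Delta$ of $T$, an arrow $i \to j$ if $j$ follows $i$ in $\Delta$ with respect to the counterclockwise orientation of $S$. Mutation $\mu_k$ of a quiver at $k$: for every path $h \to k \to l$ add an arrow $h \to l$; reverse all arrows at $k$; remove a maximal collection of oriented 2-cycles. The framed quiver $\hat{Q}$ adds a frozen vertex $k'$ and an arrow $k \to k'$ for each vertex $k$; frozen vertices are never mutated. A non-frozen vertex is green if no arrow goes from a frozen vertex into it, and red if no arrow goes from it into a frozen vertex. A maximal green sequence for $Q$ is a finite sequence of mutations of $\hat{Q}$ at non-frozen vertices, each at a vertex green at that moment, after which all non-frozen vertices are red; its length is the number of mutations. -}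

module Defs where

open import Data.Nat using (ℕ; zero; suc; _+_; _*_; _∸_; _<_; _≤_; _<ᵇ_; _≡ᵇ_)
open import Data.Fin using (Fin; toℕ) renaming (zero to fz; suc to fs)
open import Data.Fin.Properties using () renaming (_≟_ to _≟ᶠ_)
open import Data.Bool using (Bool; true; false; _∧_; _∨_; if_then_else_)
open import Data.Product using (_×_; _,_; ∃)
open import Data.Sum using (_⊎_; inj₁; inj₂)
open import Data.List using (List; []; _∷_)
open import Relation.Nullary using (¬_; does)
open import Relation.Binary.PropositionalEquality using (_≡_; _≢_)
open import Relation.Binary.Definitions using (DecidableEquality)

-- Convex polygon S with m vertices labelled 0,1,…,m-1 in counterclockwise
-- order.  A segment between two vertices is stored as an ordered pair (a , b)
-- with toℕ a < toℕ b.

Seg : ℕ → Set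
Seg m = Fin m × Fin m

IsDiagonal : (m : ℕ) → Seg m → Set
IsDiagonal m (a , b) =
  (toℕ a < toℕ b) × (toℕ b ≢ suc (toℕ a)) × ¬ ((toℕ a ≡ 0) × (suc (toℕ b) ≡ m))

-- Two diagonals intersect in the interior of S iff their endpoints interleave.
Crosses : {m : ℕ} → Seg m → Seg m → Set
Crosses (a , b) (c , d) =
  ((toℕ a < toℕ c) × (toℕ c < toℕ b) × (toℕ b < toℕ d))
  ⊎ ((toℕ c < toℕ a) × (toℕ a < toℕ d) × (toℕ d < toℕ b))

record IsTriangulation (m n : ℕ) (T : Fin n → Seg m) : Set where
  field
    arcs      : ∀ i → IsDiagonal m (T i)
    distinct  : ∀ i j → T i ≡ T j → i ≡ j
    noncross  : ∀ i j → ¬ Crosses (T i) (T j)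
    maximal   : ∀ e → IsDiagonal m e → (∀ i → T i ≢ e) → ∃ λ i → Crosses e (T i)

sumFin : {k : ℕ} → (Fin k → ℕ) → ℕ
sumFin {zero}  f = 0
sumFin {suc k} f = f fz + sumFin (λ i → f (fs i))

anyFin : {k : ℕ} → (Fin k → Bool) → Bool
anyFin {zero}  f = false
anyFin {suc k} f = f fz ∨ anyFin (λ i → f (fs i))

b2n : Bool → ℕ
b2n true  = 1
b2n false = 0

module _ {m n : ℕ} (T : Fin n → Seg m) where

  isArcNo : Fin n → Fin m → Fin m → Bool
  isArcNo i x y with T i
  ... | (a , b) = (toℕ a ≡ᵇ toℕ x) ∧ (toℕ b ≡ᵇ toℕ y)

  isArc : Fin m → Fin m → Bool
  isArc x y = anyFin (λ i → isArcNo i x y)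

  isBoundary : Fin m → Fin m → Bool
  isBoundary x y = (suc (toℕ x) ≡ᵇ toℕ y) ∨ ((toℕ x ≡ᵇ 0) ∧ (suc (toℕ y) ≡ᵇ m))

  isSide : Fin m → Fin m → Bool
  isSide x y = isBoundary x y ∨ isArc x y

  isTriangle : Fin m → Fin m → Fin m → Bool
  isTriangle a b c = (toℕ a <ᵇ toℕ b) ∧ (toℕ b <ᵇ toℕ c)
                     ∧ isSide a b ∧ isSide b c ∧ isSide a c

  isInteriorTriangle : Fin m → Fin m → Fin m → Bool
  isInteriorTriangle a b c = (toℕ a <ᵇ toℕ b) ∧ (toℕ b <ᵇ toℕ c)
                     ∧ isArc a b ∧ isArc b c ∧ isArc a c

  interiorTriangles : ℕ
  interiorTriangles =
    sumFin λ a → sumFin λ b → sumFin λ c → b2n (isInteriorTriangle a b c)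

  -- In the triangle a < b < c (vertices counterclockwise), the sides in
  -- counterclockwise order are (a,b), (b,c), (c,a).  Number of ordered pairs of
  -- consecutive sides (i first, j following) in this triangle:
  follows : Fin n → Fin n → Fin m → Fin m → Fin m → ℕ
  follows i j a b c =
      b2n (isArcNo i a b ∧ isArcNo j b c)
    + b2n (isArcNo i b c ∧ isArcNo j a c)
    + b2n (isArcNo i a c ∧ isArcNo j a b)

-- Quivers on a vertex set V, given by the number of arrows u → v.

Quiver : Set → Set
Quiver V = V → V → ℕ

module _ {m n : ℕ} where
  QT : (T : Fin n → Seg m) → Quiver (Fin n)
  QT T i j = sumFin λ a → sumFin λ b → sumFin λ c →
    if isTriangle T a b c then follows T i j a b c else 0

-- Mutation at k: (1) for each path h → k → l add an arrow h → l,
-- (2) reverse all arrows at k, (3) remove a maximal collection of 2-cycles.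
mutate : {V : Set} → DecidableEquality V → V → Quiver V → Quiver V
mutate {V} _≟_ k Q h l = step12 h l ∸ step12 l h
  where
  step12 : V → V → ℕ
  step12 x y with does (x ≟ k) | does (y ≟ k)
  ... | true  | _     = Q y x
  ... | false | true  = Q y x
  ... | false | false = Q x y + Q x k * Q k y

-- Framed quiver: vertices inj₁ k (mutable) and inj₂ k (frozen k'),
-- with an extra arrow k → k' for each k.
FVert : ℕ → Set
FVert n = Fin n ⊎ Fin n

_≟F_ : {n : ℕ} → DecidableEquality (FVert n)
inj₁ i ≟F inj₁ j with i ≟ᶠ j
... | Relation.Nullary.yes Relation.Binary.PropositionalEquality.refl = Relation.Nullary.yes Relation.Binary.PropositionalEquality.refl
... | Relation.Nullary.no p = Relation.Nullary.no λ { Relation.Binary.PropositionalEquality.refl → p Relation.Binary.PropositionalEquality.refl }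
inj₁ i ≟F inj₂ j = Relation.Nullary.no λ ()
inj₂ i ≟F inj₁ j = Relation.Nullary.no λ ()
inj₂ i ≟F inj₂ j with i ≟ᶠ j
... | Relation.Nullary.yes Relation.Binary.PropositionalEquality.refl = Relation.Nullary.yes Relation.Binary.PropositionalEquality.refl
... | Relation.Nullary.no p = Relation.Nullary.no λ { Relation.Binary.PropositionalEquality.refl → p Relation.Binary.PropositionalEquality.refl }

framed : {n : ℕ} → Quiver (Fin n) → Quiver (FVert n)
framed Q (inj₁ i) (inj₁ j) = Q i j
framed Q (inj₁ i) (inj₂ j) = if does (i ≟ᶠ j) then 1 else 0
framed Q (inj₂ i) _        = 0

μ : {n : ℕ} → Fin n → Quiver (FVert n) → Quiver (FVert n)
μ k = mutate _≟F_ (inj₁ k)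

Green : {n : ℕ} → Quiver (FVert n) → Fin n → Set
Green Q k = ∀ j → Q (inj₂ j) (inj₁ k) ≡ 0

Red : {n : ℕ} → Quiver (FVert n) → Fin n → Set
Red Q k = ∀ j → Q (inj₁ k) (inj₂ j) ≡ 0

IsMaxGreenFrom : {n : ℕ} → Quiver (FVert n) → List (Fin n) → Set
IsMaxGreenFrom Q []       = ∀ k → Red Q k
IsMaxGreenFrom Q (k ∷ ks) = Green Q k × IsMaxGreenFrom (μ k Q) ks

IsMaximalGreenSequence : {n : ℕ} → Quiver (Fin n) → List (Fin n) → Set
IsMaximalGreenSequence Q ks = IsMaxGreenFrom (framed Q) ks

{-# OPTIONS --safe #-}

{-
The frozen arrows at an arc k of a triangulation reached from T by green mutations are the shear
coordinates at k of laminations close to the arcs of T, so a green mutation never meets a negative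
coordinate and in the end no coordinate is positive.  Let p q r s be a quadrilateral around an arc
p r of T.  Initially p r itself joins the boundary intervals [p , q) and [r , s).  A green flip
cannot create the first arc joining them, and at the end there is none, since an extremal one would
have a positive coordinate.  The flip that removes the last one takes place at an arc whose only
positive coordinate belongs to p r.

Now let p q r be an interior triangle, with s beyond p r and u beyond q r.  The flip that removes
the last arc joining [p , u) and [r , s) has positive coordinates exactly for p r and q r, unless
it also removes an arc of [p , q) and [r , s) while no arc of [q , u) and [r , p) is left.  The
exception cannot happen for all three rotations of p q r.  Thus every arc and every interior
triangle has a mutation of its own, recognised by the end points of the arcs with positive
coordinate.

In terms of the Jacobian algebra, "an arc joins [p , q) and [r , s)" says that the simple module of
p r lies in the current torsion class, and [p , u) and [r , s) play the same role for the module
of length two with composition factors p r and q r.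
-}

module Submission where

open import Defs
open import Algebra.Properties.CommutativeSemigroup using (interchange)
open import Data.Bool using (Bool; true; false; _∧_; _∨_; if_then_else_; T)
import Data.Bool.Properties as Boolₚ
open import Data.Empty using (⊥; ⊥-elim)
open import Data.Fin using (Fin; toℕ; fromℕ<; _↑ˡ_; _↑ʳ_; splitAt; join)
import Data.Fin as Fin
import Data.Fin.Properties as Finₚ
open import Data.Integer using (ℤ; +_; 0ℤ; 1ℤ; -[1+_]; -1ℤ)
import Data.Integer as ℤ
import Data.Integer.Properties as ℤₚ
open import Data.Integer.Tactic.RingSolver using (solve-∀)
open import Data.List using (List; []; _∷_; length)
open import Data.Maybe using (Maybe; just; nothing)
open import Data.Nat using (ℕ; zero; suc; _+_; _*_; _∸_; _≤_; _<_; z≤n; s≤s; _≤?_; _<?_; _≡ᵇ_; _<ᵇ_)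
import Data.Nat as ℕ
open import Data.Nat.Induction using (<-wellFounded)
import Data.Nat.Properties as ℕₚ
open import Data.Product using (_×_; _,_; proj₁; proj₂; ∃)
open import Data.Sum using (_⊎_; inj₁; inj₂; [_,_]′)
open import Data.Unit using (⊤; tt)
open import Data.Vec using (Vec; []; _∷_; lookup; tabulate; allFin)
open import Data.Vec.N-ary using (N-ary; ∀ⁿ; curryⁿ; _$ⁿ_)
import Data.Vec.Properties as Vecₚ
open import Function using (id)
open import Induction.WellFounded using (Acc; acc)
open import Relation.Binary using (tri<; tri≈; tri>)
open import Relation.Binary.Definitions using (DecidableEquality)
open import Relation.Binary.PropositionalEquality
open import Relation.Nullary using (¬_; Dec; yes; no; does)
open import Relation.Nullary.Decidable
  using (decidable-stable; _×-dec_; _⊎-dec_; _→-dec_; dec-true; dec-false; map′)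

-- For a quadrilateral `w x y z` around an arc, the coordinate of a lamination is
-- `(χ y - χ w) (χ z - χ x)`, where `χ` marks the vertices on one side of the lamination. Its sign
-- depends only on which pair of opposite sides the lamination meets. The geometry thus reduces to
-- cyclic orders of at most ten vertices, settled by a decision procedure for difference
-- constraints.
--
-- The lamination of an arc arises by moving both ends back by half an edge. This is why intervals
-- of vertices are half open, and why `p r` joins its own two intervals.
--
-- The bound is an injection into the steps. A step is labelled by the end points of the initial
-- arcs with positive coordinate there: two vertices for an arc, three for an interior triangle.
-- Labels of different size differ, and vertices determine the arc or the triangle.
--
-- The obstacle is that the step found for a triangle may be one that belongs to the arc `p r`. All
-- that is then known is that the simple of `p r` is still present while the simple of `q r` is
-- gone. If all three rotations were exceptional, each simple would outlive the next one around the
-- triangle, although an absent simple never returns.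

-- Deciding difference constraints

-- a, b, c occur in this order going once around the circle.
Cyc : ℕ → ℕ → ℕ → Set
Cyc a b c = (a < b × b < c) ⊎ (b < c × c < a) ⊎ (c < a × a < b)

cyc? : ∀ a b c → Dec (Cyc a b c)
cyc? a b c =
  (a <? b ×-dec b <? c) ⊎-dec (b <? c ×-dec c <? a) ⊎-dec (c <? a ×-dec a <? b)

-- leᶠ k i j means k + xᵢ ≤ xⱼ, and eqᶠ k i j means k + xᵢ ≡ xⱼ.
data Formula (n : ℕ) : Set where
  leᶠ eqᶠ       : ℕ → Fin n → Fin n → Formula n
  cyc         : Fin n → Fin n → Fin n → Formula n
  ff          : Formula n
  _∧ᶠ_ _∨ᶠ_ _⇒ᶠ_ : Formula n → Formula n → Formula n

infixr 6 _∧ᶠ_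
infixr 5 _∨ᶠ_
infixr 4 _⇒ᶠ_

module _ {n : ℕ} where

  ⟦_⟧ : Formula n → Vec ℕ n → Set
  ⟦ leᶠ k i j ⟧ ρ = k + lookup ρ i ≤ lookup ρ j
  ⟦ eqᶠ k i j ⟧ ρ = k + lookup ρ i ≡ lookup ρ j
  ⟦ cyc i j k ⟧ ρ = Cyc (lookup ρ i) (lookup ρ j) (lookup ρ k)
  ⟦ ff ⟧       ρ = ⊥
  ⟦ φ ∧ᶠ ψ ⟧   ρ = ⟦ φ ⟧ ρ × ⟦ ψ ⟧ ρ
  ⟦ φ ∨ᶠ ψ ⟧   ρ = ⟦ φ ⟧ ρ ⊎ ⟦ ψ ⟧ ρ
  ⟦ φ ⇒ᶠ ψ ⟧   ρ = ⟦ φ ⟧ ρ → ⟦ ψ ⟧ ρ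

  ⟦_⟧? : ∀ φ ρ → Dec (⟦ φ ⟧ ρ)
  ⟦ leᶠ k i j ⟧? ρ = k + lookup ρ i ≤? lookup ρ j
  ⟦ eqᶠ k i j ⟧? ρ = k + lookup ρ i ℕ.≟ lookup ρ j
  ⟦ cyc i j k ⟧? ρ = cyc? (lookup ρ i) (lookup ρ j) (lookup ρ k)
  ⟦ ff ⟧?       ρ = no λ ()
  ⟦ φ ∧ᶠ ψ ⟧?   ρ = ⟦ φ ⟧? ρ ×-dec ⟦ ψ ⟧? ρ
  ⟦ φ ∨ᶠ ψ ⟧?   ρ = ⟦ φ ⟧? ρ ⊎-dec ⟦ ψ ⟧? ρ
  ⟦ φ ⇒ᶠ ψ ⟧?   ρ = ⟦ φ ⟧? ρ →-dec ⟦ ψ ⟧? ρ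

  -- Entry (i , j) = just c records xᵢ + c ≤ xⱼ; the matrix is kept transitively closed.
  Bounds : Set
  Bounds = Vec (Vec (Maybe ℤ) n) n

  entry : Bounds → Fin n → Fin n → Maybe ℤ
  entry M i j = lookup (lookup M i) j

  _⊕_ : Maybe ℤ → Maybe ℤ → Maybe ℤ
  just c ⊕ just d  = just (c ℤ.+ d)
  just _ ⊕ nothing = nothing
  nothing ⊕ _      = nothing

  _⊔ᵐ_ : Maybe ℤ → Maybe ℤ → Maybe ℤ
  just c  ⊔ᵐ just d  = if c ℤ.≤ᵇ d then just d else just c
  just c  ⊔ᵐ nothing = just c
  nothing ⊔ᵐ d       = d

  noBounds : Bounds
  noBounds = tabulate λ i → tabulate λ j → if does (i Fin.≟ j) then just 0ℤ else nothing

  -- An improved bound from `a` to `b` uses the new one once: from `a` to `i`, across it, and from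
  -- `j` on to `b`. The zeros on the diagonal of `noBounds` cover `a = i` and `b = j`, so one pass
  -- restores closure.
  tighten : Fin n → ℤ → Fin n → Bounds → Bounds
  tighten i c j M =
    tabulate λ a → tabulate λ b → entry M a b ⊔ᵐ ((entry M a i ⊕ just c) ⊕ entry M j b)

  -- A bound and its reverse form a cycle; a total of at least 1 would put a number strictly below
  -- itself.
  exceeds : ℤ → Maybe ℤ → Bool
  exceeds c (just d) = 1ℤ ℤ.≤ᵇ (c ℤ.+ d)
  exceeds c nothing  = false

  implied : ℤ → Maybe ℤ → Bool
  implied c (just d) = c ℤ.≤ᵇ d
  implied c nothing  = false

  assume : Fin n → ℤ → Fin n → Bounds → (Bounds → Bool) → Bool
  assume i c j M k =
    if exceeds c (entry M j i) then true
    else if implied c (entry M i j) then k M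
    else k (tighten i c j M)

  impliesT impliesF : Formula n → Bounds → Bool
  impliesT (leᶠ a i j) M = implied (+ a) (entry M i j)
  impliesT (φ ∧ᶠ ψ)   M = impliesT φ M ∧ impliesT ψ M
  impliesT (φ ∨ᶠ ψ)   M = impliesT φ M ∨ impliesT ψ M
  impliesT (cyc i j k) M = (i≺j ∧ j≺k) ∨ (j≺k ∧ k≺i) ∨ (k≺i ∧ i≺j)
    where
    i≺j = implied 1ℤ (entry M i j)
    j≺k = implied 1ℤ (entry M j k)
    k≺i = implied 1ℤ (entry M k i)
  impliesT _          M = false
  -- Over the integers the negation of `a + xᵢ ≤ xⱼ` is `xⱼ + (1 - a) ≤ xᵢ`.
  impliesF (leᶠ a i j) M = implied (1ℤ ℤ.- + a) (entry M j i)
  impliesF (φ ∧ᶠ ψ)   M = impliesF φ M ∨ impliesF ψ M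
  impliesF (φ ∨ᶠ ψ)   M = impliesF φ M ∧ impliesF ψ M
  impliesF (cyc i j k) M = (j≼i ∧ k≼j) ∨ (k≼j ∧ i≼k) ∨ (i≼k ∧ j≼i)
    where
    j≼i = implied 0ℤ (entry M j i)
    k≼j = implied 0ℤ (entry M k j)
    i≼k = implied 0ℤ (entry M i k)
  impliesF _          M = false

  -- refuteT φ M k shows that φ contradicts M, where k is called on every strengthening of M
  -- that remains open; refuteF φ M k does the same for the negation of φ.
  refuteT refuteF : Formula n → Bounds → (Bounds → Bool) → Bool
  refuteT (leᶠ a i j) M k = assume i (+ a) j M k
  refuteT (eqᶠ a i j) M k = assume i (+ a) j M λ M′ → assume j (ℤ.- (+ a)) i M′ k
  refuteT (cyc h i j) M k =
    if impliesT (cyc h i j) M then k M else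
      assume h 1ℤ i M (λ M′ → assume i 1ℤ j M′ k) ∧
      assume i 1ℤ j M (λ M′ → assume j 1ℤ h M′ k) ∧
      assume j 1ℤ h M (λ M′ → assume h 1ℤ i M′ k)
  refuteT ff         M k = true
  refuteT (φ ∧ᶠ ψ)   M k = refuteT φ M λ M′ → refuteT ψ M′ k
  refuteT (φ ∨ᶠ ψ)   M k =
    if impliesT φ M ∨ impliesT ψ M then k M else refuteT φ M k ∧ refuteT ψ M k
  refuteT (φ ⇒ᶠ ψ)   M k =
    if impliesF φ M ∨ impliesT ψ M then k M else refuteF φ M k ∧ refuteT ψ M k
  refuteF (leᶠ a i j) M k = assume j (1ℤ ℤ.- + a) i M k
  refuteF (eqᶠ a i j) M k = assume j (1ℤ ℤ.- + a) i M k ∧ assume i (+ suc a) j M k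
  refuteF (cyc h i j) M k =
    if impliesF (cyc h i j) M then k M else
      assume j 0ℤ i M (λ M′ → assume i 0ℤ h M′ k) ∧
      assume i 0ℤ h M (λ M′ → assume h 0ℤ j M′ k) ∧
      assume h 0ℤ j M (λ M′ → assume j 0ℤ i M′ k)
  refuteF ff         M k = k M
  refuteF (φ ∧ᶠ ψ)   M k =
    if impliesF φ M ∨ impliesF ψ M then k M else refuteF φ M k ∧ refuteF ψ M k
  refuteF (φ ∨ᶠ ψ)   M k = refuteF φ M λ M′ → refuteF ψ M′ k
  refuteF (φ ⇒ᶠ ψ)   M k = refuteT φ M λ M′ → refuteF ψ M′ k

  module _ (ρ : Vec ℕ n) where

    infix 3 _+_⊑_
    _+_⊑_ : ℕ → ℤ → ℕ → Set
    x + c ⊑ y = + x ℤ.+ c ℤ.≤ + y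

    Bounded : Maybe ℤ → ℕ → ℕ → Set
    Bounded (just c) x y = x + c ⊑ y
    Bounded nothing  x y = ⊤

    Sound : Bounds → Set
    Sound M = ∀ i j → Bounded (entry M i j) (lookup ρ i) (lookup ρ j)

    ⊑-trans : ∀ {x y z} c d → x + c ⊑ y → y + d ⊑ z → x + c ℤ.+ d ⊑ z
    ⊑-trans {x} c d p q =
      ℤₚ.≤-trans (ℤₚ.≤-reflexive (sym (ℤₚ.+-assoc (+ x) c d)))
                 (ℤₚ.≤-trans (ℤₚ.+-monoˡ-≤ d p) q)

    ⊕-sound : ∀ {x y z} a b → Bounded a x y → Bounded b y z → Bounded (a ⊕ b) x z
    ⊕-sound (just c) (just d) p q = ⊑-trans c d p q
    ⊕-sound (just c) nothing  p q = tt
    ⊕-sound nothing  b        p q = tt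

    ⊔-sound : ∀ {x y} a b → Bounded a x y → Bounded b x y → Bounded (a ⊔ᵐ b) x y
    ⊔-sound (just c) (just d) p q with c ℤ.≤ᵇ d
    ... | true  = q
    ... | false = p
    ⊔-sound (just c) nothing p q = p
    ⊔-sound nothing  b       p q = q

    tabulate-sound : ∀ (f : Fin n → Fin n → Maybe ℤ) → (∀ i j → Bounded (f i j) (lookup ρ i) (lookup ρ j)) →
                     Sound (tabulate λ i → tabulate (f i))
    tabulate-sound f s i j
      rewrite Vecₚ.lookup∘tabulate (λ i → tabulate (f i)) i
            | Vecₚ.lookup∘tabulate (f i) j = s i j

    noBounds-sound : Sound noBounds
    noBounds-sound = tabulate-sound _ bound
      where
      bound : ∀ i j → Bounded (if does (i Fin.≟ j) then just 0ℤ else nothing)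
                              (lookup ρ i) (lookup ρ j)
      bound i j with i Fin.≟ j
      ... | yes refl = ℤₚ.≤-reflexive (ℤₚ.+-identityʳ _)
      ... | no  _    = tt

    tighten-sound : ∀ i c j M → Sound M → lookup ρ i + c ⊑ lookup ρ j → Sound (tighten i c j M)
    tighten-sound i c j M s h = tabulate-sound _ λ a b →
      ⊔-sound (entry M a b) _ (s a b)
        (⊕-sound (entry M a i ⊕ just c) (entry M j b)
          (⊕-sound (entry M a i) (just c) (s a i) h) (s j b))

    exceeds-sound : ∀ {x y} c b → exceeds c b ≡ true → x + c ⊑ y → Bounded b y x → ⊥
    exceeds-sound {x} c (just d) e p q = absurd (ℤₚ.≤-trans (ℤₚ.+-monoʳ-≤ (+ x) 1≤c+d) (⊑-trans c d p q))
      where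
      1≤c+d : 1ℤ ℤ.≤ c ℤ.+ d
      1≤c+d = ℤₚ.≤ᵇ⇒≤ (subst T (sym e) tt)
      absurd : + x ℤ.+ 1ℤ ℤ.≤ + x → ⊥
      absurd r = ℕₚ.n≮n x (subst (_≤ x) (ℕₚ.+-comm x 1) (ℤₚ.drop‿+≤+ r))

    Refutes : (Bounds → Bool) → Set
    Refutes k = ∀ M → Sound M → k M ≡ true → ⊥

    assume-sound : ∀ i c j M k → Sound M → Refutes k → lookup ρ i + c ⊑ lookup ρ j →
                   assume i c j M k ≡ true → ⊥
    assume-sound i c j M k s r h e with exceeds c (entry M j i) in ex
    ... | true  = exceeds-sound c (entry M j i) ex h (s j i)
    ... | false with implied c (entry M i j)
    ...   | true  = r M s e
    ...   | false = r _ (tighten-sound i c j M s h) e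

    ∧-true : ∀ a b → a ∧ b ≡ true → a ≡ true × b ≡ true
    ∧-true true true _ = refl , refl

    ≤⇒⊑ : ∀ a {x y} → a + x ≤ y → x + + a ⊑ y
    ≤⇒⊑ a {x} {y} h = ℤ.+≤+ (subst (_≤ y) (ℕₚ.+-comm a x) h)

    ≡⇒⊒ : ∀ a {x y} → a + x ≡ y → y + ℤ.- (+ a) ⊑ x
    ≡⇒⊒ a {x} refl = ℤₚ.≤-reflexive (lemma (+ a) (+ x))
      where
      lemma : ∀ a x → (a ℤ.+ x) ℤ.+ ℤ.- a ≡ x
      lemma = solve-∀

    ≰⇒⊑ : ∀ a {x y} → ¬ a + x ≤ y → y + 1ℤ ℤ.- + a ⊑ x
    ≰⇒⊑ a {x} {y} h =
      ℤₚ.≤-trans (ℤₚ.≤-reflexive (lemma (+ a) (+ y)))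
        (ℤₚ.≤-trans (ℤₚ.+-monoˡ-≤ (ℤ.- + a) (ℤ.+≤+ (ℕₚ.≰⇒> h)))
          (≡⇒⊒ a refl))
      where
      lemma : ∀ a y → y ℤ.+ (1ℤ ℤ.- a) ≡ (1ℤ ℤ.+ y) ℤ.+ ℤ.- a
      lemma = solve-∀

    <⇒⊑ : ∀ {x y} → x < y → x + 1ℤ ⊑ y
    <⇒⊑ = ≤⇒⊑ 1

    ≮⇒⊒ : ∀ {x y} → ¬ x < y → y + 0ℤ ⊑ x
    ≮⇒⊒ = ≰⇒⊑ 1

    assume₂-sound : ∀ i c j i′ c′ j′ M k → Sound M → Refutes k →
                    lookup ρ i + c ⊑ lookup ρ j → lookup ρ i′ + c′ ⊑ lookup ρ j′ →
                    assume i c j M (λ M′ → assume i′ c′ j′ M′ k) ≡ true → ⊥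
    assume₂-sound i c j i′ c′ j′ M k s r p q =
      assume-sound i c j M _ s (λ M′ s′ → assume-sound i′ c′ j′ M′ k s′ r q) p

    -- `Cyc` asks for two of the three ascents around the cycle, so its negation is that two of them
    -- fail; this too is a disjunction of conjunctions of bounds.
    ¬Cyc : ∀ {a b c} → ¬ Cyc a b c →
           (¬ b < c × ¬ a < b) ⊎ (¬ a < b × ¬ c < a) ⊎ (¬ c < a × ¬ b < c)
    ¬Cyc {a} {b} {c} h with a <? b | b <? c | c <? a
    ... | yes p | yes q | _     = ⊥-elim (h (inj₁ (p , q)))
    ... | yes p | no q  | yes r = ⊥-elim (h (inj₂ (inj₂ (r , p))))
    ... | yes p | no q  | no r  = inj₂ (inj₂ (r , q))
    ... | no p  | yes q | yes r = ⊥-elim (h (inj₂ (inj₁ (q , r))))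
    ... | no p  | yes q | no r  = inj₂ (inj₁ (p , r))
    ... | no p  | no q  | _     = inj₁ (q , p)

    skip : ∀ b {c M k} → Sound M → Refutes k → (c ≡ true → ⊥) →
           (if b then k M else c) ≡ true → ⊥
    skip true  s r f e = r _ s e
    skip false s r f e = f e

    refuteT-sound : ∀ φ M k → Sound M → Refutes k → ⟦ φ ⟧ ρ → refuteT φ M k ≡ true → ⊥
    refuteF-sound : ∀ φ M k → Sound M → Refutes k → ¬ ⟦ φ ⟧ ρ → refuteF φ M k ≡ true → ⊥
    refuteT-sound (leᶠ a i j) M k s r h e = assume-sound i (+ a) j M k s r (≤⇒⊑ a h) e
    refuteT-sound (eqᶠ a i j) M k s r h e =
      assume₂-sound i (+ a) j j (ℤ.- + a) i M k s r (≤⇒⊑ a (ℕₚ.≤-reflexive h)) (≡⇒⊒ a h) e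
    refuteT-sound (cyc h i j) M k s r p = skip (impliesT (cyc h i j) M) s r λ e → cases p (∧-true _ _ e)
      where
      cases : Cyc (lookup ρ h) (lookup ρ i) (lookup ρ j) → _ → ⊥
      cases (inj₁ (p , q)) (e , _) = assume₂-sound h _ i i _ j M k s r (<⇒⊑ p) (<⇒⊑ q) e
      cases (inj₂ (inj₁ (p , q))) (_ , e) =
        assume₂-sound i _ j j _ h M k s r (<⇒⊑ p) (<⇒⊑ q) (proj₁ (∧-true _ _ e))
      cases (inj₂ (inj₂ (p , q))) (_ , e) =
        assume₂-sound j _ h h _ i M k s r (<⇒⊑ p) (<⇒⊑ q) (proj₂ (∧-true _ _ e))
    refuteT-sound (φ ∧ᶠ ψ) M k s r (h , h′) e =
      refuteT-sound φ M _ s (λ M′ s′ → refuteT-sound ψ M′ k s′ r h′) h e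
    refuteT-sound (φ ∨ᶠ ψ) M k s r h = skip (impliesT φ M ∨ impliesT ψ M) s r λ e →
      [ (λ p → refuteT-sound φ M k s r p (proj₁ (∧-true _ _ e)))
      , (λ p → refuteT-sound ψ M k s r p (proj₂ (∧-true _ _ e))) ]′ h
    refuteT-sound (φ ⇒ᶠ ψ) M k s r h = skip (impliesF φ M ∨ impliesT ψ M) s r λ e →
      refuteF-sound φ M k s r
        (λ p → refuteT-sound ψ M k s r (h p) (proj₂ (∧-true _ _ e)))
        (proj₁ (∧-true _ _ e))
    refuteF-sound (leᶠ a i j) M k s r h e = assume-sound j _ i M k s r (≰⇒⊑ a h) e
    refuteF-sound (eqᶠ a i j) M k s r h e with a + lookup ρ i ≤? lookup ρ j
    ... | no  p = assume-sound j _ i M k s r (≰⇒⊑ a p) (proj₁ (∧-true _ _ e))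
    ... | yes p = assume-sound i _ j M k s r (≤⇒⊑ (suc a) (ℕₚ.≤∧≢⇒< p h)) (proj₂ (∧-true _ _ e))
    refuteF-sound (cyc h i j) M k s r p =
      skip (impliesF (cyc h i j) M) s r λ e → cases (¬Cyc p) (∧-true _ _ e)
      where
      cases : _ ⊎ _ → _ → ⊥
      cases (inj₁ (p , q)) (e , _) = assume₂-sound j _ i i _ h M k s r (≮⇒⊒ p) (≮⇒⊒ q) e
      cases (inj₂ (inj₁ (p , q))) (_ , e) =
        assume₂-sound i _ h h _ j M k s r (≮⇒⊒ p) (≮⇒⊒ q) (proj₁ (∧-true _ _ e))
      cases (inj₂ (inj₂ (p , q))) (_ , e) =
        assume₂-sound h _ j j _ i M k s r (≮⇒⊒ p) (≮⇒⊒ q) (proj₂ (∧-true _ _ e))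
    refuteF-sound ff M k s r h e = r M s e
    refuteF-sound (φ ∧ᶠ ψ) M k s r h = skip (impliesF φ M ∨ impliesF ψ M) s r λ e →
      refuteF-sound φ M k s r
        (λ p → refuteF-sound ψ M k s r (λ q → h (p , q)) (proj₂ (∧-true _ _ e)))
        (proj₁ (∧-true _ _ e))
    refuteF-sound (φ ∨ᶠ ψ) M k s r h e =
      refuteF-sound φ M _ s
        (λ M′ s′ → refuteF-sound ψ M′ k s′ r (λ q → h (inj₂ q))) (λ p → h (inj₁ p)) e
    refuteF-sound (φ ⇒ᶠ ψ) M k s r h e =
      h λ p → ⊥-elim (refuteT-sound φ M _ s
        (λ M′ s′ → refuteF-sound ψ M′ k s′ r (λ q → h (λ _ → q))) p e)

  -- The final continuation rejects every branch that is still open, so `true` means that the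
  -- negation of `φ` has been refuted on all branches.
  tautology : Formula n → Bool
  tautology φ = refuteF φ noBounds λ _ → false

  opaque
    tautology-sound : ∀ φ → tautology φ ≡ true → ∀ ρ → ⟦ φ ⟧ ρ
    tautology-sound φ e ρ = decidable-stable (⟦ φ ⟧? ρ) λ h →
      refuteF-sound ρ φ noBounds _ (noBounds-sound ρ) (λ _ _ ()) h e

∀ⁿ-intro : ∀ n {P : Vec ℕ n → Set} → (∀ ρ → P ρ) → ∀ⁿ n (curryⁿ P)
∀ⁿ-intro zero    h   = h []
∀ⁿ-intro (suc n) h x = ∀ⁿ-intro n λ ρ → h (x ∷ ρ)

-- The type of order n φ refl computes to the statement φ, with a quantifier for each of its n
-- variables; the lemmas proved by order therefore carry no further signature.
order : ∀ n (φ : N-ary n (Fin n) (Formula n)) → tautology (φ $ⁿ allFin n) ≡ true →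
        ∀ⁿ n (curryⁿ ⟦ φ $ⁿ allFin n ⟧)
order n φ e = ∀ⁿ-intro n (tautology-sound (φ $ⁿ allFin n) e)

module _ {n : ℕ} where

  infix 8 _<ᶠ_ _≤ᶠ_ _≡ᶠ_
  _<ᶠ_ _≤ᶠ_ _≡ᶠ_ : Fin n → Fin n → Formula n
  i <ᶠ j = leᶠ 1 i j
  i ≤ᶠ j = leᶠ 0 i j
  i ≡ᶠ j = eqᶠ 0 i j

  ¬ᶠ_ : Formula n → Formula n
  ¬ᶠ φ = φ ⇒ᶠ ff
  infix 7 ¬ᶠ_

-- Triangulations and flips

Same : (a b c d : ℕ) → Set
Same a b c d = (a ≡ c × b ≡ d) ⊎ (a ≡ d × b ≡ c)

same? : ∀ a b c d → Dec (Same a b c d)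
same? a b c d = (a ℕ.≟ c ×-dec b ℕ.≟ d) ⊎-dec (a ℕ.≟ d ×-dec b ℕ.≟ c)

Same-swap : ∀ {a b c d} → Same a b c d → Same a b d c
Same-swap (inj₁ p) = inj₂ p
Same-swap (inj₂ p) = inj₁ p

Cross : (a b c d : ℕ) → Set
Cross a b c d = (Cyc a c b × Cyc b d a) ⊎ (Cyc a d b × Cyc b c a)

[_,_∋_⟩ : (p q a : ℕ) → Set
[ p , q ∋ a ⟩ = p ≡ a ⊎ Cyc p a q

-- The form for ends of laminations: a point just before the vertex `a` lies on the boundary from
-- `p` to `q` exactly when `a` is after `p` and at most `q`.
⟨_,_∋_] : (p q a : ℕ) → Set
⟨ p , q ∋ a ] = a ≡ q ⊎ Cyc p a q

module _ {n : ℕ} where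

  same cross : (a b c d : Fin n) → Formula n
  same a b c d = (a ≡ᶠ c ∧ᶠ b ≡ᶠ d) ∨ᶠ (a ≡ᶠ d ∧ᶠ b ≡ᶠ c)
  cross a b c d = (cyc a c b ∧ᶠ cyc b d a) ∨ᶠ (cyc a d b ∧ᶠ cyc b c a)

  within withinʳ : (p q a : Fin n) → Formula n
  within p q a = p ≡ᶠ a ∨ᶠ cyc p a q
  withinʳ p q a = a ≡ᶠ q ∨ᶠ cyc p a q

  -- o stands for the vertex 0.
  boundary : (o m a b : Fin n) → Formula n
  boundary o m a b = eqᶠ 1 a b ∨ᶠ eqᶠ 1 b a ∨ᶠ (a ≡ᶠ o ∧ᶠ eqᶠ 1 b m) ∨ᶠ (b ≡ᶠ o ∧ᶠ eqᶠ 1 a m)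

cyc-rotate = order 3 (λ a b c → cyc a b c ⇒ᶠ cyc b c a) refl

cyc-distinct = order 3 (λ a b c → cyc a b c ⇒ᶠ ¬ᶠ a ≡ᶠ b ∧ᶠ ¬ᶠ b ≡ᶠ c ∧ᶠ ¬ᶠ a ≡ᶠ c) refl

quad-distinct = order 4 (λ w x y z → cyc w x y ⇒ᶠ cyc y z w ⇒ᶠ
  ¬ᶠ w ≡ᶠ x ∧ᶠ ¬ᶠ w ≡ᶠ y ∧ᶠ ¬ᶠ w ≡ᶠ z ∧ᶠ ¬ᶠ x ≡ᶠ y ∧ᶠ ¬ᶠ x ≡ᶠ z ∧ᶠ ¬ᶠ y ≡ᶠ z) refl

quad-turn = order 4 (λ w x y z → cyc w x y ⇒ᶠ cyc y z w ⇒ᶠ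
  cyc x y z ∧ᶠ cyc z w x) refl

cross-boundary = order 6 (λ o m a b c d → boundary o m a b ⇒ᶠ
  o ≤ᶠ a ⇒ᶠ o ≤ᶠ b ⇒ᶠ o ≤ᶠ c ⇒ᶠ o ≤ᶠ d ⇒ᶠ a <ᶠ m ⇒ᶠ b <ᶠ m ⇒ᶠ c <ᶠ m ⇒ᶠ d <ᶠ m ⇒ᶠ
  ¬ᶠ cross a b c d) refl

cross-sym = order 4 (λ a b c d → cross a b c d ⇒ᶠ cross c d a b) refl

cross-same = order 6 (λ a b c d c′ d′ → same c d c′ d′ ⇒ᶠ cross a b c′ d′ ⇒ᶠ cross a b c d) refl

-- If `e`, `a`, `a′`, `s` come in this order, then `e a′` crosses `a s`; so noncrossing sides leave
-- room for one apex only.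
apex-overlap = order 4 (λ s e a a′ → cyc s e a ⇒ᶠ cyc s e a′ ⇒ᶠ
  ¬ᶠ cross e a a′ s ⇒ᶠ ¬ᶠ cross e a′ a s ⇒ᶠ a ≡ᶠ a′) refl

quad-cross = order 4 (λ w x y z → cyc w x y ⇒ᶠ cyc y z w ⇒ᶠ cross w y x z) refl

-- A chord that crosses `x z` but no side can leave the quadrilateral only through a corner on
-- either side of `x z`. Hence only the old diagonal obstructs the new one.
quad-blocks = order 6 (λ w x y z c d → cyc w x y ⇒ᶠ cyc y z w ⇒ᶠ cross c d x z ⇒ᶠ
  ¬ᶠ cross w x c d ⇒ᶠ ¬ᶠ cross x y c d ⇒ᶠ ¬ᶠ cross y z c d ⇒ᶠ ¬ᶠ cross z w c d ⇒ᶠ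
  same w y c d) refl

cross-irrefl = order 2 (λ a b → ¬ᶠ cross a b a b) refl

same-sym = order 4 (λ a b c d → same a b c d ⇒ᶠ same c d a b) refl

opaque
  update : ℕ → ℕ → ℕ → (ℕ → ℕ → ℕ) → ℕ → ℕ → ℕ
  update a b v f s e = if does (a ℕ.≟ s ×-dec b ℕ.≟ e) then v else f s e

  update-hit : ∀ a b v f → update a b v f a b ≡ v
  update-hit a b v f rewrite dec-true (a ℕ.≟ a ×-dec b ℕ.≟ b) (refl , refl) = refl

  update-miss : ∀ a b v f {s e} → ¬ (a ≡ s × b ≡ e) → update a b v f s e ≡ f s e
  update-miss a b v f {s} {e} h rewrite dec-false (a ℕ.≟ s ×-dec b ℕ.≟ e) h = refl

-- apex s e is the third vertex of the triangle to the left of the directed arc s → e, and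
-- arbitrary if s → e is not an arc.
record Chords (n : ℕ) : Set where
  field
    src tgt : Fin n → ℕ
    apex    : ℕ → ℕ → ℕ

module _ {n : ℕ} (k : Fin n) (S : Chords n) where
  open Chords S

  private
    w = src k
    y = tgt k
    x = apex y w
    z = apex w y

  flip : Chords n
  flip = record
    { src  = λ h → if does (h Fin.≟ k) then x else src h
    ; tgt  = λ h → if does (h Fin.≟ k) then z else tgt h
    -- The new triangles are `w x z` and `x y z`; each of their six directed sides receives its
    -- opposite vertex.
    ; apex = update w x z (update x y z (update y z x (update z w x
               (update x z w (update z x y apex)))))
    }

module Polygon (m : ℕ) where

  Boundary : ℕ → ℕ → Set
  Boundary a b = suc a ≡ b ⊎ suc b ≡ a ⊎ (a ≡ 0 × suc b ≡ m) ⊎ (b ≡ 0 × suc a ≡ m)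

  boundary-swap : ∀ {a b} → Boundary a b → Boundary b a
  boundary-swap (inj₁ p) = inj₂ (inj₁ p)
  boundary-swap (inj₂ (inj₁ p)) = inj₁ p
  boundary-swap (inj₂ (inj₂ (inj₁ p))) = inj₂ (inj₂ (inj₂ p))
  boundary-swap (inj₂ (inj₂ (inj₂ p))) = inj₂ (inj₂ (inj₁ p))

  module Sides {n : ℕ} (S : Chords n) where
    open Chords S

    Arc : ℕ → ℕ → Set
    Arc a b = ∃ λ h → Same (src h) (tgt h) a b

    record Side (a b : ℕ) : Set where
      constructor side
      field
        a<m  : a < m
        b<m  : b < m
        edge : Boundary a b ⊎ Arc a b

    side-swap : ∀ {a b} → Side a b → Side b a
    side-swap (side p q (inj₁ r))       = side q p (inj₁ (boundary-swap r))
    side-swap (side p q (inj₂ (h , r))) = side q p (inj₂ (h , Same-swap r))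

    Triangle : (s e a : ℕ) → Set
    Triangle s e a = Cyc s e a × Side e a × Side a s

    boundary? : ∀ a b → Dec (Boundary a b)
    boundary? a b = suc a ℕ.≟ b ⊎-dec suc b ℕ.≟ a ⊎-dec
      (a ℕ.≟ 0 ×-dec suc b ℕ.≟ m) ⊎-dec (b ℕ.≟ 0 ×-dec suc a ℕ.≟ m)

    side? : ∀ a b → Dec (Side a b)
    side? a b = map′ (λ { (p , q , e) → side p q e }) (λ { (side p q e) → p , q , e })
      (a <? m ×-dec b <? m ×-dec (boundary? a b ⊎-dec Finₚ.any? λ h → same? (src h) (tgt h) a b))

    triangle? : ∀ s e a → Dec (Triangle s e a)
    triangle? s e a = cyc? s e a ×-dec side? e a ×-dec side? a s

    module _ (noncrossing : ∀ h h′ → ¬ Cross (src h) (tgt h) (src h′) (tgt h′)) where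

      sides-noncrossing : ∀ {a b c d} → Side a b → Side c d → ¬ Cross a b c d
      sides-noncrossing {a} {b} {c} {d} (side a< b< (inj₁ bd)) (side c< d< _) =
        cross-boundary 0 m a b c d bd z≤n z≤n z≤n z≤n a< b< c< d<
      sides-noncrossing {a} {b} {c} {d} (side a< b< (inj₂ _)) (side c< d< (inj₁ bd)) x =
        cross-boundary 0 m c d a b bd z≤n z≤n z≤n z≤n c< d< a< b< (cross-sym a b c d x)
      sides-noncrossing {a} {b} {c} {d} (side _ _ (inj₂ (h , p))) (side _ _ (inj₂ (h′ , p′))) x =
        noncrossing h h′
          (cross-same _ _ _ _ _ _ p′
            (cross-sym c d _ _ (cross-same c d _ _ _ _ p (cross-sym a b c d x))))

  open Sides using (Side; side; side-swap; Triangle; sides-noncrossing)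

  -- Maximality is replaced by a triangle on either side of every arc, a local condition that can be
  -- followed through a flip.
  record Triangulated {n : ℕ} (S : Chords n) : Set where
    open Chords S
    field
      noncrossing : ∀ h h′ → ¬ Cross (src h) (tgt h) (src h′) (tgt h′)
      distinct    : ∀ h h′ → Same (src h) (tgt h) (src h′) (tgt h′) → h ≡ h′
      triangle    : ∀ h {s e} → Same (src h) (tgt h) s e → Triangle S s e (apex s e)

  module Facts {n : ℕ} {S : Chords n} (tr : Triangulated S) where
    open Chords S
    open Triangulated tr

    bounded : ∀ h {s e} → Same (src h) (tgt h) s e → s < m × e < m
    bounded h p with triangle h p
    ... | _ , ea , as = Side.b<m as , Side.a<m ea

    arc-side : ∀ h {s e} → Same (src h) (tgt h) s e → Side S s e
    arc-side h p = side (proj₁ (bounded h p)) (proj₂ (bounded h p)) (inj₂ (h , p))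

    noncrossing-side : ∀ {a b c d} → Side S a b → Side S c d → ¬ Cross a b c d
    noncrossing-side = sides-noncrossing S noncrossing

    apex-unique : ∀ {s e a a′} → Triangle S s e a → Triangle S s e a′ → a ≡ a′
    apex-unique {s} {e} {a} {a′} (c , ea , as) (c′ , ea′ , as′) =
      apex-overlap s e a a′ c c′ (noncrossing-side ea as′) (noncrossing-side ea′ as)

  module Flip {n : ℕ} {S : Chords n} (tr : Triangulated S) (k : Fin n) where
    open Chords S
    open Triangulated tr
    open Facts tr

    S′ = flip k S
    open Chords S′ using () renaming (src to src′; tgt to tgt′; apex to apex′)

    w = src k
    y = tgt k
    x = apex y w
    z = apex w y

    wyz : Triangle S w y z
    wyz = triangle k (inj₁ (refl , refl))

    ywx : Triangle S y w x
    ywx = triangle k (inj₂ (refl , refl))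

    wxy : Cyc w x y
    wxy = cyc-rotate y w x (proj₁ ywx)

    yzw : Cyc y z w
    yzw = cyc-rotate w y z (proj₁ wyz)

    xyz : Cyc x y z
    xyz = proj₁ (quad-turn w x y z wxy yzw)

    zwx : Cyc z w x
    zwx = proj₂ (quad-turn w x y z wxy yzw)

    side-wx : Side S w x
    side-wx = proj₁ (proj₂ ywx)
    side-xy : Side S x y
    side-xy = proj₂ (proj₂ ywx)
    side-yz : Side S y z
    side-yz = proj₁ (proj₂ wyz)
    side-zw : Side S z w
    side-zw = proj₂ (proj₂ wyz)

    w≢x : w ≢ x
    w≢x = proj₁ (quad-distinct w x y z wxy yzw)
    w≢y : w ≢ y
    w≢y = proj₁ (proj₂ (quad-distinct w x y z wxy yzw))
    w≢z : w ≢ z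
    w≢z = proj₁ (proj₂ (proj₂ (quad-distinct w x y z wxy yzw)))
    x≢y : x ≢ y
    x≢y = proj₁ (proj₂ (proj₂ (proj₂ (quad-distinct w x y z wxy yzw))))
    x≢z : x ≢ z
    x≢z = proj₁ (proj₂ (proj₂ (proj₂ (proj₂ (quad-distinct w x y z wxy yzw)))))
    y≢z : y ≢ z
    y≢z = proj₂ (proj₂ (proj₂ (proj₂ (proj₂ (quad-distinct w x y z wxy yzw)))))

    -- Only the four sides of the quadrilateral, seen from inside, change their apex. Elsewhere
    -- `kept` records that the triangle does not have the flipped arc as another side, so that its
    -- sides survive and the turn of the flipped arc is zero.
    data Change (s e : ℕ) : Set where
      at-wx : s ≡ w → e ≡ x → apex s e ≡ y → apex′ s e ≡ z → Change s e
      at-xy : s ≡ x → e ≡ y → apex s e ≡ w → apex′ s e ≡ z → Change s e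
      at-yz : s ≡ y → e ≡ z → apex s e ≡ w → apex′ s e ≡ x → Change s e
      at-zw : s ≡ z → e ≡ w → apex s e ≡ y → apex′ s e ≡ x → Change s e
      kept  : ¬ Same w y e (apex s e) → ¬ Same w y (apex s e) s → apex′ s e ≡ apex s e → Change s e

    src-flip : ∀ {h} → h ≢ k → src′ h ≡ src h
    src-flip {h} h≢k rewrite dec-false (h Fin.≟ k) h≢k = refl
    tgt-flip : ∀ {h} → h ≢ k → tgt′ h ≡ tgt h
    tgt-flip {h} h≢k rewrite dec-false (h Fin.≟ k) h≢k = refl
    src-k : src′ k ≡ x
    src-k rewrite dec-true (k Fin.≟ k) refl = refl
    tgt-k : tgt′ k ≡ z
    tgt-k rewrite dec-true (k Fin.≟ k) refl = refl

    apex-wx : apex′ w x ≡ z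
    apex-wx = update-hit w x z _
    apex-xy : apex′ x y ≡ z
    apex-xy = trans (update-miss w x z _ λ p → w≢x (proj₁ p)) (update-hit x y z _)
    apex-yz : apex′ y z ≡ x
    apex-yz = trans (update-miss w x z _ λ p → w≢y (proj₁ p))
             (trans (update-miss x y z _ λ p → x≢y (proj₁ p)) (update-hit y z x _))
    apex-zw : apex′ z w ≡ x
    apex-zw = trans (update-miss w x z _ λ p → w≢z (proj₁ p))
             (trans (update-miss x y z _ λ p → x≢z (proj₁ p))
             (trans (update-miss y z x _ λ p → y≢z (proj₁ p)) (update-hit z w x _)))
    apex-xz : apex′ x z ≡ w
    apex-xz = trans (update-miss w x z _ λ p → w≢x (proj₁ p))
             (trans (update-miss x y z _ λ p → y≢z (proj₂ p))
             (trans (update-miss y z x _ λ p → x≢y (sym (proj₁ p)))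
             (trans (update-miss z w x _ λ p → w≢z (proj₂ p)) (update-hit x z w _))))
    apex-zx : apex′ z x ≡ y
    apex-zx = trans (update-miss w x z _ λ p → w≢z (proj₁ p))
             (trans (update-miss x y z _ λ p → x≢z (proj₁ p))
             (trans (update-miss y z x _ λ p → y≢z (proj₁ p))
             (trans (update-miss z w x _ λ p → w≢x (proj₂ p))
             (trans (update-miss x z w _ λ p → x≢z (proj₁ p)) (update-hit z x y _)))))

    apex-kept : ∀ {s e} → ¬ (w ≡ s × x ≡ e) → ¬ (x ≡ s × y ≡ e) → ¬ (y ≡ s × z ≡ e) →
                ¬ (z ≡ s × w ≡ e) → ¬ Same x z s e → apex′ s e ≡ apex s e
    apex-kept a b c d f =
      trans (update-miss w x z _ a) (trans (update-miss x y z _ b) (trans (update-miss y z x _ c)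
      (trans (update-miss z w x _ d) (trans (update-miss x z w _ λ p → f (inj₁ p))
      (update-miss z x y _ λ p → f (inj₂ (proj₂ p , proj₁ p)))))))

    ¬side-xz : ¬ Side S x z
    ¬side-xz s = noncrossing-side (arc-side k (inj₁ (refl , refl))) s (quad-cross w x y z wxy yzw)

    change : ∀ {h s e} → h ≢ k → Same (src h) (tgt h) s e → Change s e
    change {h} {s} {e} h≢k p with w ℕ.≟ s ×-dec x ℕ.≟ e | x ℕ.≟ s ×-dec y ℕ.≟ e
                                | y ℕ.≟ s ×-dec z ℕ.≟ e | z ℕ.≟ s ×-dec w ℕ.≟ e
    ... | yes (refl , refl) | _ | _ | _ =
      at-wx refl refl (apex-unique (triangle h p) (wxy , side-xy , side-yw)) apex-wx
      where side-yw = arc-side k (inj₂ (refl , refl))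
    ... | no _ | yes (refl , refl) | _ | _ =
      at-xy refl refl (apex-unique (triangle h p) (cyc-rotate w x y wxy , side-yw , side-wx)) apex-xy
      where side-yw = arc-side k (inj₂ (refl , refl))
    ... | no _ | no _ | yes (refl , refl) | _ =
      at-yz refl refl (apex-unique (triangle h p) (yzw , side-zw , side-wy)) apex-yz
      where side-wy = arc-side k (inj₁ (refl , refl))
    ... | no _ | no _ | no _ | yes (refl , refl) =
      at-zw refl refl (apex-unique (triangle h p) (cyc-rotate y z w yzw , side-wy , side-yz)) apex-zw
      where side-wy = arc-side k (inj₁ (refl , refl))
    ... | no a | no b | no c | no d =
      kept base base′ (apex-kept a b c d λ q → ¬side-xz (sideOf q))
      where
      t = triangle h p
      sideOf : Same x z s e → Side S x z
      sideOf (inj₁ (refl , refl)) = arc-side h p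
      sideOf (inj₂ (refl , refl)) = side-swap S (arc-side h p)
      rotate : ∀ {u} → apex s e ≡ u → Triangle S e u s
      rotate refl = cyc-rotate s e _ (proj₁ t) , proj₂ (proj₂ t) , arc-side h p
      rotate′ : ∀ {u} → apex s e ≡ u → Triangle S u s e
      rotate′ refl = cyc-rotate _ _ _ (cyc-rotate s e _ (proj₁ t)) , arc-side h p , proj₁ (proj₂ t)
      -- If the flipped arc were another side of this triangle, uniqueness of the apex over `w y` or
      -- `y w` would make `s e` one of the four sides excluded above.
      base : ¬ Same w y e (apex s e)
      base (inj₁ (refl , q)) = d (apex-unique wyz (rotate (sym q)) , refl)
      base (inj₂ (q , refl)) = b (apex-unique ywx (rotate (sym q)) , refl)
      base′ : ¬ Same w y (apex s e) s
      base′ (inj₁ (q , refl)) = c (refl , apex-unique wyz (rotate′ (sym q)))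
      base′ (inj₂ (refl , q)) = a (refl , apex-unique ywx (rotate′ (sym q)))

    side-kept : ∀ {a b} → Side S a b → ¬ Same w y a b → Side S′ a b
    side-kept (side p q (inj₁ r)) _ = side p q (inj₁ r)
    side-kept {a} {b} (side p q (inj₂ (h , r))) ¬k with h Fin.≟ k
    ... | yes refl = ⊥-elim (¬k r)
    ... | no h≢k = side p q (inj₂ (h , subst₂ (λ s t → Same s t a b)
                                              (sym (src-flip h≢k)) (sym (tgt-flip h≢k)) r))

    side′-wx : Side S′ w x
    side′-wx = side-kept side-wx λ { (inj₁ (_ , q)) → x≢y (sym q) ; (inj₂ (p , _)) → w≢x p }
    side′-xy : Side S′ x y
    side′-xy = side-kept side-xy λ { (inj₁ (p , _)) → w≢x p ; (inj₂ (p , _)) → w≢y p }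
    side′-yz : Side S′ y z
    side′-yz = side-kept side-yz λ { (inj₁ (p , _)) → w≢y p ; (inj₂ (p , _)) → w≢z p }
    side′-zw : Side S′ z w
    side′-zw = side-kept side-zw λ { (inj₁ (p , _)) → w≢z p ; (inj₂ (_ , q)) → y≢z q }
    side′-xz : Side S′ x z
    side′-xz = side (Side.b<m side-wx) (Side.b<m side-yz)
                    (inj₂ (k , inj₁ (src-k , tgt-k)))

    kept-noncrossing : ∀ {h} → h ≢ k → ¬ Cross (src h) (tgt h) x z
    kept-noncrossing {h} h≢k c = h≢k (sym (distinct k h
      (quad-blocks w x y z (src h) (tgt h) wxy yzw c (nc side-wx) (nc side-xy) (nc side-yz) (nc side-zw))))
      where
      nc : ∀ {a b} → Side S a b → ¬ Cross a b (src h) (tgt h)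
      nc s = noncrossing-side s (arc-side h (inj₁ (refl , refl)))

    kept-distinct : ∀ {h} → ¬ Same (src h) (tgt h) x z
    kept-distinct {h} p = ¬side-xz (arc-side h p)

    flip-triangulated : Triangulated S′
    flip-triangulated = record
      { noncrossing = noncrossing′ ; distinct = distinct′ ; triangle = triangle′ }
      where
      noncrossing′ : ∀ h h′ → ¬ Cross (src′ h) (tgt′ h) (src′ h′) (tgt′ h′)
      noncrossing′ h h′ c with h Fin.≟ k | h′ Fin.≟ k
      ... | yes _  | yes _   = cross-irrefl x z c
      ... | yes _  | no h′≢k = kept-noncrossing h′≢k (cross-sym x z _ _ c)
      ... | no h≢k | yes _   = kept-noncrossing h≢k c
      ... | no _   | no _    = noncrossing h h′ c

      distinct′ : ∀ h h′ → Same (src′ h) (tgt′ h) (src′ h′) (tgt′ h′) → h ≡ h′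
      distinct′ h h′ p with h Fin.≟ k | h′ Fin.≟ k
      ... | yes refl | yes refl = refl
      ... | yes _  | no h′≢k = ⊥-elim (kept-distinct (same-sym x z _ _ p))
      ... | no h≢k | yes _   = ⊥-elim (kept-distinct p)
      ... | no _   | no _    = distinct h h′ p

      triangle′ : ∀ h {s e} → Same (src′ h) (tgt′ h) s e → Triangle S′ s e (apex′ s e)
      triangle′ h {s} {e} p with h Fin.≟ k
      triangle′ h {s} {e} (inj₁ (refl , refl)) | yes _ =
        subst (Triangle S′ x z) (sym apex-xz)
          (cyc-rotate w x z (cyc-rotate z w x zwx) , side′-zw , side′-wx)
          
      triangle′ h {s} {e} (inj₂ (refl , refl)) | yes _ =
        subst (Triangle S′ z x) (sym apex-zx)
          (cyc-rotate y z x (cyc-rotate x y z xyz) , side′-xy , side′-yz)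
      triangle′ h {s} {e} p | no h≢k with change h≢k p
      ... | at-wx refl refl _ q = subst (Triangle S′ w x) (sym q)
              (cyc-rotate z w x zwx , side′-xz , side′-zw)
      ... | at-xy refl refl _ q = subst (Triangle S′ x y) (sym q)
              (xyz , side′-yz , side-swap S′ side′-xz)
      ... | at-yz refl refl _ q = subst (Triangle S′ y z) (sym q)
              (cyc-rotate x y z xyz , side-swap S′ side′-xz , side′-xy)
      ... | at-zw refl refl _ q = subst (Triangle S′ z w) (sym q)
              (zwx , side′-wx , side′-xz)
      ... | kept a b q = subst (Triangle S′ s e) (sym q)
              (proj₁ t , side-kept (proj₁ (proj₂ t)) a , side-kept (proj₂ (proj₂ t)) b)
        where t = triangle h p

-- Shear coordinates and mutation

module _ {V : Set} (_≟_ : DecidableEquality V) (k : V) (Q : Quiver V) where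

  mutate-at-left : ∀ v → mutate _≟_ k Q k v ≡ Q v k ∸ Q k v
  mutate-at-left v with k ≟ k | v ≟ k
  ... | yes _  | yes refl = refl
  ... | yes _  | no _     = refl
  ... | no k≢k | _        = ⊥-elim (k≢k refl)

  mutate-at-right : ∀ v → mutate _≟_ k Q v k ≡ Q k v ∸ Q v k
  mutate-at-right v with v ≟ k | k ≟ k
  ... | yes refl | yes _  = refl
  ... | no _     | yes _  = refl
  ... | _        | no k≢k = ⊥-elim (k≢k refl)

  mutate-away : ∀ {u v} → u ≢ k → v ≢ k →
                mutate _≟_ k Q u v ≡ (Q u v + Q u k * Q k v) ∸ (Q v u + Q v k * Q k u)
  mutate-away {u} {v} u≢k v≢k with u ≟ k | v ≟ k
  ... | yes p | _     = ⊥-elim (u≢k p)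
  ... | no _  | yes p = ⊥-elim (v≢k p)
  ... | no _  | no _  = refl

-- Positive parts of signed arrow counts

infix 9 _⁺
_⁺ : ℤ → ℕ
(+ n) ⁺    = n
-[1+ _ ] ⁺ = 0

⁺-⊖ : ∀ a b → (a ℤ.⊖ b) ⁺ ≡ a ∸ b
⁺-⊖ a b with ℕₚ.≤-total b a
... | inj₁ b≤a rewrite ℤₚ.⊖-≥ b≤a = refl
... | inj₂ a≤b rewrite ℤₚ.⊖-≤ a≤b | ℕₚ.m≤n⇒m∸n≡0 a≤b = neg⁺ (b ∸ a)
  where
  neg⁺ : ∀ n → (ℤ.- (+ n)) ⁺ ≡ 0
  neg⁺ zero    = refl
  neg⁺ (suc n) = refl

⁺-∸ : ∀ a → a ⁺ ∸ (ℤ.- a) ⁺ ≡ a ⁺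
⁺-∸ (+ zero)  = refl
⁺-∸ (+ suc n) = refl
⁺-∸ -[1+ n ]  = refl

-⁺-∸ : ∀ a → (ℤ.- a) ⁺ ∸ a ⁺ ≡ (ℤ.- a) ⁺
-⁺-∸ (+ zero)  = refl
-⁺-∸ (+ suc n) = ℕₚ.0∸n≡0 (suc n)
-⁺-∸ -[1+ n ]  = refl

⁺-split : ∀ b → + (b ⁺) ℤ.- + ((ℤ.- b) ⁺) ≡ b
⁺-split (+ zero)  = refl
⁺-split (+ suc n) = ℤₚ.+-identityʳ _
⁺-split -[1+ n ]  = refl

-- Cancelling 2-cycles by `∸` amounts to taking the positive part of the signed count, here after
-- `u` arrows are added one way and `v` the other way.
⁺-cancel : ∀ b u v → (b ⁺ + u) ∸ ((ℤ.- b) ⁺ + v) ≡ (b ℤ.+ + u ℤ.- + v) ⁺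
⁺-cancel b u v = begin
  (b ⁺ + u) ∸ ((ℤ.- b) ⁺ + v)                        ≡⟨ ⁺-⊖ (b ⁺ + u) ((ℤ.- b) ⁺ + v) ⟨
  ((b ⁺ + u) ℤ.⊖ ((ℤ.- b) ⁺ + v)) ⁺                  ≡⟨ cong _⁺ (ℤₚ.m-n≡m⊖n (b ⁺ + u) ((ℤ.- b) ⁺ + v)) ⟨
  ((+ (b ⁺) ℤ.+ + u) ℤ.- (+ ((ℤ.- b) ⁺) ℤ.+ + v)) ⁺  ≡⟨ cong _⁺ (regroup (+ (b ⁺)) (+ u) (+ ((ℤ.- b) ⁺)) (+ v)) ⟩
  ((+ (b ⁺) ℤ.- + ((ℤ.- b) ⁺)) ℤ.+ + u ℤ.- + v) ⁺    ≡⟨ cong (λ c → (c ℤ.+ + u ℤ.- + v) ⁺) (⁺-split b) ⟩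
  (b ℤ.+ + u ℤ.- + v) ⁺                              ∎
  where
  open ≡-Reasoning
  regroup : ∀ p u q v → (p ℤ.+ u) ℤ.- (q ℤ.+ v) ≡ (p ℤ.- q) ℤ.+ u ℤ.- v
  regroup = solve-∀

⁺-nonneg : ∀ {b} → 0ℤ ℤ.≤ b → + (b ⁺) ≡ b
⁺-nonneg {+ n} _ = refl

⁺-nonpos : ∀ {b} → b ℤ.≤ 0ℤ → b ⁺ ≡ 0
⁺-nonpos {+ n}      (ℤ.+≤+ z≤n) = refl
⁺-nonpos { -[1+ n ]} _           = refl

⊓-left : ∀ a b → a ℤ.⊓ b ≡ a ℤ.- + ((a ℤ.- b) ⁺)
⊓-left a b with ℤₚ.≤-total a b
... | inj₁ a≤b rewrite ⁺-nonpos (ℤₚ.i≤j⇒i-j≤0 a≤b) =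
  trans (ℤₚ.i≤j⇒i⊓j≡i a≤b) (sym (ℤₚ.+-identityʳ a))
... | inj₂ b≤a rewrite ⁺-nonneg (ℤₚ.i≤j⇒0≤j-i b≤a) =
  trans (ℤₚ.i≥j⇒i⊓j≡j b≤a) (lemma a b)
  where
  lemma : ∀ a b → b ≡ a ℤ.- (a ℤ.- b)
  lemma = solve-∀

χ : ∀ {P : Set} → Dec P → ℤ
χ d = if does d then 1ℤ else 0ℤ

χ-yes : ∀ {P : Set} (d : Dec P) → P → χ d ≡ 1ℤ
χ-yes d p rewrite dec-true d p = refl

χ-no : ∀ {P : Set} (d : Dec P) → ¬ P → χ d ≡ 0ℤ
χ-no d p rewrite dec-false d p = refl

χ-cong : ∀ {P P′ : Set} (d : Dec P) (d′ : Dec P′) → (P → P′) → (P′ → P) → χ d ≡ χ d′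
χ-cong (yes p) d′ f g = sym (χ-yes d′ (f p))
χ-cong (no ¬p) d′ f g = sym (χ-no d′ λ p′ → ¬p (g p′))

Weight : Set
Weight = ℕ → ℕ → ℤ

Symmetric : Weight → Set
Symmetric g = ∀ a b → g a b ≡ g b a

-- Counterclockwise in the triangle `s e a`, the side `s e` is followed by `e a` and preceded by
-- `a s`. For the indicator of an arc, `shear` is therefore the signed number of arrows to that arc.
turn : Weight → (s e a : ℕ) → ℤ
turn g s e a = g e a ℤ.- g a s

shear : ∀ {n} → Chords n → Fin n → Weight → ℤ
shear S h g = turn g (src h) (tgt h) (apex (src h) (tgt h))
          ℤ.+ turn g (tgt h) (src h) (apex (tgt h) (src h))
  where open Chords S

indicator : ∀ {n} → Chords n → Fin n → Weight
indicator S l a b = χ (same? (src l) (tgt l) a b)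
  where open Chords S

-- Cut c d is one of the two sets of vertices separated by the chord that joins the midpoints
-- of the boundary edges preceding c and d.
Cut : (c d a : ℕ) → Set
Cut c d a = c ≤ a × a < d

cut? : ∀ c d a → Dec (Cut c d a)
cut? c d a = (c ≤? a) ×-dec (a <? d)

-- The product is half of `χ a + χ b` minus half the number of crossings of `a b` with the
-- lamination. The linear terms cancel between the two triangles in `shear`, so this weight gives
-- integral shear coordinates.
lamination : (c d : ℕ) → Weight
lamination c d a b = χ (cut? c d a) ℤ.* χ (cut? c d b)

indicator-sym : ∀ {n} (S : Chords n) l → Symmetric (indicator S l)
indicator-sym S l a b = χ-cong (same? (src l) (tgt l) a b) (same? (src l) (tgt l) b a) Same-swap Same-swap
  where open Chords S

lamination-sym : ∀ c d → Symmetric (lamination c d)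
lamination-sym c d a b = ℤₚ.*-comm (χ (cut? c d a)) (χ (cut? c d b))

turn-cong : ∀ {g g′ : Weight} → (∀ a b → g a b ≡ g′ a b) → ∀ s e a → turn g s e a ≡ turn g′ s e a
turn-cong g≗g′ s e a = cong₂ ℤ._-_ (g≗g′ e a) (g≗g′ a s)

shear-cong : ∀ {n} (S : Chords n) h {g g′} → (∀ a b → g a b ≡ g′ a b) → shear S h g ≡ shear S h g′
shear-cong S h g≗g′ = cong₂ ℤ._+_ (turn-cong g≗g′ _ _ _) (turn-cong g≗g′ _ _ _)

module _ {n : ℕ} where
  cut : (c d a : Fin n) → Formula n
  cut c d a = c ≤ᶠ a ∧ᶠ a <ᶠ d

cut-noncrossing = order 6 (λ w x y z c d → cyc w x y ⇒ᶠ cyc y z w ⇒ᶠ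
  ¬ᶠ (cut c d w ∧ᶠ ¬ᶠ cut c d x ∧ᶠ cut c d y ∧ᶠ ¬ᶠ cut c d z)) refl

quad-sides-distinct = order 6 (λ w x y z c d → cyc w x y ⇒ᶠ cyc y z w ⇒ᶠ
  same c d w x ∨ᶠ same c d y z ⇒ᶠ ¬ᶠ same c d x y ∧ᶠ ¬ᶠ same c d z w) refl

-- The tropical Ptolemy relation. It has a minimum where crossing numbers have a maximum, since
-- crossings enter the weight of a lamination with a negative sign.
Ptolemy : Weight → (w x y z : ℕ) → Set
Ptolemy g w x y z = g w y ℤ.+ g x z ≡ (g w x ℤ.+ g y z) ℤ.⊓ (g x y ℤ.+ g z w)

lamination-ptolemy : ∀ c d {w x y z} → Cyc w x y → Cyc y z w → Ptolemy (lamination c d) w x y z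
lamination-ptolemy c d {w} {x} {y} {z} p q =
  go (cut? c d w) (cut? c d x) (cut? c d y) (cut? c d z)
  where
  go : (w∈ : Dec (Cut c d w)) (x∈ : Dec (Cut c d x)) (y∈ : Dec (Cut c d y)) (z∈ : Dec (Cut c d z)) →
       χ w∈ ℤ.* χ y∈ ℤ.+ χ x∈ ℤ.* χ z∈
         ≡ (χ w∈ ℤ.* χ x∈ ℤ.+ χ y∈ ℤ.* χ z∈) ℤ.⊓ (χ x∈ ℤ.* χ y∈ ℤ.+ χ z∈ ℤ.* χ w∈)
  go (yes w∈) (no x∉) (yes y∈) (no z∉) = ⊥-elim (cut-noncrossing w x y z c d p q (w∈ , x∉ , y∈ , z∉))
  go (no w∉) (yes x∈) (no y∉) (yes z∈) =
    ⊥-elim (cut-noncrossing x y z w c d (proj₁ t) (proj₂ t) (x∈ , y∉ , z∈ , w∉))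
    where t = quad-turn w x y z p q
  go (yes _) (yes _) (yes _) (yes _) = refl
  go (yes _) (yes _) (yes _) (no _)  = refl
  go (yes _) (yes _) (no _)  (yes _) = refl
  go (yes _) (yes _) (no _)  (no _)  = refl
  go (yes _) (no _)  (yes _) (yes _) = refl
  go (yes _) (no _)  (no _)  (yes _) = refl
  go (yes _) (no _)  (no _)  (no _)  = refl
  go (no _)  (yes _) (yes _) (yes _) = refl
  go (no _)  (yes _) (yes _) (no _)  = refl
  go (no _)  (yes _) (no _)  (no _)  = refl
  go (no _)  (no _)  (yes _) (yes _) = refl
  go (no _)  (no _)  (yes _) (no _)  = refl
  go (no _)  (no _)  (no _)  (yes _) = refl
  go (no _)  (no _)  (no _)  (no _)  = refl

-- The effect of a flip with shear coordinate κ on a turn τ; α is the turn of the flipped arc.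
data Shift (κ α τ τ′ : ℤ) : Set where
  up   : α ≡ 1ℤ → τ′ ≡ τ ℤ.+ + (κ ⁺) → Shift κ α τ τ′
  down : α ≡ -1ℤ → τ′ ≡ τ ℤ.- + ((ℤ.- κ) ⁺) → Shift κ α τ τ′
  none : α ≡ 0ℤ → τ′ ≡ τ → Shift κ α τ τ′

mutated : (κ α τ : ℤ) → ℤ
mutated κ α τ = τ ℤ.+ + (α ⁺) ℤ.* + (κ ⁺) ℤ.- + ((ℤ.- κ) ⁺) ℤ.* + ((ℤ.- α) ⁺)

Opposite : ℤ → ℤ → Set
Opposite α α′ = α ≡ 1ℤ × α′ ≡ -1ℤ

-- Positive parts add up only for turns that are not of opposite sign: for turns 1 and -1 the
-- mutation rule would change nothing, whereas the two shifts add up to `κ`.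
shift-add : ∀ {κ α₁ α₂ τ₁ τ₂ τ₁′ τ₂′} → Shift κ α₁ τ₁ τ₁′ → Shift κ α₂ τ₂ τ₂′ →
            ¬ Opposite α₁ α₂ → ¬ Opposite α₂ α₁ →
            τ₁′ ℤ.+ τ₂′ ≡ mutated κ (α₁ ℤ.+ α₂) (τ₁ ℤ.+ τ₂)
shift-add {κ} {τ₁ = a} {τ₂ = b} (up refl refl) (up refl refl) _ _ =
  lemma a b (+ (κ ⁺)) (+ ((ℤ.- κ) ⁺))
  where
  lemma : ∀ a b p q → (a ℤ.+ p) ℤ.+ (b ℤ.+ p) ≡ (a ℤ.+ b) ℤ.+ + 2 ℤ.* p ℤ.- q ℤ.* 0ℤ
  lemma = solve-∀
shift-add {κ} {τ₁ = a} {τ₂ = b} (down refl refl) (down refl refl) _ _ =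
  lemma a b (+ (κ ⁺)) (+ ((ℤ.- κ) ⁺))
  where
  lemma : ∀ a b p q → (a ℤ.- q) ℤ.+ (b ℤ.- q) ≡ (a ℤ.+ b) ℤ.+ 0ℤ ℤ.* p ℤ.- q ℤ.* + 2
  lemma = solve-∀
shift-add {κ} {τ₁ = a} {τ₂ = b} (none refl refl) (none refl refl) _ _ =
  lemma a b (+ (κ ⁺)) (+ ((ℤ.- κ) ⁺))
  where
  lemma : ∀ a b p q → a ℤ.+ b ≡ (a ℤ.+ b) ℤ.+ 0ℤ ℤ.* p ℤ.- q ℤ.* 0ℤ
  lemma = solve-∀
shift-add {κ} {τ₁ = a} {τ₂ = b} (up refl refl) (none refl refl) _ _ =
  lemma a b (+ (κ ⁺)) (+ ((ℤ.- κ) ⁺))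
  where
  lemma : ∀ a b p q → (a ℤ.+ p) ℤ.+ b ≡ (a ℤ.+ b) ℤ.+ 1ℤ ℤ.* p ℤ.- q ℤ.* 0ℤ
  lemma = solve-∀
shift-add {κ} {τ₁ = a} {τ₂ = b} (none refl refl) (up refl refl) _ _ =
  lemma a b (+ (κ ⁺)) (+ ((ℤ.- κ) ⁺))
  where
  lemma : ∀ a b p q → a ℤ.+ (b ℤ.+ p) ≡ (a ℤ.+ b) ℤ.+ 1ℤ ℤ.* p ℤ.- q ℤ.* 0ℤ
  lemma = solve-∀
shift-add {κ} {τ₁ = a} {τ₂ = b} (down refl refl) (none refl refl) _ _ =
  lemma a b (+ (κ ⁺)) (+ ((ℤ.- κ) ⁺))
  where
  lemma : ∀ a b p q → (a ℤ.- q) ℤ.+ b ≡ (a ℤ.+ b) ℤ.+ 0ℤ ℤ.* p ℤ.- q ℤ.* 1ℤ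
  lemma = solve-∀
shift-add {κ} {τ₁ = a} {τ₂ = b} (none refl refl) (down refl refl) _ _ =
  lemma a b (+ (κ ⁺)) (+ ((ℤ.- κ) ⁺))
  where
  lemma : ∀ a b p q → a ℤ.+ (b ℤ.- q) ≡ (a ℤ.+ b) ℤ.+ 0ℤ ℤ.* p ℤ.- q ℤ.* 1ℤ
  lemma = solve-∀
shift-add (up p _) (down q _) h _ = ⊥-elim (h (p , q))
shift-add (down q _) (up p _) _ h = ⊥-elim (h (p , q))

-- One signed number describes the arrows in both directions, because at most one of the two counts
-- is nonzero.
record Row {n : ℕ} (Q : Quiver (FVert n)) (h : Fin n) (l : FVert n) (β : ℤ) : Set where
  constructor row
  field
    outgoing : Q (inj₁ h) l ≡ β ⁺
    incoming : Q l (inj₁ h) ≡ (ℤ.- β) ⁺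

row-away : ∀ {n} {Q : Quiver (FVert n)} {h k l α β κ} → h ≢ k → l ≢ inj₁ k →
           Row Q h (inj₁ k) α → Row Q h l β → Row Q k l κ → Row (μ k Q) h l (mutated κ α β)
row-away {Q = Q} {h} {k} {l} {α} {β} {κ} h≢k l≢k (row hk kh) (row hl lh) (row kl lk) = row forth back
  where
  inj≢ : inj₁ h ≢ inj₁ k
  inj≢ refl = h≢k refl
  open ≡-Reasoning
  u = α ⁺ * κ ⁺
  v = (ℤ.- κ) ⁺ * (ℤ.- α) ⁺
  shape : β ℤ.+ + u ℤ.- + v ≡ mutated κ α β
  shape = cong₂ (λ p q → β ℤ.+ p ℤ.- q) (ℤₚ.pos-* (α ⁺) (κ ⁺)) (ℤₚ.pos-* ((ℤ.- κ) ⁺) _)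
  forth : μ k Q (inj₁ h) l ≡ (mutated κ α β) ⁺
  forth = begin
    μ k Q (inj₁ h) l
      ≡⟨ mutate-away _≟F_ (inj₁ k) Q inj≢ l≢k ⟩
    _
      ≡⟨ cong₂ _∸_ (cong₂ _+_ hl (cong₂ _*_ hk kl)) (cong₂ _+_ lh (cong₂ _*_ lk kh)) ⟩
    (β ⁺ + u) ∸ ((ℤ.- β) ⁺ + v)
      ≡⟨ ⁺-cancel β u v ⟩
    (β ℤ.+ + u ℤ.- + v) ⁺
      ≡⟨ cong _⁺ shape ⟩
    (mutated κ α β) ⁺
      ∎
  back : μ k Q l (inj₁ h) ≡ (ℤ.- mutated κ α β) ⁺
  back = begin
    μ k Q l (inj₁ h)
      ≡⟨ mutate-away _≟F_ (inj₁ k) Q l≢k inj≢ ⟩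
    _
      ≡⟨ cong₂ _∸_ (cong₂ _+_ lh (cong₂ _*_ lk kh)) (cong₂ _+_ hl (cong₂ _*_ hk kl)) ⟩
    ((ℤ.- β) ⁺ + v) ∸ (β ⁺ + u)
      ≡⟨ cong (λ b → ((ℤ.- β) ⁺ + v) ∸ (b ⁺ + u)) (ℤₚ.neg-involutive β) ⟨
    ((ℤ.- β) ⁺ + v) ∸ ((ℤ.- ℤ.- β) ⁺ + u)
      ≡⟨ ⁺-cancel (ℤ.- β) v u ⟩
    (ℤ.- β ℤ.+ + v ℤ.- + u) ⁺
      ≡⟨ cong _⁺ (lemma β (+ u) (+ v)) ⟩
    (ℤ.- (β ℤ.+ + u ℤ.- + v)) ⁺
      ≡⟨ cong (λ c → (ℤ.- c) ⁺) shape ⟩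
    (ℤ.- mutated κ α β) ⁺
      ∎
    where
    lemma : ∀ b u v → ℤ.- b ℤ.+ v ℤ.- u ≡ ℤ.- (b ℤ.+ u ℤ.- v)
    lemma = solve-∀

row-at-source : ∀ {n} {Q : Quiver (FVert n)} {k l κ} → Row Q k l κ → Row (μ k Q) k l (ℤ.- κ)
row-at-source {Q = Q} {k} {l} {κ} (row kl lk) = row
  (trans (mutate-at-left _≟F_ (inj₁ k) Q l) (trans (cong₂ _∸_ lk kl) (-⁺-∸ κ)))
  (trans (mutate-at-right _≟F_ (inj₁ k) Q l)
    (trans (cong₂ _∸_ kl lk) (trans (⁺-∸ κ) (cong _⁺ (sym (ℤₚ.neg-involutive κ))))))

row-at-target : ∀ {n} {Q : Quiver (FVert n)} {k h α} → Row Q h (inj₁ k) α →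
                Row (μ k Q) h (inj₁ k) (ℤ.- α)
row-at-target {Q = Q} {k} {h} {α} (row hk kh) = row
  (trans (mutate-at-right _≟F_ (inj₁ k) Q (inj₁ h)) (trans (cong₂ _∸_ kh hk) (-⁺-∸ α)))
  (trans (mutate-at-left _≟F_ (inj₁ k) Q (inj₁ h))
    (trans (cong₂ _∸_ hk kh) (trans (⁺-∸ α) (cong _⁺ (sym (ℤₚ.neg-involutive α))))))

-- Flips mutate shear coordinates

module FlipWeights {m n : ℕ} {S : Chords n} (tr : Polygon.Triangulated m S) (k : Fin n) where
  open Chords S
  open Polygon.Triangulated tr
  open Polygon.Sides m S
  open Polygon.Facts m tr
  open Polygon.Flip m tr k
  open Chords S′ using () renaming (src to src′; tgt to tgt′; apex to apex′)

  turn-sign : ∀ {s e} → Change s e → ℤ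
  turn-sign (at-wx _ _ _ _) = -1ℤ
  turn-sign (at-xy _ _ _ _) = 1ℤ
  turn-sign (at-yz _ _ _ _) = -1ℤ
  turn-sign (at-zw _ _ _ _) = 1ℤ
  turn-sign (kept _ _ _)    = 0ℤ

  turn-k : ∀ {s e} (c : Change s e) → turn (indicator S k) s e (apex s e) ≡ turn-sign c
  turn-k (at-wx refl refl p q) rewrite p =
    cong₂ ℤ._-_ (χ-no (same? w y x y) λ { (inj₁ (p , _)) → w≢x p ; (inj₂ (p , _)) → w≢y p })
                (χ-yes (same? w y y w) (inj₂ (refl , refl)))
  turn-k (at-yz refl refl p q) rewrite p =
    cong₂ ℤ._-_ (χ-no (same? w y z w) λ { (inj₁ (p , _)) → w≢z p ; (inj₂ (_ , p)) → y≢z p })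
                (χ-yes (same? w y w y) (inj₁ (refl , refl)))
  turn-k (at-xy refl refl p q) rewrite p =
    cong₂ ℤ._-_ (χ-yes (same? w y y w) (inj₂ (refl , refl)))
                (χ-no (same? w y w x) λ { (inj₁ (_ , p)) → x≢y (sym p) ; (inj₂ (p , _)) → w≢x p })
  turn-k (at-zw refl refl p q) rewrite p =
    cong₂ ℤ._-_ (χ-yes (same? w y w y) (inj₁ (refl , refl)))
                (χ-no (same? w y y z) λ { (inj₁ (p , _)) → w≢y p ; (inj₂ (p , _)) → w≢z p })
  turn-k (kept p q r) = cong₂ ℤ._-_ (χ-no (same? w y _ _) p) (χ-no (same? w y _ _) q)

  -- Turn 1 occurs at `x y` and `z w`, turn -1 at `w x` and `y z`. No side of the first pair is the
  -- reverse of one of the second, as the four corners are distinct.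
  turn-opposite : ∀ {s e} → Change s e → Change e s →
                  ¬ Opposite (turn (indicator S k) s e (apex s e)) (turn (indicator S k) e s (apex e s))
  turn-opposite c d (p , q) = go c d (trans (sym (turn-k c)) p) (trans (sym (turn-k d)) q)
    where
    go : ∀ {s e} (c : Change s e) (d : Change e s) → turn-sign c ≡ 1ℤ → turn-sign d ≡ -1ℤ → ⊥
    go (at-xy refl refl _ _) (at-wx q _ _ _) _ _ = w≢y (sym q)
    go (at-xy refl refl _ _) (at-yz _ q _ _) _ _ = x≢z q
    go (at-zw refl refl _ _) (at-wx _ q _ _) _ _ = x≢z (sym q)
    go (at-zw refl refl _ _) (at-yz q _ _ _) _ _ = w≢y q
    go (at-wx _ _ _ _) _ () _
    go (at-yz _ _ _ _) _ () _
    go (kept _ _ _) _ () _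
    go (at-xy _ _ _ _) (at-xy _ _ _ _) _ ()
    go (at-xy _ _ _ _) (at-zw _ _ _ _) _ ()
    go (at-xy _ _ _ _) (kept _ _ _) _ ()
    go (at-zw _ _ _ _) (at-xy _ _ _ _) _ ()
    go (at-zw _ _ _ _) (at-zw _ _ _ _) _ ()
    go (at-zw _ _ _ _) (kept _ _ _) _ ()

  module Weighted (g : Weight) (g-sym : Symmetric g) where

    A = g w x ℤ.+ g y z
    B = g x y ℤ.+ g z w
    κ = shear S k g

    κ≡A-B : κ ≡ A ℤ.- B
    κ≡A-B = lemma (g w x) (g x y) (g y z) (g z w)
      where
      lemma : ∀ a b c d → (c ℤ.- d) ℤ.+ (a ℤ.- b) ≡ (a ℤ.+ c) ℤ.- (b ℤ.+ d)
      lemma = solve-∀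

    shear-flip-k : shear S′ k g ≡ ℤ.- κ
    shear-flip-k =
      trans (cong₂ (λ s e → turn g s e (apex′ s e) ℤ.+ turn g e s (apex′ e s)) src-k tgt-k)
        (trans (cong₂ (λ a b → turn g x z a ℤ.+ turn g z x b) apex-xz apex-zx)
               (lemma (g w x) (g x y) (g y z) (g z w)))
      where
      lemma : ∀ a b c d → (d ℤ.- a) ℤ.+ (b ℤ.- c) ≡ ℤ.- ((c ℤ.- d) ℤ.+ (a ℤ.- b))
      lemma = solve-∀

    module _ (pt : Ptolemy g w x y z) where

      -- The minimum is written in two ways, as `A - (A - B)⁺` for the sides `x y` and `z w`, whose
      -- turn grows, and as `B - (B - A)⁺` for `w x` and `y z`, whose turn shrinks.
      diagonals : g w y ℤ.+ g x z ≡ A ℤ.- + (κ ⁺)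
      diagonals = trans pt (trans (⊓-left A B) (cong (λ c → A ℤ.- + (c ⁺)) (sym κ≡A-B)))

      diagonals′ : g w y ℤ.+ g x z ≡ B ℤ.- + ((ℤ.- κ) ⁺)
      diagonals′ = trans pt (trans (ℤₚ.⊓-comm A B) (trans (⊓-left B A)
        (cong (λ c → B ℤ.- + (c ⁺)) (trans (lemma A B) (cong ℤ.-_ (sym κ≡A-B))))))
        where
        lemma : ∀ a b → b ℤ.- a ≡ ℤ.- (a ℤ.- b)
        lemma = solve-∀

      change-shift : ∀ {s e} → Change s e →
        Shift κ (turn (indicator S k) s e (apex s e)) (turn g s e (apex s e)) (turn g s e (apex′ s e))
      change-shift c@(at-wx refl refl p q) = down (turn-k c) goal
        where
        -- The old diagonal is added and subtracted, so that the sum of both diagonals appears and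
        -- Ptolemy applies.
        lemma : ∀ xz zw wy xy → xz ℤ.- zw ≡ (wy ℤ.+ xz) ℤ.- xy ℤ.- zw ℤ.+ (xy ℤ.- wy)
        lemma = solve-∀
        lemma₂ : ∀ xy zw q yw → ((xy ℤ.+ zw) ℤ.- q) ℤ.- xy ℤ.- zw ℤ.+ (xy ℤ.- yw) ≡ (xy ℤ.- yw) ℤ.- q
        lemma₂ = solve-∀
        goal : turn g w x (apex′ w x) ≡ turn g w x (apex w x) ℤ.- + ((ℤ.- κ) ⁺)
        goal rewrite p | q = trans (lemma (g x z) (g z w) (g w y) (g x y))
          (trans (cong₂ (λ c d → c ℤ.- g x y ℤ.- g z w ℤ.+ (g x y ℤ.- d)) diagonals′ (g-sym w y))
                 (lemma₂ (g x y) (g z w) _ (g y w)))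
      change-shift c@(at-yz refl refl p q) = down (turn-k c) goal
        where
        lemma : ∀ xz zw wy xy → xz ℤ.- xy ≡ (wy ℤ.+ xz) ℤ.- xy ℤ.- zw ℤ.+ (zw ℤ.- wy)
        lemma = solve-∀
        lemma₂ : ∀ xy zw q yw → ((xy ℤ.+ zw) ℤ.- q) ℤ.- xy ℤ.- zw ℤ.+ (zw ℤ.- yw) ≡ (zw ℤ.- yw) ℤ.- q
        lemma₂ = solve-∀
        goal : turn g y z (apex′ y z) ≡ turn g y z (apex y z) ℤ.- + ((ℤ.- κ) ⁺)
        goal rewrite p | q = trans (cong (λ c → c ℤ.- g x y) (g-sym z x))
          (trans (lemma (g x z) (g z w) (g w y) (g x y))
          (trans (cong (λ c → c ℤ.- g x y ℤ.- g z w ℤ.+ (g z w ℤ.- g w y)) diagonals′)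
                 (lemma₂ (g x y) (g z w) _ (g w y))))
      change-shift c@(at-xy refl refl p q) = up (turn-k c) goal
        where
        lemma : ∀ xz yz wy wx → yz ℤ.- xz ≡ wx ℤ.+ yz ℤ.- (wy ℤ.+ xz) ℤ.+ (wy ℤ.- wx)
        lemma = solve-∀
        lemma₂ : ∀ wx yz p yw → (wx ℤ.+ yz) ℤ.- ((wx ℤ.+ yz) ℤ.- p) ℤ.+ (yw ℤ.- wx) ≡ (yw ℤ.- wx) ℤ.+ p
        lemma₂ = solve-∀
        goal : turn g x y (apex′ x y) ≡ turn g x y (apex x y) ℤ.+ + (κ ⁺)
        goal rewrite p | q = trans (cong (λ c → g y z ℤ.- c) (g-sym z x))
          (trans (lemma (g x z) (g y z) (g w y) (g w x))
          (trans (cong₂ (λ c d → g w x ℤ.+ g y z ℤ.- c ℤ.+ (d ℤ.- g w x)) diagonals (g-sym w y))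
                 (lemma₂ (g w x) (g y z) _ (g y w))))
      change-shift c@(at-zw refl refl p q) = up (turn-k c) goal
        where
        lemma : ∀ xz yz wy wx → wx ℤ.- xz ≡ wx ℤ.+ yz ℤ.- (wy ℤ.+ xz) ℤ.+ (wy ℤ.- yz)
        lemma = solve-∀
        lemma₂ : ∀ wx yz p yw → (wx ℤ.+ yz) ℤ.- ((wx ℤ.+ yz) ℤ.- p) ℤ.+ (yw ℤ.- yz) ≡ (yw ℤ.- yz) ℤ.+ p
        lemma₂ = solve-∀
        goal : turn g z w (apex′ z w) ≡ turn g z w (apex z w) ℤ.+ + (κ ⁺)
        goal rewrite p | q = trans (lemma (g x z) (g y z) (g w y) (g w x))
          (trans (cong (λ c → g w x ℤ.+ g y z ℤ.- c ℤ.+ (g w y ℤ.- g y z)) diagonals)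
                 (lemma₂ (g w x) (g y z) _ (g w y)))
      change-shift c@(kept p q r) = none (turn-k c) (cong (turn g _ _) r)

      shear-flip : ∀ {h} → h ≢ k →
                   shear S′ h g ≡ mutated κ (shear S h (indicator S k)) (shear S h g)
      shear-flip {h} h≢k rewrite src-flip h≢k | tgt-flip h≢k =
        shift-add (change-shift c) (change-shift d) (turn-opposite c d) (turn-opposite d c)
        where
        c : Change (src h) (tgt h)
        c = change h≢k (inj₁ (refl , refl))
        d : Change (tgt h) (src h)
        d = change h≢k (inj₂ (refl , refl))

  indicator-flip : ∀ {l} → l ≢ k → ∀ a b → indicator S′ l a b ≡ indicator S l a b
  indicator-flip l≢k a b rewrite src-flip l≢k | tgt-flip l≢k = refl

  -- Both diagonals weigh zero, since `l` is not `k` and `x z` is not yet an arc. The minimum is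
  -- zero because `l` cannot belong to both pairs of opposite sides. For `l = k` the diagonal `w y`
  -- weighs 1 and the relation fails, hence the separate treatment of the indicator of `k`.
  indicator-ptolemy : ∀ {l} → l ≢ k → Ptolemy (indicator S l) w x y z
  indicator-ptolemy {l} l≢k =
    trans (cong₂ ℤ._+_ (χ-no (same? _ _ w y) λ p → l≢k (distinct l k p))
                       (χ-no (same? _ _ x z) kept-distinct))
          (sym (go (same? _ _ w x) (same? _ _ y z) (same? _ _ x y) (same? _ _ z w)))
    where
    c = src l
    d = tgt l
    apart = quad-sides-distinct w x y z c d wxy yzw
    go : (wx : Dec (Same c d w x)) (yz : Dec (Same c d y z))
         (xy : Dec (Same c d x y)) (zw : Dec (Same c d z w)) →
         (χ wx ℤ.+ χ yz) ℤ.⊓ (χ xy ℤ.+ χ zw) ≡ 0ℤ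
    go (yes p) _ (yes q) _ = ⊥-elim (proj₁ (apart (inj₁ p)) q)
    go (yes p) _ _ (yes q) = ⊥-elim (proj₂ (apart (inj₁ p)) q)
    go _ (yes p) (yes q) _ = ⊥-elim (proj₁ (apart (inj₂ p)) q)
    go _ (yes p) _ (yes q) = ⊥-elim (proj₂ (apart (inj₂ p)) q)
    go (yes _) (yes _) (no _) (no _) = refl
    go (yes _) (no _)  (no _) (no _) = refl
    go (no _)  (yes _) (no _) (no _) = refl
    go (no _)  (no _)  (yes _) (yes _) = refl
    go (no _)  (no _)  (yes _) (no _)  = refl
    go (no _)  (no _)  (no _)  (yes _) = refl
    go (no _)  (no _)  (no _)  (no _)  = refl

  shear-indicator-kk : shear S k (indicator S k) ≡ 0ℤ
  shear-indicator-kk =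
    cong₂ ℤ._+_
      (cong₂ ℤ._-_ (χ-no (same? w y y z) λ { (inj₁ (p , _)) → w≢y p ; (inj₂ (p , _)) → w≢z p })
                   (χ-no (same? w y z w) λ { (inj₁ (p , _)) → w≢z p ; (inj₂ (_ , p)) → y≢z p }))
      (cong₂ ℤ._-_ (χ-no (same? w y w x) λ { (inj₁ (_ , p)) → x≢y (sym p) ; (inj₂ (p , _)) → w≢x p })
                   (χ-no (same? w y x y) λ { (inj₁ (p , _)) → w≢x p ; (inj₂ (p , _)) → w≢y p }))

  indicator′-k : ∀ a b → indicator S′ k a b ≡ χ (same? x z a b)
  indicator′-k a b = cong₂ (λ s t → χ (same? s t a b)) src-k tgt-k

  turn′-k : ∀ {h s e} → Same (src h) (tgt h) s e → (c : Change s e) →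
            turn (indicator S′ k) s e (apex′ s e) ≡ ℤ.- turn-sign c
  turn′-k {s = s} {e} p c = trans (turn-cong indicator′-k s e (apex′ s e)) (go c)
    where
    g = λ a b → χ (same? x z a b)
    go : (c : Change s e) → turn g s e (apex′ s e) ≡ ℤ.- turn-sign c
    go (at-wx refl refl _ q) rewrite q =
      cong₂ ℤ._-_ (χ-yes (same? x z x z) (inj₁ (refl , refl)))
                  (χ-no (same? x z z w) λ { (inj₁ (p , _)) → x≢z p ; (inj₂ (p , _)) → w≢x (sym p) })
    go (at-yz refl refl _ q) rewrite q =
      cong₂ ℤ._-_ (χ-yes (same? x z z x) (inj₂ (refl , refl)))
                  (χ-no (same? x z x y) λ { (inj₁ (_ , p)) → y≢z (sym p) ; (inj₂ (p , _)) → x≢y p })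
    go (at-xy refl refl _ q) rewrite q =
      cong₂ ℤ._-_ (χ-no (same? x z y z) λ { (inj₁ (p , _)) → x≢y p ; (inj₂ (p , _)) → x≢z p })
                  (χ-yes (same? x z z x) (inj₂ (refl , refl)))
    go (at-zw refl refl _ q) rewrite q =
      cong₂ ℤ._-_ (χ-no (same? x z w x) λ { (inj₁ (p , _)) → w≢x (sym p) ; (inj₂ (_ , p)) → w≢z (sym p) })
                  (χ-yes (same? x z x z) (inj₁ (refl , refl)))
    go (kept _ _ q) rewrite q =
      cong₂ ℤ._-_ (χ-no (same? x z _ _) (λ r → ¬side-xz (transport (proj₁ (proj₂ t)) r)))
                  (χ-no (same? x z _ _) (λ r → ¬side-xz (transport (proj₂ (proj₂ t)) r)))
      where
      t = triangle _ p
      transport : ∀ {a b} → Side a b → Same x z a b → Side x z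
      transport ab (inj₁ (refl , refl)) = ab
      transport ab (inj₂ (refl , refl)) = side-swap ab

  shear-indicator-flip : ∀ {h} → h ≢ k →
                         shear S′ h (indicator S′ k) ≡ ℤ.- shear S h (indicator S k)
  shear-indicator-flip {h} h≢k =
    trans (cong₂ (λ s e → turn (indicator S′ k) s e (apex′ s e) ℤ.+ turn (indicator S′ k) e s (apex′ e s))
                 (src-flip h≢k) (tgt-flip h≢k))
      (trans (cong₂ ℤ._+_ (turn′-k (inj₁ (refl , refl)) c) (turn′-k (inj₂ (refl , refl)) d))
        (trans (sym (ℤₚ.neg-distrib-+ (turn-sign c) (turn-sign d)))
          (cong ℤ.-_ (sym (cong₂ ℤ._+_ (turn-k c) (turn-k d))))))
    where
    c : Change (src h) (tgt h)
    c = change h≢k (inj₁ (refl , refl))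
    d : Change (tgt h) (src h)
    d = change h≢k (inj₂ (refl , refl))

-- The weight whose shear coordinates count the arrows between arcs and the vertex l; the frozen
-- vertex of the initial arc j corresponds to a lamination close to j.
weight : ∀ {n} (lo hi : Fin n → ℕ) → Chords n → FVert n → Weight
weight lo hi S (inj₁ l) = indicator S l
weight lo hi S (inj₂ j) = lamination (lo j) (hi j)

Models : ∀ {n} (lo hi : Fin n → ℕ) → Chords n → Quiver (FVert n) → Set
Models lo hi S Q = ∀ h l → Row Q h l (shear S h (weight lo hi S l))

-- At `k` the flip exchanges the two pairs of opposite sides, which negates the row. The column of
-- `k` is negated because its indicator moves to the new diagonal. All other entries follow the
-- mutation rule by Ptolemy.
models-flip : ∀ {m n} {lo hi : Fin n → ℕ} {S : Chords n} {Q} → Polygon.Triangulated m S → ∀ k →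
              Models lo hi S Q → Models lo hi (flip k S) (μ k Q)
models-flip {m} {n} {lo} {hi} {S} {Q} tr k mod = go
  where
  open FlipWeights tr k
  open Polygon.Flip m tr k
  Goal : Fin n → FVert n → Set
  Goal h l = Row (μ k Q) h l (shear (flip k S) h (weight lo hi (flip k S) l))
  arc-goal : ∀ h l → Dec (h ≡ k) → Dec (l ≡ k) → Goal h (inj₁ l)
  arc-goal h l (yes refl) (yes refl) = subst (Row (μ k Q) k (inj₁ k)) zeros (row-at-source {Q = Q} (mod k (inj₁ k)))
    where
    zeros : ℤ.- shear S k (indicator S k) ≡ shear (flip k S) k (indicator (flip k S) k)
    zeros = trans (cong ℤ.-_ shear-indicator-kk) (sym (FlipWeights.shear-indicator-kk flip-triangulated k))
  arc-goal h l (yes refl) (no l≢k) = subst (Row (μ k Q) k (inj₁ l))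
      (sym (trans (shear-cong (flip k S) k (indicator-flip l≢k))
                  (Weighted.shear-flip-k (indicator S l) (indicator-sym S l))))
      (row-at-source {Q = Q} (mod k (inj₁ l)))
  arc-goal h l (no h≢k) (yes refl) = subst (Row (μ k Q) h (inj₁ k)) (sym (shear-indicator-flip h≢k))
      (row-at-target {Q = Q} (mod h (inj₁ k)))
  arc-goal h l (no h≢k) (no l≢k) = subst (Row (μ k Q) h (inj₁ l))
      (sym (trans (shear-cong (flip k S) h (indicator-flip l≢k))
                  (Weighted.shear-flip (indicator S l) (indicator-sym S l) (indicator-ptolemy l≢k) h≢k)))
      (row-away {Q = Q} h≢k (λ { refl → l≢k refl }) (mod h (inj₁ k)) (mod h (inj₁ l)) (mod k (inj₁ l)))
  frozen-goal : ∀ h j → Dec (h ≡ k) → Goal h (inj₂ j)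
  frozen-goal h j (yes refl) = subst (Row (μ k Q) k (inj₂ j))
      (sym (Weighted.shear-flip-k (lamination (lo j) (hi j)) (lamination-sym (lo j) (hi j))))
      (row-at-source {Q = Q} (mod k (inj₂ j)))
  frozen-goal h j (no h≢k) = subst (Row (μ k Q) h (inj₂ j))
      (sym (Weighted.shear-flip (lamination (lo j) (hi j)) (lamination-sym (lo j) (hi j))
             (lamination-ptolemy (lo j) (hi j) wxy yzw) h≢k))
      (row-away {Q = Q} h≢k (λ ()) (mod h (inj₁ k)) (mod h (inj₂ j)) (mod k (inj₂ j)))
  go : Models lo hi (flip k S) (μ k Q)
  go h (inj₁ l) = arc-goal h l (h Fin.≟ k) (l Fin.≟ k)
  go h (inj₂ j) = frozen-goal h j (h Fin.≟ k)

-- The chord from just before c to just before d crosses the sides z w and x y of a quadrilateral.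
Straddles : (c d w x y z : ℕ) → Set
Straddles c d w x y z = (⟨ z , w ∋ c ] × ⟨ x , y ∋ d ]) ⊎ (⟨ z , w ∋ d ] × ⟨ x , y ∋ c ])

module _ {n : ℕ} where
  straddles : (c d w x y z : Fin n) → Formula n
  straddles c d w x y z = (withinʳ z w c ∧ᶠ withinʳ x y d) ∨ᶠ (withinʳ z w d ∧ᶠ withinʳ x y c)

Separates : (c d w x y z : ℕ) → Set
Separates c d w x y z =
  (Cut c d w × Cut c d x × ¬ Cut c d y × ¬ Cut c d z) ⊎
  (¬ Cut c d w × ¬ Cut c d x × Cut c d y × Cut c d z)

straddles-cut = order 6 (λ c d w x y z → c <ᶠ d ⇒ᶠ cyc w x y ⇒ᶠ cyc y z w ⇒ᶠ straddles c d w x y z ⇒ᶠ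
  (cut c d w ∧ᶠ cut c d x ∧ᶠ ¬ᶠ cut c d y ∧ᶠ ¬ᶠ cut c d z) ∨ᶠ
  (¬ᶠ cut c d w ∧ᶠ ¬ᶠ cut c d x ∧ᶠ cut c d y ∧ᶠ cut c d z)) refl

-- The quadrilateral around arc k, in counterclockwise order.
module Quad {n : ℕ} (S : Chords n) (k : Fin n) where
  open Chords S
  w x y z : ℕ
  w = src k
  x = apex (tgt k) (src k)
  y = tgt k
  z = apex (src k) (tgt k)

module _ {m n : ℕ} {S : Chords n} (tr : Polygon.Triangulated m S) (k : Fin n) {c d : ℕ} (c<d : c < d) where
  open Quad S k
  open Polygon.Flip m tr k using (wxy; yzw; xyz; zwx)

  private
    -- This equals `(χ y∈ - χ w∈) * (χ z∈ - χ x∈)`, which is nonzero exactly when the cut separates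
    -- the ends of both diagonals.
    value : (w∈ : Dec (Cut c d w)) (x∈ : Dec (Cut c d x)) (y∈ : Dec (Cut c d y)) (z∈ : Dec (Cut c d z)) → ℤ
    value w∈ x∈ y∈ z∈ =
      (χ y∈ ℤ.* χ z∈ ℤ.- χ z∈ ℤ.* χ w∈) ℤ.+ (χ w∈ ℤ.* χ x∈ ℤ.- χ x∈ ℤ.* χ y∈)

  shear-straddles : Straddles c d w x y z → shear S k (lamination c d) ≡ 1ℤ
  shear-straddles st = go (cut? c d w) (cut? c d x) (cut? c d y) (cut? c d z)
                          (straddles-cut c d w x y z c<d wxy yzw st)
    where
    go : ∀ w∈ x∈ y∈ z∈ → Separates c d w x y z → value w∈ x∈ y∈ z∈ ≡ 1ℤ
    go (yes _) (yes _) (no _)  (no _)  _ = refl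
    go (no _)  (no _)  (yes _) (yes _) _ = refl
    go (no ¬w) _ _ _ (inj₁ (w , _)) = ⊥-elim (¬w w)
    go _ (no ¬x) _ _ (inj₁ (_ , x , _)) = ⊥-elim (¬x x)
    go _ _ (yes y) _ (inj₁ (_ , _ , ¬y , _)) = ⊥-elim (¬y y)
    go _ _ _ (yes z) (inj₁ (_ , _ , _ , ¬z)) = ⊥-elim (¬z z)
    go (yes w) _ _ _ (inj₂ (¬w , _)) = ⊥-elim (¬w w)
    go _ (yes x) _ _ (inj₂ (_ , ¬x , _)) = ⊥-elim (¬x x)
    go _ _ (no ¬y) _ (inj₂ (_ , _ , y , _)) = ⊥-elim (¬y y)
    go _ _ _ (no ¬z) (inj₂ (_ , _ , _ , z)) = ⊥-elim (¬z z)

  shear-straddles′ : Straddles c d x y z w → shear S k (lamination c d) ≡ -1ℤ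
  shear-straddles′ st = go (cut? c d w) (cut? c d x) (cut? c d y) (cut? c d z)
                           (straddles-cut c d x y z w c<d xyz zwx st)
    where
    go : ∀ w∈ x∈ y∈ z∈ → Separates c d x y z w → value w∈ x∈ y∈ z∈ ≡ -1ℤ
    go (no _) (yes _) (yes _)  (no _)  _ = refl
    go (yes _)  (no _)  (no _) (yes _) _ = refl
    go _ (no ¬w) _ _ (inj₁ (w , _)) = ⊥-elim (¬w w)
    go _ _ (no ¬x) _ (inj₁ (_ , x , _)) = ⊥-elim (¬x x)
    go _ _ _ (yes y) (inj₁ (_ , _ , ¬y , _)) = ⊥-elim (¬y y)
    go (yes z) _ _ _ (inj₁ (_ , _ , _ , ¬z)) = ⊥-elim (¬z z)
    go _ (yes w) _ _ (inj₂ (¬w , _)) = ⊥-elim (¬w w)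
    go _ _ (yes x) _ (inj₂ (_ , ¬x , _)) = ⊥-elim (¬x x)
    go _ _ _ (no ¬y) (inj₂ (_ , _ , y , _)) = ⊥-elim (¬y y)
    go (no ¬z) _ _ _ (inj₂ (_ , _ , _ , z)) = ⊥-elim (¬z z)

Positive Negative : ∀ {n} → Chords n → Fin n → (c d : ℕ) → Set
Positive S k c d = Straddles c d w x y z where open Quad S k
Negative S k c d = Straddles c d x y z w where open Quad S k

red⇒¬positive : ∀ {m n lo hi} {S : Chords n} {Q} → Polygon.Triangulated m S → Models lo hi S Q →
                ∀ {k j} → lo j < hi j → Red Q k → ¬ Positive S k (lo j) (hi j)
red⇒¬positive tr mod {k} {j} lt red p =
  ℕₚ.0≢1+n (trans (sym (red j)) (trans (Row.outgoing (mod k (inj₂ j))) (cong _⁺ (shear-straddles tr k lt p))))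

green⇒¬negative : ∀ {m n lo hi} {S : Chords n} {Q} → Polygon.Triangulated m S → Models lo hi S Q →
                  ∀ {k j} → lo j < hi j → Green Q k → ¬ Negative S k (lo j) (hi j)
green⇒¬negative tr mod {k} {j} lt green p =
  ℕₚ.0≢1+n (trans (sym (green j)) (trans (Row.incoming (mod k (inj₂ j)))
    (cong (λ b → (ℤ.- b) ⁺) (shear-straddles′ tr k lt p))))

-- Arcs between two intervals of vertices

Joins : (p q r s a b : ℕ) → Set
Joins p q r s a b = ([ p , q ∋ a ⟩ × [ r , s ∋ b ⟩) ⊎ ([ p , q ∋ b ⟩ × [ r , s ∋ a ⟩)

Joins-swap : ∀ {p q r s a b} → Joins p q r s a b → Joins p q r s b a
Joins-swap (inj₁ h) = inj₂ h
Joins-swap (inj₂ h) = inj₁ h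

within? : ∀ p q a → Dec [ p , q ∋ a ⟩
within? p q a = p ℕ.≟ a ⊎-dec cyc? p a q

joins? : ∀ p q r s a b → Dec (Joins p q r s a b)
joins? p q r s a b = (within? p q a ×-dec within? r s b) ⊎-dec (within? p q b ×-dec within? r s a)

Quadrilateral : (p q r s : ℕ) → Set
Quadrilateral p q r s = Cyc p q r × Cyc r s p

Alternating : (p q r s w x y z : ℕ) → Set
Alternating p q r s w x y z = ([ p , q ∋ w ⟩ × [ q , r ∋ x ⟩) × ([ r , s ∋ y ⟩ × [ s , p ∋ z ⟩)

module _ {n : ℕ} where
  joins : (p q r s a b : Fin n) → Formula n
  joins p q r s a b = (within p q a ∧ᶠ within r s b) ∨ᶠ (within p q b ∧ᶠ within r s a)

  quadrilateral : (p q r s : Fin n) → Formula n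
  quadrilateral p q r s = cyc p q r ∧ᶠ cyc r s p

  alternating : (p q r s w x y z : Fin n) → Formula n
  alternating p q r s w x y z = (within p q w ∧ᶠ within q r x) ∧ᶠ (within r s y ∧ᶠ within s p z)

-- The vertices `q` and `s` lie between the two intervals, one on either way around, so a joining
-- chord never connects neighbours.
joins-boundary = order 8 (λ o m p q r s a b → quadrilateral p q r s ⇒ᶠ
  o ≤ᶠ p ⇒ᶠ o ≤ᶠ q ⇒ᶠ o ≤ᶠ r ⇒ᶠ o ≤ᶠ s ⇒ᶠ o ≤ᶠ a ⇒ᶠ o ≤ᶠ b ⇒ᶠ
  p <ᶠ m ⇒ᶠ q <ᶠ m ⇒ᶠ r <ᶠ m ⇒ᶠ s <ᶠ m ⇒ᶠ a <ᶠ m ⇒ᶠ b <ᶠ m ⇒ᶠ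
  boundary o m a b ⇒ᶠ ¬ᶠ joins p q r s a b) refl

interleave = order 8 (λ p q r s w x y z → quadrilateral p q r s ⇒ᶠ quadrilateral w x y z ⇒ᶠ
  within p q w ∧ᶠ within r s y ⇒ᶠ
  ¬ᶠ within p q x ⇒ᶠ ¬ᶠ within r s x ⇒ᶠ ¬ᶠ within p q z ⇒ᶠ ¬ᶠ within r s z ⇒ᶠ
  alternating p q r s w x y z) refl

straddles-ends = order 5 (λ p q s w z → cyc p q s ⇒ᶠ within p q w ⇒ᶠ within s p z ⇒ᶠ withinʳ z w p) refl

quad-corner = order 4 (λ p q r s → quadrilateral p q r s ⇒ᶠ cyc p q s) refl

quad-opposite = order 4 (λ p q r s → quadrilateral p q r s ⇒ᶠ quadrilateral r s p q) refl

alternating⇒straddles : ∀ {p q r s w x y z} → Quadrilateral p q r s →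
                        Alternating p q r s w x y z → Straddles p r w x y z
alternating⇒straddles {p} {q} {r} {s} {w} {x} {y} {z} Q ((w∈ , x∈) , (y∈ , z∈)) =
  inj₁ ( straddles-ends p q s w z (quad-corner p q r s Q) w∈ z∈
       , straddles-ends r s q y x (quad-corner r s p q (quad-opposite p q r s Q)) y∈ x∈ )

straddles-opposite : ∀ {c d w x y z} → Straddles c d y z w x → Straddles c d w x y z
straddles-opposite (inj₁ (p , q)) = inj₂ (q , p)
straddles-opposite (inj₂ (p , q)) = inj₁ (q , p)

straddles-same : ∀ {c d p r w x y z} → Same c d p r → Straddles p r w x y z → Straddles c d w x y z
straddles-same (inj₁ (refl , refl)) st = st
straddles-same (inj₂ (refl , refl)) (inj₁ st) = inj₂ st
straddles-same (inj₂ (refl , refl)) (inj₂ st) = inj₁ st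

-- A chord missing the sides and the diagonal p r of a quadrilateral p q r s that meets the
-- alternating quadrilateral w x y z in opposite sides is the diagonal p r.
straddles-unique = order 10 (λ p q r s w x y z c d → quadrilateral p q r s ⇒ᶠ quadrilateral w x y z ⇒ᶠ
  alternating p q r s w x y z ⇒ᶠ straddles c d w x y z ⇒ᶠ
  ¬ᶠ cross p q c d ⇒ᶠ ¬ᶠ cross q r c d ⇒ᶠ ¬ᶠ cross r s c d ⇒ᶠ ¬ᶠ cross s p c d ⇒ᶠ ¬ᶠ cross p r c d ⇒ᶠ
  same p r c d) refl

-- The number of edges counterclockwise from `a` to `b`, for vertices below `m`; it measures how
-- close a joining arc is to `p r`.
dist : (m a b : ℕ) → ℕ
dist m a b with a ≤? b
... | yes _ = b ∸ a
... | no _  = (b + m) ∸ a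

dist-self : ∀ m a → dist m a a ≡ 0
dist-self m a with a ≤? a
... | yes _  = ℕₚ.n∸n≡0 a
... | no a≰a = ⊥-elim (a≰a ℕₚ.≤-refl)

dist-pos : ∀ m {a b} → a < m → a ≢ b → 0 < dist m a b
dist-pos m {a} {b} a<m a≢b with a ≤? b
... | yes a≤b = ℕₚ.m<n⇒0<n∸m (ℕₚ.≤∧≢⇒< a≤b a≢b)
... | no _    = ℕₚ.m<n⇒0<n∸m (ℕₚ.<-≤-trans a<m (ℕₚ.m≤n+m m b))

dist-cyc : ∀ m {a b c} → a < m → b < m → c < m → Cyc a b c → dist m a b < dist m a c
dist-cyc m {a} {b} {c} a<m b<m c<m h with a ≤? b | a ≤? c
dist-cyc m a<m b<m c<m (inj₁ (_ , b<c)) | yes p | yes _ = ℕₚ.∸-monoˡ-< b<c p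
dist-cyc m a<m b<m c<m (inj₁ (a<b , b<c)) | yes p | no q = ⊥-elim (q (ℕₚ.<⇒≤ (ℕₚ.<-trans a<b b<c)))
dist-cyc m a<m b<m c<m (inj₁ (a<b , _)) | no p | _ = ⊥-elim (p (ℕₚ.<⇒≤ a<b))
dist-cyc m a<m b<m c<m (inj₂ (inj₁ (b<c , c<a))) | yes p | _ = ⊥-elim (ℕₚ.<⇒≱ (ℕₚ.<-trans b<c c<a) p)
dist-cyc m a<m b<m c<m (inj₂ (inj₁ (b<c , c<a))) | no _ | yes q = ⊥-elim (ℕₚ.<⇒≱ c<a q)
dist-cyc m {b = b} a<m b<m c<m (inj₂ (inj₁ (b<c , c<a))) | no _ | no _ =
  ℕₚ.∸-monoˡ-< (ℕₚ.+-monoˡ-< m b<c) (ℕₚ.≤-trans (ℕₚ.<⇒≤ a<m) (ℕₚ.m≤n+m m b))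
dist-cyc m {c = c} a<m b<m c<m (inj₂ (inj₂ (c<a , a<b))) | yes p | no _ =
  ℕₚ.∸-monoˡ-< (ℕₚ.<-≤-trans b<m (ℕₚ.m≤n+m m c)) p
dist-cyc m a<m b<m c<m (inj₂ (inj₂ (c<a , a<b))) | yes _ | yes q = ⊥-elim (ℕₚ.<⇒≱ c<a q)
dist-cyc m a<m b<m c<m (inj₂ (inj₂ (c<a , a<b))) | no p | _ = ⊥-elim (p (ℕₚ.<⇒≤ a<b))

dist-within : ∀ m {p z w} → p < m → z < m → w < m → [ p , w ∋ z ⟩ → z ≢ w → dist m p z < dist m p w
dist-within m {p} {w = w} p<m _ _ (inj₁ refl) z≢w =
  subst (_< dist m p w) (sym (dist-self m p)) (dist-pos m p<m z≢w)
dist-within m p<m z<m w<m (inj₂ c) _  = dist-cyc m p<m z<m w<m c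

back-shrink = order 7 (λ p q r s w y z → quadrilateral p q r s ⇒ᶠ within p q w ⇒ᶠ within r s y ⇒ᶠ
  cyc y z w ⇒ᶠ within p q z ⇒ᶠ within p w z ∧ᶠ ¬ᶠ z ≡ᶠ w) refl

-- Going from `y` to `w`, a vertex `z` outside `[p , q)` comes before `p`, so `p` is after `z` and
-- at most `w`. Likewise `r` is after `x` and at most `y`.
stuck-straddles = order 8 (λ p q r s w x y z → quadrilateral p q r s ⇒ᶠ quadrilateral w x y z ⇒ᶠ
  within p q w ⇒ᶠ within r s y ⇒ᶠ ¬ᶠ within r s x ⇒ᶠ ¬ᶠ within p q z ⇒ᶠ straddles p r w x y z) refl

Presents : (p q r s : ℕ) {n : ℕ} → Chords n → Set
Presents p q r s S = ∃ λ h → Joins p q r s (src h) (tgt h) where open Chords S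

presents? : ∀ p q r s {n} (S : Chords n) → Dec (Presents p q r s S)
presents? p q r s S = Finₚ.any? λ h → joins? p q r s (src h) (tgt h) where open Chords S

presents-opposite : ∀ {p q r s n} {S : Chords n} → Presents p q r s S → Presents r s p q S
presents-opposite (h , inj₁ (a , b)) = h , inj₂ (b , a)
presents-opposite (h , inj₂ (a , b)) = h , inj₁ (b , a)

module Moves (m : ℕ) where

  open Polygon m

  record Frame (p q r s : ℕ) : Set where
    constructor frame
    field
      quad : Quadrilateral p q r s
      p<m : p < m
      q<m : q < m
      r<m : r < m
      s<m : s < m

  module Presence {n : ℕ} {p q r s : ℕ} (F : Frame p q r s) where
    open Frame F

    private
      Present : Chords n → Set
      Present = Presents p q r s

    present-side : ∀ {S : Chords n} {a b} → Sides.Side S a b → Joins p q r s a b → Present S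
    present-side (Sides.side a<m b<m (inj₁ bd)) j =
      ⊥-elim (joins-boundary 0 m p q r s _ _ quad z≤n z≤n z≤n z≤n z≤n z≤n p<m q<m r<m s<m a<m b<m bd j)
    present-side (Sides.side _ _ (inj₂ (h , inj₁ (refl , refl)))) j = h , j
    present-side (Sides.side _ _ (inj₂ (h , inj₂ (refl , refl)))) j = h , Joins-swap j

    module _ {S : Chords n} (absent : ¬ Present S) where
      open Sides S

      -- If `x` or `z` were in one of the intervals, it would span a joining side with `w` or `y`,
      -- and a joining side is an arc.
      interleave-side : ∀ {w x y z} → Quadrilateral w x y z → Side w x → Side x y → Side y z → Side z w →
        [ p , q ∋ w ⟩ × [ r , s ∋ y ⟩ → Alternating p q r s w x y z
      interleave-side {w} {x} {y} {z} Q wx xy yz zw (w∈ , y∈) = interleave p q r s w x y z quad Q (w∈ , y∈)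
        (λ x∈ → absent (present-side xy (inj₁ (x∈ , y∈))))
        (λ x∈ → absent (present-side wx (inj₁ (w∈ , x∈))))
        (λ z∈ → absent (present-side yz (inj₂ (z∈ , y∈))))
        (λ z∈ → absent (present-side zw (inj₂ (w∈ , z∈))))

    -- The flipped arc is the only one that can disappear, so it joined the intervals. The sides of
    -- its quadrilateral survive the flip, so none of them joins.
    death : ∀ {S : Chords n} (tr : Triangulated S) k → Present S → ¬ Present (flip k S) →
            let open Quad S k in Alternating p q r s w x y z ⊎ Alternating p q r s y z w x
    death {S} tr k (h , j) absent with h Fin.≟ k
    ... | no h≢k = ⊥-elim (absent (h , subst₂ (Joins p q r s) (sym (src-flip h≢k)) (sym (tgt-flip h≢k)) j))
      where open Flip tr k
    ... | yes refl = [ (λ j → inj₁ (interleave-side absent (wxy , yzw) side′-wx side′-xy side′-yz side′-zw j))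
                     , (λ { (y∈ , w∈) → inj₂ (interleave-side absent (yzw , wxy)
                                                 side′-yz side′-zw side′-wx side′-xy (y∈ , w∈)) }) ]′ j
      where open Flip tr k

    -- The joining arc must be the new diagonal `x z`. As no side joins, the alternation now starts
    -- at `x` or `z`, and this makes the coordinate of `p r` at the flipped arc negative.
    birth : ∀ {S : Chords n} (tr : Triangulated S) k → ¬ Present S → Present (flip k S) →
            let open Quad S k in Straddles p r x y z w
    birth {S} tr k absent (h , j) with h Fin.≟ k
    ... | no _     = ⊥-elim (absent (h , j))
    ... | yes refl = [ (λ j → alternating⇒straddles quad
                                (interleave-side absent (xyz , zwx) side-xy side-yz side-zw side-wx j))
                     , (λ { (z∈ , x∈) → straddles-opposite (alternating⇒straddles quad
                                (interleave-side absent (zwx , xyz) side-zw side-wx side-xy side-yz (z∈ , x∈))) }) ]′ j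
      where open Flip tr k

    -- Among the arcs joining [p , q) and [r , s), one closest to p and r turns positively.
    final : ∀ {S : Chords n} → Triangulated S →
            (∀ k → let open Quad S k in ¬ Straddles p r w x y z) → ¬ Present S
    final {S} tr nowhere (h , j) =
      [ (λ j → descend h (inj₁ (refl , refl)) j (<-wellFounded _))
      , (λ { (t∈ , s∈) → descend h (inj₂ (refl , refl)) (t∈ , s∈) (<-wellFounded _) }) ]′ j
      where
      open Chords S
      open Triangulated tr
      open Facts tr
      descend : ∀ h {w y} → Same (src h) (tgt h) w y → [ p , q ∋ w ⟩ × [ r , s ∋ y ⟩ →
                Acc _<_ (dist m p w + dist m r y) → ⊥
      descend h {w} {y} hwy (w∈ , y∈) (acc rec) = continue (within? r s x) (within? p q z)
        where
        x = apex y w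
        z = apex w y
        wyz = triangle h hwy
        ywx = triangle h (Same-swap hwy)
        wxy : Cyc w x y
        wxy = cyc-rotate y w x (proj₁ ywx)
        yzw : Cyc y z w
        yzw = cyc-rotate w y z (proj₁ wyz)
        wx = proj₁ (proj₂ ywx)
        yz = proj₁ (proj₂ wyz)
        w<m = proj₁ (bounded h hwy)
        y<m = proj₂ (bounded h hwy)
        continue : Dec [ r , s ∋ x ⟩ → Dec [ p , q ∋ z ⟩ → ⊥
        continue (yes x∈) _ with wx
        ... | Sides.side _ x<m (inj₂ (h′ , hwx)) =
          descend h′ hwx (w∈ , x∈) (rec (ℕₚ.+-monoʳ-< (dist m p w)
            (dist-within m r<m x<m y<m (proj₁ sh) (proj₂ sh))))
          where sh = back-shrink r s p q y w x (quad-opposite p q r s quad) y∈ w∈ wxy x∈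
        ... | Sides.side a<m b<m (inj₁ bd) =
          joins-boundary 0 m p q r s _ _ quad z≤n z≤n z≤n z≤n z≤n z≤n p<m q<m r<m s<m a<m b<m bd (inj₁ (w∈ , x∈))
        continue (no _) (yes z∈) with yz
        ... | Sides.side _ z<m (inj₂ (h′ , hyz)) =
          descend h′ (Same-swap hyz) (z∈ , y∈) (rec (ℕₚ.+-monoˡ-< (dist m r y)
            (dist-within m p<m z<m w<m (proj₁ sh) (proj₂ sh))))
          where sh = back-shrink p q r s w y z quad w∈ y∈ yzw z∈
        ... | Sides.side a<m b<m (inj₁ bd) =
          joins-boundary 0 m p q r s _ _ quad z≤n z≤n z≤n z≤n z≤n z≤n p<m q<m r<m s<m a<m b<m bd (inj₂ (z∈ , y∈))
        continue (no x∉) (no z∉) = finish hwy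
          where
          st : Straddles p r w x y z
          st = stuck-straddles p q r s w x y z quad (wxy , yzw) w∈ y∈ x∉ z∉
          finish : Same (src h) (tgt h) w y → ⊥
          finish (inj₁ (refl , refl)) = nowhere h st
          finish (inj₂ (refl , refl)) = nowhere h (straddles-opposite st)

-- Maximal green sequences

first-failure : ∀ L {P : ℕ → Set} → (∀ t → Dec (P t)) → P 0 → ¬ P L →
                ∃ λ (i : Fin L) → P (toℕ i) × ¬ P (suc (toℕ i))
first-failure zero    P? p ¬p = ⊥-elim (¬p p)
first-failure (suc L) P? p ¬p with P? 1
... | no ¬p₁ = Fin.zero , p , ¬p₁
... | yes p₁ with first-failure L (λ t → P? (suc t)) p₁ ¬p
...   | i , q , ¬q = Fin.suc i , q , ¬q

last-success : ∀ {L} {P : ℕ → Set} → (∀ (i : Fin L) → P (suc (toℕ i)) → P (toℕ i)) →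
               ∀ {t u} → t ≤ u → u ≤ L → P u → P t
last-success {P = P} back {t} {zero}  z≤n _ p = p
last-success {L} {P} back {t} {suc u} t≤u u<L p with ℕₚ.m≤n⇒m<n∨m≡n t≤u
... | inj₂ refl = p
... | inj₁ (s≤s t≤u′) = last-success back t≤u′ (ℕₚ.<⇒≤ u<L)
  (subst P (Finₚ.toℕ-fromℕ< u<L)
    (back (Fin.fromℕ< u<L) (subst (λ i → P (suc i)) (sym (Finₚ.toℕ-fromℕ< u<L)) p)))

-- The pentagon made of an interior triangle and two of its neighbours

triangle-quads = order 5 (λ p q r s u → cyc p q r ⇒ᶠ cyc r s p ⇒ᶠ cyc q u r ⇒ᶠ
  quadrilateral p q r s ∧ᶠ quadrilateral q u r p ∧ᶠ quadrilateral p u r s) refl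

-- Around the circle come `w`, then an end in `[q , u)`, then `x`, then an end in `[r , p)`.
blocked = order 9 (λ p q r s u w x a b → quadrilateral p q r s ⇒ᶠ quadrilateral q u r p ⇒ᶠ
  within p q w ⇒ᶠ within u r x ⇒ᶠ joins q u r p a b ⇒ᶠ cross w x a b) refl

straddles-second = order 8 (λ p q r s u w x z → quadrilateral p q r s ⇒ᶠ cyc q u r ⇒ᶠ
  within p u w ⇒ᶠ ¬ᶠ within p q w ⇒ᶠ within s p z ⇒ᶠ withinʳ z w q) refl

-- The only chord through p u that misses the pentagon p q u r s and its diagonal p r is q r.
pentagon-diagonal = order 6 (λ p q u r c d → cyc p q u ⇒ᶠ cyc u r p ⇒ᶠ cross p u c d ⇒ᶠ
  ¬ᶠ cross p q c d ⇒ᶠ ¬ᶠ cross q u c d ⇒ᶠ ¬ᶠ cross u r c d ⇒ᶠ ¬ᶠ cross p r c d ⇒ᶠ same q r c d) refl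

cross? : ∀ a b c d → Dec (Cross a b c d)
cross? a b c d = (cyc? a c b ×-dec cyc? b d a) ⊎-dec (cyc? a d b ×-dec cyc? b c a)

pentagon-turn = order 4 (λ p q u r → cyc p q r ⇒ᶠ cyc q u r ⇒ᶠ cyc p q u ∧ᶠ cyc u r p) refl

same-ends : ∀ {a b c d v} → Same a b c d → a ≡ v ⊎ b ≡ v → c ≡ v ⊎ d ≡ v
same-ends (inj₁ (refl , refl)) h = h
same-ends (inj₂ (refl , refl)) (inj₁ h) = inj₂ h
same-ends (inj₂ (refl , refl)) (inj₂ h) = inj₁ h

Corner : (p q r v : ℕ) → Set
Corner p q r v = p ≡ v ⊎ q ≡ v ⊎ r ≡ v

Realised : {L : ℕ} → (Fin L → ℕ → Set) → (ℕ → Set) → Set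
Realised Support P = ∃ λ i → (∀ v → Support i v → P v) × (∀ v → P v → Support i v)

module Runs (m : ℕ) {n : ℕ} (lo hi : Fin n → ℕ) where

  open Polygon m
  open Moves m

  record Run (S : Chords n) (L : ℕ) : Set where
    field
      state   : ℕ → Chords n
      step    : Fin L → Fin n
      start   : state 0 ≡ S
      advance : ∀ i → state (suc (toℕ i)) ≡ flip (step i) (state (toℕ i))
      valid   : ∀ t → Triangulated (state t)
      green   : ∀ i j → ¬ Negative (state (toℕ i)) (step i) (lo j) (hi j)
      red     : ∀ k j → ¬ Positive (state L) k (lo j) (hi j)

  run : (∀ j → lo j < hi j) → ∀ ks {S Q} → Triangulated S → Models lo hi S Q →
        IsMaxGreenFrom Q ks → Run S (length ks)
  -- The states past the end repeat the last one, so that `valid` can be stated for all times.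
  run lo<hi [] {S} tr mod h = record
    { state = λ _ → S ; step = λ () ; start = refl ; advance = λ () ; valid = λ _ → tr
    ; green = λ () ; red = λ k j → red⇒¬positive tr mod (lo<hi j) (h k) }
  run lo<hi (k ∷ ks) {S} {Q} tr mod (g , h) = record
    { state = state′ ; step = step′ ; start = refl ; advance = advance′ ; valid = valid′
    ; green = green′ ; red = R.red }
    where
    module R = Run (run lo<hi ks (Flip.flip-triangulated tr k) (models-flip tr k mod) h)
    state′ : ℕ → Chords n
    state′ zero    = S
    state′ (suc t) = R.state t
    step′ : Fin (suc (length ks)) → Fin n
    step′ Fin.zero    = k
    step′ (Fin.suc i) = R.step i
    advance′ : ∀ i → state′ (suc (toℕ i)) ≡ flip (step′ i) (state′ (toℕ i))
    advance′ Fin.zero    = R.start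
    advance′ (Fin.suc i) = R.advance i
    valid′ : ∀ t → Triangulated (state′ t)
    valid′ zero    = tr
    valid′ (suc t) = R.valid t
    green′ : ∀ i j → ¬ Negative (state′ (toℕ i)) (step′ i) (lo j) (hi j)
    green′ Fin.zero    j = green⇒¬negative tr mod (lo<hi j) g
    green′ (Fin.suc i) j = R.green i j

  module Along {S : Chords n} {L : ℕ} (R : Run S L) where
    open Run R

    Support : Fin L → ℕ → Set
    Support i v = ∃ λ j → Positive (state (toℕ i)) (step i) (lo j) (hi j) × (lo j ≡ v ⊎ hi j ≡ v)

    module _ {p q r s : ℕ} (F : Frame p q r s) {j : Fin n} (pr : Same (lo j) (hi j) p r) where
      open Frame F
      open Presence {n} F

      private
        Present : Chords n → Set
        Present = Presents p q r s

      vanish : Present S → ∃ λ (i : Fin L) → let open Quad (state (toℕ i)) (step i) in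
               Present (state (toℕ i)) × (Alternating p q r s w x y z ⊎ Alternating p q r s y z w x)
      vanish pres with first-failure L (λ t → presents? p q r s (state t)) (subst Present (sym start) pres)
                         (final (valid L) λ k st → red k j (straddles-same pr st))
      ... | i , here , gone =
        i , here , death (valid (toℕ i)) (step i) here (subst (λ S′ → ¬ Present S′) (advance i) gone)

      -- By `birth` a first joining arc would come with a negative coordinate, which greenness
      -- forbids; so presence passes to earlier times.
      present-before : ∀ {t u} → t ≤ u → u ≤ L → Present (state u) → Present (state t)
      present-before = last-success back
        where
        back : ∀ (i : Fin L) → Present (state (suc (toℕ i))) → Present (state (toℕ i))
        back i later with presents? p q r s (state (toℕ i))
        ... | yes now = now
        ... | no never = ⊥-elim (green i j (straddles-same pr
                (birth (valid (toℕ i)) (step i) never (subst Present (advance i) later))))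

      present-until : ∀ {i i′ : Fin L} → Present (state (toℕ i)) → ¬ Present (state (toℕ i′)) →
                      toℕ i < toℕ i′
      present-until {i} {i′} now gone with toℕ i <? toℕ i′
      ... | yes lt = lt
      ... | no ¬lt = ⊥-elim (gone (present-before (ℕₚ.≮⇒≥ ¬lt) (ℕₚ.<⇒≤ (Finₚ.toℕ<n i)) now))

-- The mutations belonging to arcs and interior triangles

module Witnesses (m : ℕ) {n : ℕ} {S : Chords n} (tr : Polygon.Triangulated m S) {L : ℕ}
                 (R : Runs.Run m (Chords.src S) (Chords.tgt S) S L) where
  open Chords S renaming (src to lo; tgt to hi)
  open Polygon m
  open Moves m
  open Runs m lo hi
  open Run R
  open Along R
  open Sides S
  open Facts tr
  open Triangulated tr

  private
    arc : ∀ j → Side (lo j) (hi j)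
    arc j = arc-side j (inj₁ (refl , refl))

  module _ (j : Fin n) where
    private
      p = lo j
      r = hi j
      q = apex r p
      s = apex p r
      prs = triangle j (inj₁ (refl , refl))
      rpq = triangle j (inj₂ (refl , refl))
      pqrs : Quadrilateral p q r s
      pqrs = cyc-rotate r p q (proj₁ rpq) , cyc-rotate p r s (proj₁ prs)
      F : Frame p q r s
      F = frame pqrs (Side.a<m (arc j)) (Side.b<m (proj₁ (proj₂ rpq)))
                     (Side.b<m (arc j)) (Side.b<m (proj₁ (proj₂ prs)))

      only : ∀ {w x y z} → Quadrilateral w x y z → Alternating p q r s w x y z →
             ∀ l v → Straddles (lo l) (hi l) w x y z → lo l ≡ v ⊎ hi l ≡ v → p ≡ v ⊎ r ≡ v
      only {w} {x} {y} {z} Q alt l v st = same-ends (same-sym p r (lo l) (hi l)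
        (straddles-unique p q r s w x y z (lo l) (hi l) pqrs Q alt st
          (miss (proj₁ (proj₂ rpq))) (miss (proj₂ (proj₂ rpq)))
          (miss (proj₁ (proj₂ prs))) (miss (proj₂ (proj₂ prs))) (miss (arc j))))
        where
        miss : ∀ {a b} → Side a b → ¬ Cross a b (lo l) (hi l)
        miss ab = noncrossing-side ab (arc l)

    -- The mutation at which the simple module of j leaves the torsion class.
    arc-witness : Realised Support λ v → lo j ≡ v ⊎ hi j ≡ v
    arc-witness with vanish F {j} (inj₁ (refl , refl)) (j , inj₁ (inj₁ refl , inj₁ refl))
    ... | i , _ , inj₁ alt =
      i , (λ { v (l , st , e) → only (wxy , yzw) alt l v st e })
        , (λ v e → j , alternating⇒straddles pqrs alt , e)
      where open Flip (valid (toℕ i)) (step i)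
    ... | i , _ , inj₂ alt =
      i , (λ { v (l , st , e) → only (yzw , wxy) alt l v (straddles-opposite st) e })
        , (λ v e → j , straddles-opposite (alternating⇒straddles pqrs alt) , e)
      where open Flip (valid (toℕ i)) (step i)

  module _ {p q r : ℕ} (pqr : Cyc p q r) {j k l : Fin n} (pr : Same (lo j) (hi j) p r)
           (qr : Same (lo k) (hi k) q r) (pq : Same (lo l) (hi l) p q) where
    private
      s = apex p r
      u = apex r q
      prs = triangle j pr
      rqu = triangle k (Same-swap qr)
      crsp : Cyc r s p
      crsp = cyc-rotate p r s (proj₁ prs)
      cqur : Cyc q u r
      cqur = cyc-rotate r q u (proj₁ rqu)
      quads = triangle-quads p q r s u pqr crsp cqur
      p<m = proj₁ (bounded j pr)
      r<m = proj₂ (bounded j pr)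
      q<m = proj₁ (bounded k qr)
      s<m = Side.b<m (proj₁ (proj₂ prs))
      u<m = Side.b<m (proj₁ (proj₂ rqu))

    outer-frame : Frame p q r s
    outer-frame = frame (proj₁ quads) p<m q<m r<m s<m
    middle-frame : Frame p u r s
    middle-frame = frame (proj₂ (proj₂ quads)) p<m u<m r<m s<m

    -- Either the extension of the simples of j and k leaves the torsion class by itself, or
    -- together with the simple of j, in which case the simple of k has left before.
    Overtaken : Set
    Overtaken = ∃ λ (i : Fin L) → Presents p q r s (state (toℕ i)) × ¬ Presents q u r p (state (toℕ i))

    triangle-step : Realised Support (Corner p q r) ⊎ Overtaken
    triangle-step with Along.vanish R middle-frame {j} pr (j , start-joins pr)
      where
      start-joins : Same (lo j) (hi j) p r → Joins p u r s (lo j) (hi j)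
      start-joins (inj₁ (refl , refl)) = inj₁ (inj₁ refl , inj₁ refl)
      start-joins (inj₂ (refl , refl)) = inj₂ (inj₁ refl , inj₁ refl)
    ... | i , _ , alt = [ analyse id id (λ j → j) (Flip.side-wx v k′) wxyz
                        , analyse opposite opposite Joins-swap (Flip.side-yz v k′) yzwx ]′ alt
      where
      v = valid (toℕ i)
      k′ = step i
      open Chords (state (toℕ i)) using () renaming (src to src′; tgt to tgt′)
      module Q = Quad (state (toℕ i)) k′
      wxyz : Quadrilateral Q.w Q.x Q.y Q.z
      wxyz = Flip.wxy v k′ , Flip.yzw v k′
      yzwx : Quadrilateral Q.y Q.z Q.w Q.x
      yzwx = proj₂ wxyz , proj₁ wxyz
      opposite : ∀ {c d w x y z} → Straddles c d w x y z → Straddles c d y z w x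
      opposite = straddles-opposite
      miss : ∀ {a b} l → Side a b → ¬ Cross a b (lo l) (hi l)
      miss l ab = noncrossing-side ab (arc l)
      pentagon = pentagon-turn p q u r pqr cqur
      analyse : ∀ {w x y z} →
        (∀ {c d} → Straddles c d Q.w Q.x Q.y Q.z → Straddles c d w x y z) →
        (∀ {c d} → Straddles c d w x y z → Straddles c d Q.w Q.x Q.y Q.z) →
        (Joins p q r s w y → Joins p q r s (src′ k′) (tgt′ k′)) →
        Sides.Side (state (toℕ i)) w x → Quadrilateral w x y z →
        Alternating p u r s w x y z → Realised Support (Corner p q r) ⊎ Overtaken
      analyse {w} {x} {y} {z} to from joined wx Q alt@((w∈ , x∈) , (y∈ , z∈)) with within? p q w
      -- The side `w x` runs from `[p , q)` to `[u , r)` and therefore crosses every chord that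
      -- joins `[q , u)` and `[r , p)`.
      ... | yes w∈′ = inj₂ (i , (k′ , joined (inj₁ (w∈′ , y∈))) , λ { (h , joins) →
              Facts.noncrossing-side v wx (Facts.arc-side v h (inj₁ (refl , refl)))
                (blocked p q r s u w x (src′ h) (tgt′ h) (proj₁ quads) (proj₁ (proj₂ quads)) w∈′ x∈ joins) })
      ... | no w∉ = inj₁ (i , only , supports)
        where
        straddling : ∀ l → Straddles (lo l) (hi l) w x y z →
                     Same p r (lo l) (hi l) ⊎ Same q r (lo l) (hi l)
        -- `p u` crosses `q r`, so it is not an initial arc, and a chord crossing it needs its own
        -- case. The other sides of `p u r s` and the diagonal `p r` are initial sides, which no
        -- initial arc crosses.
        straddling l st with cross? p u (lo l) (hi l)
        ... | yes c = inj₂ (pentagon-diagonal p q u r (lo l) (hi l) (proj₁ pentagon) (proj₂ pentagon) c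
                (miss l (arc-side _ pq)) (miss l (proj₂ (proj₂ (rotated)))) (miss l (proj₁ (proj₂ rotated)))
                (miss l (arc-side j pr)))
          where
          rotated : Cyc r q u × Side u r × Side q u
          rotated = proj₁ rqu , proj₂ (proj₂ rqu) , proj₁ (proj₂ rqu)
        ... | no ¬c = inj₁ (straddles-unique p u r s w x y z (lo l) (hi l) (proj₂ (proj₂ quads)) Q alt st
                ¬c (miss l (proj₂ (proj₂ rqu))) (miss l (proj₁ (proj₂ prs))) (miss l (proj₂ (proj₂ prs)))
                (miss l (arc-side j pr)))
        only : ∀ v → Support i v → Corner p q r v
        only v (l , st , e) with straddling l (to st)
        ... | inj₁ same = [ inj₁ , (λ e → inj₂ (inj₂ e)) ]′ (same-ends (same-sym p r _ _ same) e)
        ... | inj₂ same = inj₂ (same-ends (same-sym q r _ _ same) e)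
        st-pr : Straddles p r w x y z
        st-pr = alternating⇒straddles (proj₂ (proj₂ quads)) alt
        -- Here `w` lies in `[q , u)`, so `q`, like `p`, is after `z` and at most `w`: the
        -- laminations of `p r` and `q r` meet the same two sides.
        st-qr : Straddles q r w x y z
        st-qr = inj₁
          ( straddles-second p q r s u w x z (proj₁ quads) cqur w∈ w∉ z∈
          , straddles-ends r s u y x
              (quad-corner r s p u (quad-opposite p u r s (proj₂ (proj₂ quads)))) y∈ x∈ )
        from-ends : ∀ {a b v} l → Same (lo l) (hi l) a b → Straddles a b w x y z → a ≡ v ⊎ b ≡ v → Support i v
        from-ends l same st e = l , from (straddles-same same st) , same-ends (same-sym _ _ _ _ same) e
        supports : ∀ v → Corner p q r v → Support i v
        supports v (inj₁ e)        = from-ends j pr st-pr (inj₁ e)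
        supports v (inj₂ (inj₁ e)) = from-ends k qr st-qr (inj₁ e)
        supports v (inj₂ (inj₂ e)) = from-ends k qr st-qr (inj₂ e)

  private
    turn-witness : ∀ {p q r} → Realised Support (Corner q r p) → Realised Support (Corner p q r)
    turn-witness (i , a , b) = i , (λ v h → rotate (a v h)) , (λ v h → b v (unrotate h))
      where
      rotate : ∀ {p q r v} → Corner q r p v → Corner p q r v
      rotate = [ (λ e → inj₂ (inj₁ e)) , [ (λ e → inj₂ (inj₂ e)) , inj₁ ]′ ]′
      unrotate : ∀ {p q r v} → Corner p q r v → Corner q r p v
      unrotate = [ (λ e → inj₂ (inj₂ e)) , [ inj₁ , (λ e → inj₂ (inj₁ e)) ]′ ]′

  -- The three simples of an interior triangle cannot overtake each other cyclically.
  triangle-witness : ∀ {p q r j k l} → Cyc p q r → Same (lo j) (hi j) p r → Same (lo k) (hi k) q r →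
                     Same (lo l) (hi l) p q → Realised Support (Corner p q r)
  triangle-witness {p} {q} {r} {j} {k} {l} pqr pr qr pq = conclude
    (triangle-step pqr pr qr pq) (triangle-step qrp qp rp qr) (triangle-step rpq rq pq rp)
    where
    qrp = cyc-rotate p q r pqr
    rpq = cyc-rotate q r p qrp
    qp = Same-swap pq
    rp = Same-swap pr
    rq = Same-swap qr
    conclude : Realised Support (Corner p q r) ⊎ Overtaken pqr pr qr pq →
               Realised Support (Corner q r p) ⊎ Overtaken qrp qp rp qr →
               Realised Support (Corner r p q) ⊎ Overtaken rpq rq pq rp → Realised Support (Corner p q r)
    conclude (inj₁ W) _ _ = W
    conclude _ (inj₁ W) _ = turn-witness W
    conclude _ _ (inj₁ W) = turn-witness (turn-witness W)
    conclude (inj₂ (i₁ , j₁ , ¬k₁)) (inj₂ (i₂ , l₂ , ¬j₂)) (inj₂ (i₃ , k₃ , ¬l₃)) =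
      ⊥-elim (ℕₚ.<-irrefl refl (ℕₚ.<-trans t₁<t₂ (ℕₚ.<-trans t₂<t₃ t₃<t₁)))
      where
      t₁<t₂ : toℕ i₁ < toℕ i₂
      -- In the rotated triangle the arc `p r` appears with the quadrilateral `r s p q`, whence
      -- `presents-opposite`.
      t₁<t₂ = present-until (outer-frame pqr pr qr pq) pr {i₁} {i₂} j₁
                (λ h → ¬j₂ (presents-opposite {S = state (toℕ i₂)} h))
      t₂<t₃ : toℕ i₂ < toℕ i₃
      t₂<t₃ = present-until (outer-frame qrp qp rp qr) qp {i₂} {i₃} l₂
                (λ h → ¬l₃ (presents-opposite {S = state (toℕ i₃)} h))
      t₃<t₁ : toℕ i₃ < toℕ i₁
      t₃<t₁ = present-until (outer-frame rpq rq pq rp) rq {i₃} {i₁} k₃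
                (λ h → ¬k₁ (presents-opposite {S = state (toℕ i₁)} h))

-- The initial triangulation and its quiver

interleaved-cross = order 4 (λ a b c d →
  (a <ᶠ c ∧ᶠ c <ᶠ b ∧ᶠ b <ᶠ d) ∨ᶠ (c <ᶠ a ∧ᶠ a <ᶠ d ∧ᶠ d <ᶠ b) ⇒ᶠ cross a b c d) refl

cross-interleaved = order 4 (λ a b c d → a <ᶠ b ⇒ᶠ c <ᶠ d ⇒ᶠ cross a b c d ⇒ᶠ
  (a <ᶠ c ∧ᶠ c <ᶠ b ∧ᶠ b <ᶠ d) ∨ᶠ (c <ᶠ a ∧ᶠ a <ᶠ d ∧ᶠ d <ᶠ b)) refl

cross-flip = order 4 (λ a b c d → cross a b c d ⇒ᶠ cross b a c d) refl

same-sorted = order 4 (λ a b c d → a <ᶠ b ⇒ᶠ c <ᶠ d ⇒ᶠ same a b c d ⇒ᶠ a ≡ᶠ c ∧ᶠ b ≡ᶠ d) refl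

next-left = order 6 (λ o m s e c d → o ≤ᶠ s ⇒ᶠ s <ᶠ m ⇒ᶠ c <ᶠ m ⇒ᶠ o ≤ᶠ c ⇒ᶠ cyc s e c ⇒ᶠ
  eqᶠ 1 e d ∨ᶠ (d ≡ᶠ o ∧ᶠ eqᶠ 1 e m) ⇒ᶠ cyc s e d) refl

-- A chord that enters the triangle `s e a` through `a s` and crosses neither other side must end at
-- `e`.
fan-arc = order 5 (λ s e a c d → cyc s e a ⇒ᶠ cross a s c d ⇒ᶠ ¬ᶠ cross s e c d ⇒ᶠ ¬ᶠ cross e a c d ⇒ᶠ
  (c ≡ᶠ e ∧ᶠ cyc e a d ∧ᶠ cyc s e d) ∨ᶠ (d ≡ᶠ e ∧ᶠ cyc e a c ∧ᶠ cyc s e c)) refl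

-- One diagonal with both ends on the same side of the cut already makes a factor of the shear
-- coordinate vanish.
shear-zero-cut = order 6 (λ w x y z c d → c <ᶠ d ⇒ᶠ cyc w x y ⇒ᶠ cyc y z w ⇒ᶠ
  ¬ᶠ cross w x c d ⇒ᶠ ¬ᶠ cross x y c d ⇒ᶠ ¬ᶠ cross y z c d ⇒ᶠ ¬ᶠ cross z w c d ⇒ᶠ
  ¬ᶠ cross w y c d ⇒ᶠ ¬ᶠ same w y c d ⇒ᶠ
  (cut c d w ∧ᶠ cut c d y) ∨ᶠ (¬ᶠ cut c d w ∧ᶠ ¬ᶠ cut c d y) ∨ᶠ
  (cut c d x ∧ᶠ cut c d z) ∨ᶠ (¬ᶠ cut c d x ∧ᶠ ¬ᶠ cut c d z)) refl

module Initial {m n : ℕ} (τ : Fin n → Seg m) (tri : IsTriangulation m n τ) where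

  open IsTriangulation tri
  open Polygon m

  lo hi : Fin n → ℕ
  lo i = toℕ (proj₁ (τ i))
  hi i = toℕ (proj₂ (τ i))

  lo<hi : ∀ i → lo i < hi i
  lo<hi i = proj₁ (arcs i)

  private
    -- The constant apex is a placeholder: `Side` and `Triangle` read only the end points of arcs,
    -- so they can serve in the search for the true apex.
    bare : Chords n
    bare = record { src = lo ; tgt = hi ; apex = λ _ _ → 0 }

  findApex : ℕ → ℕ → ℕ
  findApex s e with Finₚ.any? (λ (c : Fin m) → Sides.triangle? bare s e (toℕ c))
  ... | yes (c , _) = toℕ c
  ... | no _        = 0

  initial : Chords n
  initial = record { src = lo ; tgt = hi ; apex = findApex }

  open Sides bare

  initial-noncrossing : ∀ i j → ¬ Cross (lo i) (hi i) (lo j) (hi j)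
  initial-noncrossing i j c =
    noncross i j (cross-interleaved (lo i) (hi i) (lo j) (hi j) (lo<hi i) (lo<hi j) c)

  initial-distinct : ∀ i j → Same (lo i) (hi i) (lo j) (hi j) → i ≡ j
  initial-distinct i j p with same-sorted (lo i) (hi i) (lo j) (hi j) (lo<hi i) (lo<hi j) p
  ... | q , r = distinct i j (cong₂ _,_ (Finₚ.toℕ-injective q) (Finₚ.toℕ-injective r))

  arc-is-side : ∀ i → Side (lo i) (hi i)
  arc-is-side i = side (Finₚ.toℕ<n _) (Finₚ.toℕ<n _) (inj₂ (i , inj₁ (refl , refl)))

  sorted-crossed : ∀ {a b} → a < b → (a<m : a < m) (b<m : b < m) → ¬ Side a b →
                   ∃ λ i → Cross a b (lo i) (hi i)
  sorted-crossed {a} {b} a<b a<m b<m ¬ab with maximal (fromℕ< a<m , fromℕ< b<m) diagonal fresh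
    where
    a′ = Finₚ.toℕ-fromℕ< a<m
    b′ = Finₚ.toℕ-fromℕ< b<m
    diagonal : IsDiagonal m (fromℕ< a<m , fromℕ< b<m)
    diagonal rewrite a′ | b′ =
      a<b , (λ e → ¬ab (side a<m b<m (inj₁ (inj₁ (sym e)))))
          , (λ e → ¬ab (side a<m b<m (inj₁ (inj₂ (inj₂ (inj₁ e))))))
    fresh : ∀ i → τ i ≢ (fromℕ< a<m , fromℕ< b<m)
    fresh i e = ¬ab (side a<m b<m (inj₂ (i , inj₁
      (trans (cong (λ t → toℕ (proj₁ t)) e) a′ , trans (cong (λ t → toℕ (proj₂ t)) e) b′))))
  ... | i , c = i , interleaved-cross a b (lo i) (hi i)
    (subst₂ (λ a b → (a < lo i × lo i < b × b < hi i) ⊎ (lo i < a × a < hi i × hi i < b))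
            (Finₚ.toℕ-fromℕ< a<m) (Finₚ.toℕ-fromℕ< b<m) c)

  nonside-crossed : ∀ {a b} → a ≢ b → a < m → b < m → ¬ Side a b → ∃ λ i → Cross a b (lo i) (hi i)
  nonside-crossed {a} {b} a≢b a<m b<m ¬ab with ℕₚ.<-cmp a b
  ... | tri< a<b _ _ = sorted-crossed a<b a<m b<m ¬ab
  ... | tri≈ _ a≡b _ = ⊥-elim (a≢b a≡b)
  ... | tri> _ _ b<a with sorted-crossed b<a b<m a<m (λ s → ¬ab (side-swap s))
  ...   | i , c = i , cross-flip b a (lo i) (hi i) c

  -- Take the last vertex a on the left of s → e, in the order starting at e, such that e a is a side.
  fan : ∀ {s e a} → Side s e → Cyc s e a → Side e a → Acc _<_ (m ∸ dist m e a) → ∃ λ (c : Fin m) → Triangle s e (toℕ c)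
  fan {s} {e} {a} se sea ea (acc rec)
    with Finₚ.any? (λ (c : Fin m) → cyc? e a (toℕ c) ×-dec cyc? s e (toℕ c) ×-dec side? e (toℕ c))
  ... | yes (c , eac , sec , ec) =
    fan se sec ec (rec (ℕₚ.∸-monoʳ-< (dist-cyc m (Side.b<m se) (Side.b<m ea) (Finₚ.toℕ<n c) eac)
                                    (dist≤m c)))
    where
    dist≤m : ∀ (c : Fin m) → dist m e (toℕ c) ≤ m
    dist≤m c with e ≤? toℕ c
    ... | yes _ = ℕₚ.≤-trans (ℕₚ.m∸n≤m (toℕ c) e) (ℕₚ.<⇒≤ (Finₚ.toℕ<n c))
    ... | no e≰c = ℕₚ.≤-trans (ℕₚ.∸-monoʳ-≤ (toℕ c + m) (ℕₚ.<⇒≤ (ℕₚ.≰⇒> e≰c)))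
                              (ℕₚ.≤-reflexive (ℕₚ.m+n∸m≡n (toℕ c) m))
  ... | no last with side? a s
  ...   | yes as = fromℕ< a<m , subst (Triangle s e) (sym (Finₚ.toℕ-fromℕ< a<m)) (sea , ea , as)
    where a<m = Side.b<m ea
  ...   | no ¬as = ⊥-elim (contra (nonside-crossed (λ p → proj₂ (proj₂ (cyc-distinct s e a sea)) (sym p))
                                     (Side.b<m ea) (Side.a<m se) ¬as))
    where
    contra : ¬ ∃ λ i → Cross a s (lo i) (hi i)
    contra (i , c) with fan-arc s e a (lo i) (hi i) sea c (clear se) (clear ea)
      where
      clear : ∀ {a b} → Side a b → ¬ Cross a b (lo i) (hi i)
      clear ab = sides-noncrossing initial-noncrossing ab (arc-is-side i)
    ... | inj₁ (refl , eac , sec) = last (proj₂ (τ i) , eac , sec , arc-is-side i)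
    ... | inj₂ (refl , eac , sec) = last (proj₁ (τ i) , eac , sec , side-swap (arc-is-side i))

  triangle-exists : ∀ {s e c} → Side s e → c < m → Cyc s e c → ∃ λ (c : Fin m) → Triangle s e (toℕ c)
  triangle-exists {s} {e} {c} se c<m sec with suc e <? m
  -- The fan at `e` starts with the boundary edge leaving `e`; its far end is on the left of `s e`
  -- because some vertex is.
  ... | yes e+1<m = fan se (next-left 0 m s e c (suc e) z≤n (Side.a<m se) c<m z≤n sec (inj₁ refl))
                       (side (Side.b<m se) e+1<m (inj₁ (inj₁ refl))) (<-wellFounded _)
  ... | no e+1≮m = fan se (next-left 0 m s e c 0 z≤n (Side.a<m se) c<m z≤n sec (inj₂ (refl , e+1≡m)))
                      (side (Side.b<m se) (ℕₚ.≤-<-trans z≤n c<m) (inj₁ (inj₂ (inj₂ (inj₂ (refl , e+1≡m))))))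
                      (<-wellFounded _)
    where
    e+1≡m : suc e ≡ m
    e+1≡m = ℕₚ.≤-antisym (Side.b<m se) (ℕₚ.≮⇒≥ e+1≮m)

  -- The vertex after `hi i`, or else 0, works unless the arc runs from 0 to the last vertex, and
  -- that segment is not a diagonal.
  vertex-left : ∀ i → ∃ λ c → c < m × Cyc (lo i) (hi i) c
  vertex-left i with suc (hi i) <? m
  ... | yes p = suc (hi i) , p , inj₁ (lo<hi i , ℕₚ.n<1+n _)
  ... | no ¬p with lo i ℕ.≟ 0
  ...   | yes q = ⊥-elim (proj₂ (proj₂ (arcs i)) (q , ℕₚ.≤-antisym (Finₚ.toℕ<n (proj₂ (τ i))) (ℕₚ.≮⇒≥ ¬p)))
  ...   | no ¬q = 0 , ℕₚ.≤-<-trans z≤n (Finₚ.toℕ<n (proj₂ (τ i)))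
                , inj₂ (inj₂ (ℕₚ.n≢0⇒n>0 ¬q , lo<hi i))

  vertex-right : ∀ i → ∃ λ c → c < m × Cyc (hi i) (lo i) c
  vertex-right i = suc (lo i) , ℕₚ.<-trans lt (Finₚ.toℕ<n (proj₂ (τ i)))
                 , inj₂ (inj₁ (ℕₚ.n<1+n _ , lt))
    where
    lt : suc (lo i) < hi i
    lt = ℕₚ.≤∧≢⇒< (lo<hi i) λ e → proj₁ (proj₂ (arcs i)) (sym e)

  findApex-correct : ∀ {s e} → (∃ λ (c : Fin m) → Triangle s e (toℕ c)) → Triangle s e (findApex s e)
  findApex-correct {s} {e} t with Finₚ.any? (λ (c : Fin m) → Sides.triangle? bare s e (toℕ c))
  ... | yes (_ , t′) = t′
  ... | no none′     = ⊥-elim (none′ t)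

  initial-triangulated : Triangulated initial
  initial-triangulated = record
    { noncrossing = initial-noncrossing ; distinct = initial-distinct ; triangle = triangle }
    where
    transfer : ∀ {a b} → Side a b → Sides.Side initial a b
    transfer (side p q e) = Sides.side p q e
    triangle : ∀ i {s e} → Same (lo i) (hi i) s e → Sides.Triangle initial s e (findApex s e)
    triangle i (inj₁ (refl , refl)) with vertex-left i
    ... | c , c<m , l with findApex-correct (triangle-exists (arc-is-side i) c<m l)
    ...   | cy , p , q = cy , transfer p , transfer q
    triangle i (inj₂ (refl , refl)) with vertex-right i
    ... | c , c<m , l with findApex-correct (triangle-exists (side-swap (arc-is-side i)) c<m l)
    ...   | cy , p , q = cy , transfer p , transfer q

between = order 3 (λ u v z → u <ᶠ v ⇒ᶠ cyc v u z ⇒ᶠ u <ᶠ z ∧ᶠ z <ᶠ v) refl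

-- Sums over triples of vertices and Boolean tests

sum-zero : ∀ {k} (f : Fin k → ℕ) → (∀ i → f i ≡ 0) → sumFin f ≡ 0
sum-zero {zero}  f h = refl
sum-zero {suc k} f h = cong₂ _+_ (h Fin.zero) (sum-zero _ λ i → h (Fin.suc i))

sum-cong : ∀ {k} {f g : Fin k → ℕ} → (∀ i → f i ≡ g i) → sumFin f ≡ sumFin g
sum-cong {zero}  h = refl
sum-cong {suc k} h = cong₂ _+_ (h Fin.zero) (sum-cong λ i → h (Fin.suc i))

sum-single : ∀ {k} (f : Fin k → ℕ) c → (∀ i → i ≢ c → f i ≡ 0) → sumFin f ≡ f c
sum-single f Fin.zero    h = trans (cong (λ t → f Fin.zero + t) (sum-zero _ λ i → h (Fin.suc i) λ ())) (ℕₚ.+-identityʳ _)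
sum-single f (Fin.suc c) h =
  trans (cong₂ _+_ (h Fin.zero λ ()) refl)
        (sum-single (λ i → f (Fin.suc i)) c λ i i≢c → h (Fin.suc i) λ e → i≢c (Finₚ.suc-injective e))

sum-+ : ∀ {k} (f g : Fin k → ℕ) → sumFin (λ i → f i + g i) ≡ sumFin f + sumFin g
sum-+ {zero}  f g = refl
sum-+ {suc k} f g =
  trans (cong (_+_ (f Fin.zero + g Fin.zero)) (sum-+ (λ i → f (Fin.suc i)) (λ i → g (Fin.suc i))))
        (interchange ℕₚ.+-commutativeSemigroup (f Fin.zero) (g Fin.zero) _ _)

sum³ : ∀ {k} → (Fin k → Fin k → Fin k → ℕ) → ℕ
sum³ F = sumFin λ a → sumFin λ b → sumFin λ c → F a b c

sum³-cong : ∀ {k} {F G : Fin k → Fin k → Fin k → ℕ} → (∀ a b c → F a b c ≡ G a b c) → sum³ F ≡ sum³ G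
sum³-cong h = sum-cong λ a → sum-cong λ b → sum-cong λ c → h a b c

sum³-+ : ∀ {k} (F G : Fin k → Fin k → Fin k → ℕ) → sum³ (λ a b c → F a b c + G a b c) ≡ sum³ F + sum³ G
sum³-+ F G =
  trans (sum-cong λ a → trans (sum-cong λ b → sum-+ (F a b) (G a b))
                              (sum-+ (λ b → sumFin (F a b)) (λ b → sumFin (G a b))))
        (sum-+ (λ a → sumFin λ b → sumFin (F a b)) (λ a → sumFin λ b → sumFin (G a b)))

sum³-zero : ∀ {k} (F : Fin k → Fin k → Fin k → ℕ) → (∀ a b c → F a b c ≡ 0) → sum³ F ≡ 0
sum³-zero F h = sum-zero _ λ a → sum-zero _ λ b → sum-zero _ λ c → h a b c

sum³-single : ∀ {k} (F : Fin k → Fin k → Fin k → ℕ) a₀ b₀ c₀ →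
              (∀ a b c → ¬ (a ≡ a₀ × b ≡ b₀ × c ≡ c₀) → F a b c ≡ 0) → sum³ F ≡ F a₀ b₀ c₀
sum³-single F a₀ b₀ c₀ h =
  trans (sum-single _ a₀ λ a a≢ → sum-zero _ λ b → sum-zero _ λ c → h a b c λ p → a≢ (proj₁ p))
  (trans (sum-single _ b₀ λ b b≢ → sum-zero _ λ c → h a₀ b c λ p → b≢ (proj₁ (proj₂ p)))
         (sum-single _ c₀ λ c c≢ → h a₀ b₀ c λ p → c≢ (proj₂ (proj₂ p))))

T-∧⁻ : ∀ {a b} → T (a ∧ b) → T a × T b
T-∧⁻ {true} h = tt , h

T-∧⁺ : ∀ {a b} → T a → T b → T (a ∧ b)
T-∧⁺ {true} _ h = h

T-∨⁻ : ∀ {a b} → T (a ∨ b) → T a ⊎ T b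
T-∨⁻ {true}  h = inj₁ h
T-∨⁻ {false} h = inj₂ h

T-∨ˡ : ∀ {a b} → T a → T (a ∨ b)
T-∨ˡ {true} _ = tt

T-∨ʳ : ∀ {a b} → T b → T (a ∨ b)
T-∨ʳ {true}  _ = tt
T-∨ʳ {false} h = h

anyFin⁻ : ∀ {k} (f : Fin k → Bool) → T (anyFin f) → ∃ λ i → T (f i)
anyFin⁻ {suc k} f h with T-∨⁻ {f Fin.zero} h
... | inj₁ p = Fin.zero , p
... | inj₂ p with anyFin⁻ (λ i → f (Fin.suc i)) p
...   | i , q = Fin.suc i , q

anyFin⁺ : ∀ {k} (f : Fin k → Bool) i → T (f i) → T (anyFin f)
anyFin⁺ f Fin.zero    h = T-∨ˡ {f Fin.zero} h
anyFin⁺ f (Fin.suc i) h = T-∨ʳ {f Fin.zero} (anyFin⁺ (λ i → f (Fin.suc i)) i h)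

b2n-T : ∀ {b} → T b → b2n b ≡ 1
b2n-T {true} _ = refl

b2n-¬T : ∀ {b} → ¬ T b → b2n b ≡ 0
b2n-¬T {true}  h = ⊥-elim (h tt)
b2n-¬T {false} h = refl

guard : Bool → ℕ → ℕ
guard b x = if b then x else 0

guard-+ : ∀ b x y z → guard b (x + y + z) ≡ guard b x + guard b y + guard b z
guard-+ true  x y z = refl
guard-+ false x y z = refl

guard-zero : ∀ b {P} → ¬ (T b × T P) → guard b (b2n P) ≡ 0
guard-zero true  {true}  h = ⊥-elim (h (tt , tt))
guard-zero true  {false} h = refl
guard-zero false         h = refl

⁺-difference : ∀ p q → p ≡ 0 ⊎ q ≡ 0 → (+ p ℤ.- + q) ⁺ ≡ p × (ℤ.- (+ p ℤ.- + q)) ⁺ ≡ q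
⁺-difference p zero    _ rewrite ℕₚ.+-identityʳ p = refl , ⁺-nonpos (ℤₚ.neg-mono-≤ (ℤ.+≤+ (z≤n {p})))
⁺-difference zero (suc q) _ = refl , refl
⁺-difference (suc p) (suc q) (inj₁ ())
⁺-difference (suc p) (suc q) (inj₂ ())

-- The framed quiver of the initial triangulation

module InitialQuiver {m n : ℕ} (τ : Fin n → Seg m) (tri : IsTriangulation m n τ) where
  open Polygon m
  open Initial τ tri
  open Sides initial

  isArcNo⁻ : ∀ i x y → T (isArcNo τ i x y) → lo i ≡ toℕ x × hi i ≡ toℕ y
  isArcNo⁻ i x y h with τ i
  ... | a , b = ℕₚ.≡ᵇ⇒≡ (toℕ a) (toℕ x) (proj₁ (T-∧⁻ h))
              , ℕₚ.≡ᵇ⇒≡ (toℕ b) (toℕ y) (proj₂ (T-∧⁻ {toℕ a ≡ᵇ toℕ x} h))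

  isArcNo⁺ : ∀ i x y → lo i ≡ toℕ x × hi i ≡ toℕ y → T (isArcNo τ i x y)
  isArcNo⁺ i x y (p , q) with τ i
  ... | a , b = T-∧⁺ (ℕₚ.≡⇒≡ᵇ (toℕ a) (toℕ x) p) (ℕₚ.≡⇒≡ᵇ (toℕ b) (toℕ y) q)

  isArc⁻ : ∀ x y → T (isArc τ x y) → ∃ λ i → lo i ≡ toℕ x × hi i ≡ toℕ y
  isArc⁻ x y h with anyFin⁻ (λ i → isArcNo τ i x y) h
  ... | i , p = i , isArcNo⁻ i x y p

  isSide⁻ : ∀ x y → T (isSide τ x y) → Side (toℕ x) (toℕ y)
  isSide⁻ x y h = side (Finₚ.toℕ<n x) (Finₚ.toℕ<n y) (edge (T-∨⁻ h))
    where
    edge : T (isBoundary τ x y) ⊎ T (isArc τ x y) → Boundary (toℕ x) (toℕ y) ⊎ Arc (toℕ x) (toℕ y)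
    edge (inj₁ b) with T-∨⁻ {suc (toℕ x) ≡ᵇ toℕ y} b
    ... | inj₁ p = inj₁ (inj₁ (ℕₚ.≡ᵇ⇒≡ (suc (toℕ x)) (toℕ y) p))
    ... | inj₂ p = inj₁ (inj₂ (inj₂ (inj₁
            ( ℕₚ.≡ᵇ⇒≡ (toℕ x) 0 (proj₁ (T-∧⁻ p))
            , ℕₚ.≡ᵇ⇒≡ (suc (toℕ y)) m (proj₂ (T-∧⁻ {toℕ x ≡ᵇ 0} p))))))
    edge (inj₂ a) with isArc⁻ x y a
    ... | i , q = inj₂ (i , inj₁ q)

  isSide⁺ : ∀ x y → toℕ x < toℕ y → Side (toℕ x) (toℕ y) → T (isSide τ x y)
  isSide⁺ x y x<y (side _ _ (inj₁ (inj₁ p))) =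
    T-∨ˡ (T-∨ˡ (ℕₚ.≡⇒≡ᵇ (suc (toℕ x)) (toℕ y) p))
  isSide⁺ x y x<y (side _ _ (inj₁ (inj₂ (inj₁ p)))) =
    ⊥-elim (ℕₚ.<-asym x<y (ℕₚ.≤-reflexive p))
  isSide⁺ x y x<y (side _ _ (inj₁ (inj₂ (inj₂ (inj₁ (p , q)))))) =
    T-∨ˡ (T-∨ʳ {suc (toℕ x) ≡ᵇ toℕ y} (T-∧⁺ (ℕₚ.≡⇒≡ᵇ (toℕ x) 0 p) (ℕₚ.≡⇒≡ᵇ (suc (toℕ y)) m q)))
  isSide⁺ x y x<y (side _ _ (inj₁ (inj₂ (inj₂ (inj₂ (p , q)))))) =
    ⊥-elim (ℕₚ.n≮0 (subst (toℕ x <_) p x<y))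
  isSide⁺ x y x<y (side _ _ (inj₂ (i , inj₁ e))) =
    T-∨ʳ {isBoundary τ x y} (anyFin⁺ (λ i → isArcNo τ i x y) i (isArcNo⁺ i x y e))
  isSide⁺ x y x<y (side _ _ (inj₂ (i , inj₂ (p , q)))) =
    ⊥-elim (ℕₚ.<-asym x<y (subst₂ _<_ p q (lo<hi i)))

  isTriangle⁻ : ∀ a b c → T (isTriangle τ a b c) → (toℕ a < toℕ b × toℕ b < toℕ c) ×
                Side (toℕ a) (toℕ b) × Side (toℕ b) (toℕ c) × Side (toℕ a) (toℕ c)
  isTriangle⁻ a b c h₀ with T-∧⁻ {toℕ a <ᵇ toℕ b} h₀
  ... | a<b , h₁ with T-∧⁻ {toℕ b <ᵇ toℕ c} h₁
  ...   | b<c , h₂ with T-∧⁻ {isSide τ a b} h₂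
  ...     | ab , h₃ with T-∧⁻ {isSide τ b c} h₃
  ...       | bc , ac = (ℕₚ.<ᵇ⇒< _ _ a<b , ℕₚ.<ᵇ⇒< _ _ b<c)
                      , isSide⁻ a b ab , isSide⁻ b c bc , isSide⁻ a c ac

  isTriangle⁺ : ∀ a b c → toℕ a < toℕ b → toℕ b < toℕ c →
                Side (toℕ a) (toℕ b) → Side (toℕ b) (toℕ c) → Side (toℕ a) (toℕ c) → T (isTriangle τ a b c)
  isTriangle⁺ a b c a<b b<c ab bc ac =
    T-∧⁺ (ℕₚ.<⇒<ᵇ a<b) (T-∧⁺ (ℕₚ.<⇒<ᵇ b<c) (T-∧⁺ (isSide⁺ a b a<b ab)
      (T-∧⁺ (isSide⁺ b c b<c bc) (isSide⁺ a c (ℕₚ.<-trans a<b b<c) ac))))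

  module ArcRow (h : Fin n) where
    open Triangulated initial-triangulated
    open Facts initial-triangulated

    u v : Fin m
    u = proj₁ (τ h)
    v = proj₂ (τ h)

    outer : Triangle (lo h) (hi h) (findApex (lo h) (hi h))
    outer = triangle h (inj₁ (refl , refl))

    inner : Triangle (hi h) (lo h) (findApex (hi h) (lo h))
    inner = triangle h (inj₂ (refl , refl))

    -- Here `x` is the apex outside the range from `u` to `v` and `z` the one inside it; in `Quad`
    -- the two letters are exchanged.
    x z : Fin m
    x = Fin.fromℕ< (Side.b<m (proj₁ (proj₂ outer)))
    z = Fin.fromℕ< (Side.b<m (proj₁ (proj₂ inner)))

    x-apex : toℕ x ≡ findApex (lo h) (hi h)
    x-apex = Finₚ.toℕ-fromℕ< _

    z-apex : toℕ z ≡ findApex (hi h) (lo h)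
    z-apex = Finₚ.toℕ-fromℕ< _

    outer′ : Triangle (lo h) (hi h) (toℕ x)
    outer′ = subst (Triangle (lo h) (hi h)) (sym x-apex) outer

    inner′ : Triangle (hi h) (lo h) (toℕ z)
    inner′ = subst (Triangle (hi h) (lo h)) (sym z-apex) inner

    Filter : Set
    Filter = Fin m → Fin m → Fin m → Bool

    -- The arrows at `h` are sorted by the role of `h` in the triangle `a < b < c`. In the inner
    -- triangle `h` is always `a c`; in the outer one it is `a b` if `x` comes after `v`, and `b c`
    -- if `x` comes before `u`. Each sum thus has at most one nonzero term.
    as-ab as-bc as-ac : Filter → ℕ
    as-ab φ = sum³ λ a b c → guard (isTriangle τ a b c) (b2n (isArcNo τ h a b ∧ φ a b c))
    as-bc φ = sum³ λ a b c → guard (isTriangle τ a b c) (b2n (isArcNo τ h b c ∧ φ a b c))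
    as-ac φ = sum³ λ a b c → guard (isTriangle τ a b c) (b2n (isArcNo τ h a c ∧ φ a b c))

    at-uv : ∀ a b → T (isArcNo τ h a b) → a ≡ u × b ≡ v
    at-uv a b p with isArcNo⁻ h a b p
    ... | q , r = Finₚ.toℕ-injective (sym q) , Finₚ.toℕ-injective (sym r)

    apex-x : ∀ {c} → Cyc (lo h) (hi h) (toℕ c) → Side (hi h) (toℕ c) → Side (toℕ c) (lo h) → c ≡ x
    apex-x p q r = Finₚ.toℕ-injective (apex-unique (p , q , r) outer′)

    apex-z : ∀ {c} → Cyc (hi h) (lo h) (toℕ c) → Side (lo h) (toℕ c) → Side (toℕ c) (hi h) → c ≡ z
    apex-z p q r = Finₚ.toℕ-injective (apex-unique (p , q , r) inner′)

    self : T (isArcNo τ h u v)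
    self = isArcNo⁺ h u v (refl , refl)

    at-point : ∀ {t s φ} → T t → T s → guard t (b2n (s ∧ φ)) ≡ b2n φ
    at-point {true} {true} _ _ = refl

    ab-apex : ∀ a b c → T (isTriangle τ a b c) × T (isArcNo τ h a b) → a ≡ u × b ≡ v × c ≡ x
    ab-apex a b c (t , p) with at-uv a b p | isTriangle⁻ a b c t
    ... | refl , refl | (u<v , v<c) , _ , vc , uc = refl , refl , apex-x (inj₁ (u<v , v<c)) vc (side-swap uc)

    bc-apex : ∀ a b c → T (isTriangle τ a b c) × T (isArcNo τ h b c) → a ≡ x × b ≡ u × c ≡ v
    bc-apex a b c (t , p) with at-uv b c p | isTriangle⁻ a b c t
    ... | refl , refl | (a<u , u<v) , au , _ , av = apex-x (inj₂ (inj₂ (a<u , u<v))) (side-swap av) au , refl , refl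

    ac-apex : ∀ a b c → T (isTriangle τ a b c) × T (isArcNo τ h a c) → a ≡ u × b ≡ z × c ≡ v
    ac-apex a b c (t , p) with at-uv a c p | isTriangle⁻ a b c t
    ... | refl , refl | (u<b , b<v) , ub , bv , _ = refl , apex-z (inj₂ (inj₁ (u<b , b<v))) ub bv , refl

    prune : ∀ {t s φ} → ¬ (T t × T s) → guard t (b2n (s ∧ φ)) ≡ 0
    prune {t} {s} {φ} h = guard-zero t λ { (p , q) → h (p , proj₁ (T-∧⁻ {s} q)) }

    as-ac-value : ∀ φ → as-ac φ ≡ b2n (φ u z v)
    as-ac-value φ =
      trans (sum³-single _ u z v λ a b c ¬p → prune {isTriangle τ a b c} {isArcNo τ h a c} λ q → ¬p (ac-apex a b c q))
            (at-point (isTriangle⁺ u z v (proj₁ ordered) (proj₂ ordered) uz zv (arc-side h (inj₁ (refl , refl)))) self)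
      where
      uz = proj₁ (proj₂ inner′)
      zv = proj₂ (proj₂ inner′)
      ordered : toℕ u < toℕ z × toℕ z < toℕ v
      ordered = between (toℕ u) (toℕ v) (toℕ z) (lo<hi h) (proj₁ inner′)

    module _ (v<x : toℕ v < toℕ x) where
      as-ab-value : ∀ φ → as-ab φ ≡ b2n (φ u v x)
      as-ab-value φ =
        trans (sum³-single _ u v x λ a b c ¬p → prune {isTriangle τ a b c} {isArcNo τ h a b} λ q → ¬p (ab-apex a b c q))
              (at-point (isTriangle⁺ u v x (lo<hi h) v<x (arc-side h (inj₁ (refl , refl)))
                (proj₁ (proj₂ outer′)) (side-swap (proj₂ (proj₂ outer′)))) self)

      as-bc-none : ∀ φ → as-bc φ ≡ 0
      as-bc-none φ = sum³-zero _ λ a b c → prune {isTriangle τ a b c} {isArcNo τ h b c} λ q → none′ a b c q (bc-apex a b c q)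
        where
        none′ : ∀ a b c → T (isTriangle τ a b c) × T (isArcNo τ h b c) → ¬ (a ≡ x × b ≡ u × c ≡ v)
        none′ a b c (t , _) (refl , refl , refl) =
          ℕₚ.<-asym v<x (ℕₚ.<-trans (proj₁ (proj₁ (isTriangle⁻ x u v t))) (lo<hi h))

    module _ (x<u : toℕ x < toℕ u) where
      as-bc-value : ∀ φ → as-bc φ ≡ b2n (φ x u v)
      as-bc-value φ =
        trans (sum³-single _ x u v λ a b c ¬p → prune {isTriangle τ a b c} {isArcNo τ h b c} λ q → ¬p (bc-apex a b c q))
              (at-point (isTriangle⁺ x u v x<u (lo<hi h) (proj₂ (proj₂ outer′))
                (arc-side h (inj₁ (refl , refl))) (side-swap (proj₁ (proj₂ outer′)))) self)

      as-ab-none : ∀ φ → as-ab φ ≡ 0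
      as-ab-none φ = sum³-zero _ λ a b c → prune {isTriangle τ a b c} {isArcNo τ h a b} λ q → none′ a b c q (ab-apex a b c q)
        where
        none′ : ∀ a b c → T (isTriangle τ a b c) × T (isArcNo τ h a b) → ¬ (a ≡ u × b ≡ v × c ≡ x)
        none′ a b c (t , _) (refl , refl , refl) =
          ℕₚ.<-asym x<u (ℕₚ.<-trans (lo<hi h) (proj₂ (proj₁ (isTriangle⁻ u v x t))))

    sum³-roles : ∀ {F G H : Fin m → Fin m → Fin m → ℕ} →
      sum³ (λ a b c → guard (isTriangle τ a b c) (F a b c + G a b c + H a b c)) ≡
      sum³ (λ a b c → guard (isTriangle τ a b c) (F a b c)) +
      sum³ (λ a b c → guard (isTriangle τ a b c) (G a b c)) +
      sum³ (λ a b c → guard (isTriangle τ a b c) (H a b c))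
    sum³-roles {F} {G} {H} =
      trans (sum³-cong λ a b c → guard-+ (isTriangle τ a b c) (F a b c) (G a b c) (H a b c))
      (trans (sum³-+ (λ a b c → F′ a b c + G′ a b c) H′) (cong (_+ sum³ H′) (sum³-+ F′ G′)))
      where
      F′ G′ H′ : Fin m → Fin m → Fin m → ℕ
      F′ a b c = guard (isTriangle τ a b c) (F a b c)
      G′ a b c = guard (isTriangle τ a b c) (G a b c)
      H′ a b c = guard (isTriangle τ a b c) (H a b c)

    out-arrows : ∀ l → QT τ h l ≡ as-ab (λ a b c → isArcNo τ l b c) + as-bc (λ a b c → isArcNo τ l a c)
                                + as-ac (λ a b c → isArcNo τ l a b)
    out-arrows l = sum³-roles

    in-arrows : ∀ l → QT τ l h ≡ as-bc (λ a b c → isArcNo τ l a b) + as-ac (λ a b c → isArcNo τ l b c)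
                               + as-ab (λ a b c → isArcNo τ l a c)
    in-arrows l = trans
      (sum³-cong λ a b c → cong (guard (isTriangle τ a b c)) (cong₂ _+_ (cong₂ _+_
        (cong b2n (Boolₚ.∧-comm (isArcNo τ l a b) _)) (cong b2n (Boolₚ.∧-comm (isArcNo τ l b c) _)))
        (cong b2n (Boolₚ.∧-comm (isArcNo τ l a c) _))))
      sum³-roles

    arrow-indicator : ∀ l {a b} → toℕ a < toℕ b → + b2n (isArcNo τ l a b) ≡ indicator initial l (toℕ a) (toℕ b)
    arrow-indicator l {a} {b} a<b with Boolₚ.T? (isArcNo τ l a b)
    ... | yes p = trans (cong +_ (b2n-T p))
                        (sym (χ-yes (same? (lo l) (hi l) (toℕ a) (toℕ b)) (inj₁ (isArcNo⁻ l a b p))))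
    ... | no ¬p = trans (cong +_ (b2n-¬T ¬p)) (sym (χ-no (same? (lo l) (hi l) (toℕ a) (toℕ b)) λ e →
                    ¬p (isArcNo⁺ l a b (same-sorted (lo l) (hi l) (toℕ a) (toℕ b) (lo<hi l) a<b e))))

    arrow-indicator′ : ∀ l {a b} → toℕ a < toℕ b → + b2n (isArcNo τ l a b) ≡ indicator initial l (toℕ b) (toℕ a)
    arrow-indicator′ l {a} {b} a<b =
      trans (arrow-indicator l a<b) (indicator-sym initial l (toℕ a) (toℕ b))

    u<z : toℕ u < toℕ z
    u<z = proj₁ (between (toℕ u) (toℕ v) (toℕ z) (lo<hi h) (proj₁ inner′))

    z<v : toℕ z < toℕ v
    z<v = proj₂ (between (toℕ u) (toℕ v) (toℕ z) (lo<hi h) (proj₁ inner′))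

    outside : toℕ v < toℕ x ⊎ toℕ x < toℕ u
    outside with proj₁ outer′
    ... | inj₁ (_ , v<x)        = inj₁ v<x
    ... | inj₂ (inj₁ (v<x , _)) = inj₁ v<x
    ... | inj₂ (inj₂ (x<u , _)) = inj₂ x<u

    module _ (l : Fin n) where
      private
        g = indicator initial l

      out-count : + QT τ h l ≡ g (toℕ v) (toℕ x) ℤ.+ g (toℕ u) (toℕ z)
      out-count = trans (cong +_ (out-arrows l)) (trans (cong +_ (values outside)) (split outside))
        where
        count : toℕ v < toℕ x ⊎ toℕ x < toℕ u → ℕ
        count (inj₁ _) = b2n (isArcNo τ l v x)
        count (inj₂ _) = b2n (isArcNo τ l x v)
        values : ∀ o → as-ab (λ a b c → isArcNo τ l b c) + as-bc (λ a b c → isArcNo τ l a c)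
                         + as-ac (λ a b c → isArcNo τ l a b) ≡ count o + b2n (isArcNo τ l u z)
        values (inj₁ v<x) = cong₂ _+_ (trans (cong₂ _+_ (as-ab-value v<x _) (as-bc-none v<x _))
                                             (ℕₚ.+-identityʳ _)) (as-ac-value _)
        values (inj₂ x<u) = cong₂ _+_ (cong₂ _+_ (as-ab-none x<u _) (as-bc-value x<u _)) (as-ac-value _)
        split : ∀ o → + (count o + b2n (isArcNo τ l u z)) ≡ g (toℕ v) (toℕ x) ℤ.+ g (toℕ u) (toℕ z)
        split (inj₁ v<x) = cong₂ ℤ._+_ (arrow-indicator l v<x) (arrow-indicator l u<z)
        split (inj₂ x<u) = cong₂ ℤ._+_ (arrow-indicator′ l (ℕₚ.<-trans x<u (lo<hi h))) (arrow-indicator l u<z)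

      in-count : + QT τ l h ≡ g (toℕ x) (toℕ u) ℤ.+ g (toℕ z) (toℕ v)
      in-count = trans (cong +_ (in-arrows l)) (trans (cong +_ (values outside)) (split outside))
        where
        count : toℕ v < toℕ x ⊎ toℕ x < toℕ u → ℕ
        count (inj₁ _) = b2n (isArcNo τ l u x)
        count (inj₂ _) = b2n (isArcNo τ l x u)
        values : ∀ o → as-bc (λ a b c → isArcNo τ l a b) + as-ac (λ a b c → isArcNo τ l b c)
                         + as-ab (λ a b c → isArcNo τ l a c) ≡ count o + b2n (isArcNo τ l z v)
        values (inj₁ v<x) = trans (cong₂ _+_ (cong₂ _+_ (as-bc-none v<x _) (as-ac-value _)) (as-ab-value v<x _))
                                  (ℕₚ.+-comm (b2n (isArcNo τ l z v)) _)
        values (inj₂ x<u) = trans (cong₂ _+_ (cong₂ _+_ (as-bc-value x<u _) (as-ac-value _)) (as-ab-none x<u _))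
                                  (ℕₚ.+-identityʳ _)
        split : ∀ o → + (count o + b2n (isArcNo τ l z v)) ≡ g (toℕ x) (toℕ u) ℤ.+ g (toℕ z) (toℕ v)
        split (inj₁ v<x) = cong₂ ℤ._+_ (arrow-indicator′ l (ℕₚ.<-trans (lo<hi h) v<x)) (arrow-indicator l z<v)
        split (inj₂ x<u) = cong₂ ℤ._+_ (arrow-indicator l x<u) (arrow-indicator l z<v)

      shear-count : shear initial h g ≡ + QT τ h l ℤ.- + QT τ l h
      shear-count =
        trans (cong₂ (λ x z → (g (hi h) x ℤ.- g x (lo h)) ℤ.+ (g (lo h) z ℤ.- g z (hi h))) (sym x-apex) (sym z-apex))
        (trans (regroup (g (toℕ v) (toℕ x)) (g (toℕ x) (toℕ u)) (g (toℕ u) (toℕ z)) (g (toℕ z) (toℕ v)))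
               (cong₂ ℤ._-_ (sym out-count) (sym in-count)))
        where
        regroup : ∀ a b c d → (a ℤ.- b) ℤ.+ (c ℤ.- d) ≡ (a ℤ.+ c) ℤ.- (b ℤ.+ d)
        regroup = solve-∀

      -- Arrows from `h` lead to `u z` and `v x`, arrows to `h` come from `z v` and `x u`. An arc
      -- cannot belong to both pairs of opposite sides, so there are no 2-cycles.
      one-way : QT τ h l ≡ 0 ⊎ QT τ l h ≡ 0
      one-way = decide (same? (lo l) (hi l) (toℕ u) (toℕ z)) (same? (lo l) (hi l) (toℕ v) (toℕ x))
        where
        cuzv : Cyc (toℕ u) (toℕ z) (toℕ v)
        cuzv = inj₁ (u<z , z<v)
        cvxu : Cyc (toℕ v) (toℕ x) (toℕ u)
        cvxu = cyc-rotate (toℕ u) (toℕ v) (toℕ x) (proj₁ outer′)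
        apart = quad-sides-distinct (toℕ u) (toℕ z) (toℕ v) (toℕ x) (lo l) (hi l) cuzv cvxu
        none-in : Same (lo l) (hi l) (toℕ u) (toℕ z) ⊎ Same (lo l) (hi l) (toℕ v) (toℕ x) → QT τ l h ≡ 0
        none-in s = ℤₚ.+-injective (trans in-count (cong₂ ℤ._+_
          (χ-no (same? (lo l) (hi l) (toℕ x) (toℕ u)) (proj₂ (apart s)))
          (χ-no (same? (lo l) (hi l) (toℕ z) (toℕ v)) (proj₁ (apart s)))))
        decide : Dec (Same (lo l) (hi l) (toℕ u) (toℕ z)) → Dec (Same (lo l) (hi l) (toℕ v) (toℕ x)) →
                 QT τ h l ≡ 0 ⊎ QT τ l h ≡ 0
        decide (yes p) _ = inj₂ (none-in (inj₁ p))
        decide _ (yes p) = inj₂ (none-in (inj₂ p))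
        decide (no p) (no q) = inj₁ (ℤₚ.+-injective (trans out-count (cong₂ ℤ._+_
          (χ-no (same? (lo l) (hi l) (toℕ v) (toℕ x)) q)
          (χ-no (same? (lo l) (hi l) (toℕ u) (toℕ z)) p))))

      arrow-row : Row (framed (QT τ)) h (inj₁ l) (shear initial h g)
      arrow-row = subst (Row (framed (QT τ)) h (inj₁ l)) (sym shear-count)
        (row (sym (proj₁ parts)) (sym (proj₂ parts)))
        where parts = ⁺-difference (QT τ h l) (QT τ l h) one-way

    -- Initially the lamination of j meets only j in opposite sides of its quadrilateral.
    shear-lamination : ∀ j → shear initial h (lamination (lo j) (hi j)) ≡ χ (h Fin.≟ j)
    shear-lamination j with h Fin.≟ j
    ... | yes refl = shear-straddles initial-triangulated h (lo<hi h) (inj₁ (inj₁ refl , inj₁ refl))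
    ... | no h≢j = go (cut? c d w) (cut? c d x′) (cut? c d y) (cut? c d z′)
        (shear-zero-cut w x′ y z′ c d (lo<hi j) F.wxy F.yzw
          (miss F.side-wx) (miss F.side-xy) (miss F.side-yz) (miss F.side-zw)
          (miss (arc-side h (inj₁ (refl , refl)))) λ e → h≢j (distinct h j e))
      where
      module F = Polygon.Flip m initial-triangulated h
      open Quad initial h using (w; y) renaming (x to x′; z to z′)
      c = lo j
      d = hi j
      miss : ∀ {a b} → Side a b → ¬ Cross a b c d
      miss ab = noncrossing-side ab (arc-side j (inj₁ (refl , refl)))
      Level : (w x y z : ℕ) → Set
      Level w x y z = (Cut c d w × Cut c d y) ⊎ (¬ Cut c d w × ¬ Cut c d y) ⊎
                      (Cut c d x × Cut c d z) ⊎ (¬ Cut c d x × ¬ Cut c d z)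
      go : (w∈ : Dec (Cut c d w)) (x∈ : Dec (Cut c d x′)) (y∈ : Dec (Cut c d y)) (z∈ : Dec (Cut c d z′)) →
           Level w x′ y z′ →
           (χ y∈ ℤ.* χ z∈ ℤ.- χ z∈ ℤ.* χ w∈) ℤ.+ (χ w∈ ℤ.* χ x∈ ℤ.- χ x∈ ℤ.* χ y∈) ≡ 0ℤ
      go (no ¬w) _ _ _ (inj₁ (w , _)) = ⊥-elim (¬w w)
      go _ _ (no ¬y) _ (inj₁ (_ , y)) = ⊥-elim (¬y y)
      go (yes w) _ _ _ (inj₂ (inj₁ (¬w , _))) = ⊥-elim (¬w w)
      go _ _ (yes y) _ (inj₂ (inj₁ (_ , ¬y))) = ⊥-elim (¬y y)
      go _ (no ¬x) _ _ (inj₂ (inj₂ (inj₁ (x , _)))) = ⊥-elim (¬x x)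
      go _ _ _ (no ¬z) (inj₂ (inj₂ (inj₁ (_ , z)))) = ⊥-elim (¬z z)
      go _ (yes x) _ _ (inj₂ (inj₂ (inj₂ (¬x , _)))) = ⊥-elim (¬x x)
      go _ _ _ (yes z) (inj₂ (inj₂ (inj₂ (_ , ¬z)))) = ⊥-elim (¬z z)
      go (yes _) (yes _) (yes _) (yes _) _ = refl
      go (yes _) (yes _) (yes _) (no _)  _ = refl
      go (yes _) (no _)  (yes _) (yes _) _ = refl
      go (yes _) (no _)  (yes _) (no _)  _ = refl
      go (no _)  (yes _) (no _)  (yes _) _ = refl
      go (no _)  (yes _) (no _)  (no _)  _ = refl
      go (no _)  (no _)  (no _)  (yes _) _ = refl
      go (no _)  (no _)  (no _)  (no _)  _ = refl
      go (yes _) (yes _) (no _)  (yes _) _ = refl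
      go (no _)  (yes _) (yes _) (yes _) _ = refl
      go (yes _) (no _)  (no _)  (no _)  _ = refl
      go (no _)  (no _)  (yes _) (no _)  _ = refl

    frozen-row : ∀ j → Row (framed (QT τ)) h (inj₂ j) (shear initial h (lamination (lo j) (hi j)))
    frozen-row j = subst (Row (framed (QT τ)) h (inj₂ j)) (sym (shear-lamination j)) (value (h Fin.≟ j) refl)
      where
      value : (d : Dec (h ≡ j)) → d ≡ (h Fin.≟ j) → Row (framed (QT τ)) h (inj₂ j) (χ d)
      value (yes p) e = row (cong (λ d → if does d then 1 else 0) (sym e)) refl
      value (no p)  e = row (cong (λ d → if does d then 1 else 0) (sym e)) refl

  initial-models : Models lo hi initial (framed (QT τ))
  initial-models h (inj₁ l) = ArcRow.arrow-row h l
  initial-models h (inj₂ j) = ArcRow.frozen-row h j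

-- Counting

pack : ∀ {k} (f : Fin k → ℕ) i → Fin (f i) → Fin (sumFin f)
pack f Fin.zero    a = a ↑ˡ _
pack f (Fin.suc i) a = f Fin.zero ↑ʳ pack (λ i → f (Fin.suc i)) i a

unpack : ∀ {k} (f : Fin k → ℕ) (t : Fin (sumFin f)) → ∃ λ i → ∃ λ (a : Fin (f i)) → t ≡ pack f i a
unpack {suc k} f t with splitAt (f Fin.zero) t in split
... | inj₁ a = Fin.zero , a , sym (Finₚ.splitAt⁻¹-↑ˡ split)
... | inj₂ b with unpack (λ i → f (Fin.suc i)) b
...   | i , a , e = Fin.suc i , a , trans (sym (Finₚ.splitAt⁻¹-↑ʳ split)) (cong (f Fin.zero ↑ʳ_) e)

b2n-inhabited : ∀ {b} → Fin (b2n b) → T b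
b2n-inhabited {true} _ = _

b2n-unique : ∀ {b} (i j : Fin (b2n b)) → i ≡ j
b2n-unique {true} Fin.zero Fin.zero = refl

module _ {k : ℕ} (B : Fin k → Fin k → Fin k → Bool) where

  private
    F : Fin k → Fin k → Fin k → ℕ
    F a b c = b2n (B a b c)

    encode : ∀ a b c → Fin (F a b c) → Fin (sum³ F)
    encode a b c d = pack _ a (pack _ b (pack _ c d))

  -- As every summand is 0 or 1, the numbers below the triple sum correspond to the triples that
  -- pass the test.
  record Counted (t : Fin (sum³ F)) : Set where
    constructor counted
    field
      a b c   : Fin k
      mark    : Fin (F a b c)
      encoded : t ≡ encode a b c mark

  count : ∀ t → Counted t
  count t with unpack _ t
  ... | a , t₁ , e with unpack _ t₁
  ...   | b , t₂ , e₁ with unpack _ t₂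
  ...     | c , d , e₂ = counted a b c d
    (trans e (cong (pack _ a) (trans e₁ (cong (pack _ b) e₂))))

  counted-injective : ∀ {t t′} (s : Counted t) (s′ : Counted t′) → Counted.a s ≡ Counted.a s′ →
                      Counted.b s ≡ Counted.b s′ → Counted.c s ≡ Counted.c s′ → t ≡ t′
  counted-injective (counted a b c d e) (counted _ _ _ d′ e′) refl refl refl =
    trans e (trans (cong (encode a b c) (b2n-unique d d′)) (sym e′))

ends-determine = order 4 (λ a b c d → a <ᶠ b ⇒ᶠ c <ᶠ d ⇒ᶠ c ≡ᶠ a ∨ᶠ d ≡ᶠ a ⇒ᶠ c ≡ᶠ b ∨ᶠ d ≡ᶠ b ⇒ᶠ same a b c d) refl

three-corners = order 5 (λ a b c d e → a <ᶠ b ⇒ᶠ b <ᶠ c ⇒ᶠ d ≡ᶠ a ∨ᶠ e ≡ᶠ a ⇒ᶠ d ≡ᶠ b ∨ᶠ e ≡ᶠ b ⇒ᶠ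
  d ≡ᶠ c ∨ᶠ e ≡ᶠ c ⇒ᶠ ff) refl

corners-determine = order 6 (λ a b c d e f → a <ᶠ b ⇒ᶠ b <ᶠ c ⇒ᶠ d <ᶠ e ⇒ᶠ e <ᶠ f ⇒ᶠ
  d ≡ᶠ a ∨ᶠ e ≡ᶠ a ∨ᶠ f ≡ᶠ a ⇒ᶠ d ≡ᶠ b ∨ᶠ e ≡ᶠ b ∨ᶠ f ≡ᶠ b ⇒ᶠ d ≡ᶠ c ∨ᶠ e ≡ᶠ c ∨ᶠ f ≡ᶠ c ⇒ᶠ
  a ≡ᶠ d ∧ᶠ b ≡ᶠ e ∧ᶠ c ≡ᶠ f) refl

module Count {m n : ℕ} (τ : Fin n → Seg m) (tri : IsTriangulation m n τ) {L : ℕ} (Support : Fin L → ℕ → Set)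
  (arc-witness : ∀ j → Realised Support λ v → Initial.lo τ tri j ≡ v ⊎ Initial.hi τ tri j ≡ v)
  (triangle-witness : ∀ a b c → T (isInteriorTriangle τ a b c) →
     (toℕ a < toℕ b × toℕ b < toℕ c) × Realised Support (Corner (toℕ a) (toℕ b) (toℕ c)))
  where
  open Initial τ tri

  Interior : Fin m → Fin m → Fin m → Bool
  Interior = isInteriorTriangle τ

  record TrianglePosition (t : Fin (interiorTriangles τ)) : Set where
    field
      located : Counted Interior t
    open Counted located public
    field
      a<b     : toℕ a < toℕ b
      b<c     : toℕ b < toℕ c
      witness : Realised Support (Corner (toℕ a) (toℕ b) (toℕ c))

  trianglePosition : ∀ t → TrianglePosition t
  trianglePosition t = record { located = s ; a<b = proj₁ (proj₁ w) ; b<c = proj₂ (proj₁ w) ; witness = proj₂ w }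
    where
    s = count Interior t
    w = triangle-witness (Counted.a s) (Counted.b s) (Counted.c s) (b2n-inhabited (Counted.mark s))

  position : Fin n ⊎ Fin (interiorTriangles τ) → Fin L
  position (inj₁ j) = proj₁ (arc-witness j)
  position (inj₂ t) = proj₁ (TrianglePosition.witness (trianglePosition t))

  arc-supported : ∀ j v {i} → position (inj₁ j) ≡ i → Support i v → lo j ≡ v ⊎ hi j ≡ v
  arc-supported j v refl = proj₁ (proj₂ (arc-witness j)) v

  arc-supports : ∀ j v → lo j ≡ v ⊎ hi j ≡ v → Support (position (inj₁ j)) v
  arc-supports j = proj₂ (proj₂ (arc-witness j))

  arc≢triangle : ∀ j t → position (inj₁ j) ≢ position (inj₂ t)
  arc≢triangle j t e = three-corners (toℕ a) (toℕ b) (toℕ c) (lo j) (hi j) a<b b<c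
    (end (inj₁ refl)) (end (inj₂ (inj₁ refl))) (end (inj₂ (inj₂ refl)))
    where
    open TrianglePosition (trianglePosition t)
    end : ∀ {v} → Corner (toℕ a) (toℕ b) (toℕ c) v → lo j ≡ v ⊎ hi j ≡ v
    end {v} h = arc-supported j v e (proj₂ (proj₂ witness) v h)

  position-injective : ∀ s s′ → position s ≡ position s′ → s ≡ s′
  position-injective (inj₁ j) (inj₁ j′) e = cong inj₁ (initial-distinct j j′
    (ends-determine (lo j) (hi j) (lo j′) (hi j′) (lo<hi j) (lo<hi j′) (end (inj₁ refl)) (end (inj₂ refl))))
    where
    end : ∀ {v} → lo j ≡ v ⊎ hi j ≡ v → lo j′ ≡ v ⊎ hi j′ ≡ v
    end {v} h = arc-supported j′ v (sym e) (arc-supports j v h)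
  position-injective (inj₁ j) (inj₂ t) e = ⊥-elim (arc≢triangle j t e)
  position-injective (inj₂ t) (inj₁ j) e = ⊥-elim (arc≢triangle j t (sym e))
  position-injective (inj₂ t) (inj₂ t′) e = cong inj₂ (counted-injective Interior P.located P′.located
      (Finₚ.toℕ-injective (proj₁ agree)) (Finₚ.toℕ-injective (proj₁ (proj₂ agree)))
      (Finₚ.toℕ-injective (proj₂ (proj₂ agree))))
    where
    module P = TrianglePosition (trianglePosition t)
    module P′ = TrianglePosition (trianglePosition t′)
    corner : ∀ {v} → Corner (toℕ P.a) (toℕ P.b) (toℕ P.c) v → Corner (toℕ P′.a) (toℕ P′.b) (toℕ P′.c) v
    corner {v} h = proj₁ (proj₂ P′.witness) v (subst (λ i → Support i v) e (proj₂ (proj₂ P.witness) v h))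
    agree = corners-determine (toℕ P.a) (toℕ P.b) (toℕ P.c) (toℕ P′.a) (toℕ P′.b) (toℕ P′.c)
      P.a<b P.b<c P′.a<b P′.b<c (corner (inj₁ refl)) (corner (inj₂ (inj₁ refl))) (corner (inj₂ (inj₂ refl)))

  bound : n + interiorTriangles τ ≤ L
  bound = Finₚ.injective⇒≤ {f = λ i → position (splitAt n i)} λ {i} {i′} e →
    trans (sym (Finₚ.join-splitAt n _ i))
      (trans (cong (join n _) (position-injective (splitAt n i) (splitAt n i′) e)) (Finₚ.join-splitAt n _ i′))

module Witnessed {m n : ℕ} (τ : Fin n → Seg m) (tri : IsTriangulation m n τ) {L : ℕ}
                 (R : Runs.Run m (Initial.lo τ tri) (Initial.hi τ tri) (Initial.initial τ tri) L) where
  open Initial τ tri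
  open InitialQuiver τ tri
  open Runs.Along m lo hi R using (Support)
  open Witnesses m initial-triangulated R

  interior-witness : ∀ a b c → T (isInteriorTriangle τ a b c) → (toℕ a < toℕ b × toℕ b < toℕ c)
                     × Realised Support (Corner (toℕ a) (toℕ b) (toℕ c))
  interior-witness a b c h₀ with T-∧⁻ {toℕ a <ᵇ toℕ b} h₀
  ... | a<b , h₁ with T-∧⁻ {toℕ b <ᵇ toℕ c} h₁
  ...   | b<c , h₂ with T-∧⁻ {isArc τ a b} h₂
  ...     | ab , h₃ with T-∧⁻ {isArc τ b c} h₃
  ...       | bc , ac with isArc⁻ a b ab | isArc⁻ b c bc | isArc⁻ a c ac
  ...         | l , e | k , e′ | j , e″ = sorted ,
    triangle-witness {j = j} {k} {l} (inj₁ sorted) (inj₁ e″) (inj₁ e′) (inj₁ e)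
    where
    sorted : toℕ a < toℕ b × toℕ b < toℕ c
    sorted = ℕₚ.<ᵇ⇒< (toℕ a) (toℕ b) a<b , ℕₚ.<ᵇ⇒< (toℕ b) (toℕ c) b<c

  bound : n + interiorTriangles τ ≤ L
  bound = Count.bound τ tri Support arc-witness interior-witness

theorem7p2 : (m n : ℕ) → 3 ≤ m → (T : Fin n → Seg m) → IsTriangulation m n T →
    (ks : List (Fin n)) → IsMaximalGreenSequence (QT T) ks →
    n + interiorTriangles T ≤ length ks
theorem7p2 m n _ T tri ks green = Witnessed.bound T tri
  (Runs.run m lo hi lo<hi ks initial-triangulated (InitialQuiver.initial-models T tri) green)
  where open Initial T tri
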